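{- Suppose that every quasi-line graph $G$ satisfying $\chi_l(G) \geq \Delta(G) \geq 9$ contains a complete subgraph on $\Delta(G)$ vertices. Then every claw-free graph $G$ satisfying $\chi_l(G) \geq \Delta(G) \geq 9$ contains a complete subgraph on $\Delta(G)$ vertices.
   Context: Graphs are finite and simple. $\Delta(G)$ is the maximum degree and $\chi_l(G)$ the list chromatic number (choice number) of $G$. A graph is claw-free if it has no induced subgraph isomorphic to $K_{1,3}$. A graph is quasi-line if for every vertex $v$ the neighborhood $N(v)$ can be covered by two cliques. -}

module Defs where

open import Data.Bool.Base using (Bool)
import Data.Bool.Properties as Bool
open import Data.Fin.Base using (Fin; toℕ)
open import Data.Fin.Subset using (Subset; _∈_; _⊆_; _∪_; ∣_∣)
open import Data.List.Base using (map; allFin)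
open import Data.List.Extrema.Nat using (max)
open import Data.Nat.Base using (ℕ; _+_; _≤_)
open import Data.Nat.Properties using (_<?_)
open import Data.Product.Base using (_×_; ∃; ∃₂)
open import Data.Vec.Base using (tabulate)
open import Function.Bundles using (_⇔_)
open import Function.Definitions using (Injective)
open import Level using (0ℓ)
open import Relation.Binary.Core using (Rel)
open import Relation.Binary.Definitions using (Decidable; Symmetric; Irreflexive)
open import Relation.Binary.PropositionalEquality using (_≡_; _≢_; refl; ≢-sym)
open import Relation.Nullary.Decidable using (does; ¬?)
open import Relation.Nullary.Negation using (¬_)

record Graph (n : ℕ) : Set₁ where
  infix 4 _~_ _~?_
  field
    _~_      : Rel (Fin n) 0ℓ
    _~?_     : Decidable _~_
    ~-sym    : Symmetric _~_
    ~-irrefl : Irreflexive _≡_ _~_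

  N : Fin n → Subset n
  N v = tabulate (λ u → does (v ~? u))

  deg : Fin n → ℕ
  deg v = ∣ N v ∣

  -- The graph on no vertices has maximum degree 0.
  Δ : ℕ
  Δ = max 0 (map deg (allFin n))

  IsClique : Subset n → Set
  IsClique S = ∀ {u v} → u ∈ S → v ∈ S → u ≢ v → u ~ v

  ContainsComplete : ℕ → Set
  ContainsComplete k = ∃ λ S → IsClique S × ∣ S ∣ ≡ k

  QuasiLine : Set
  QuasiLine = ∀ v → ∃₂ λ A B → IsClique A × IsClique B × N v ⊆ A ∪ B

  -- Only finitely many colours occur in the lists of a finite graph, so the
  -- lists are taken to be subsets of a palette Fin m, for arbitrary m.
  ListAssignment : ℕ → Set
  ListAssignment m = Fin n → Subset m

  Colourable : ∀ {m} → ListAssignment m → Set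
  Colourable {m} L = ∃ λ (φ : Fin n → Fin m) →
    (∀ v → φ v ∈ L v) × (∀ {u v} → u ~ v → φ u ≢ φ v)

  Choosable : ℕ → Set
  Choosable k = ∀ {m} (L : ListAssignment m) → (∀ v → ∣ L v ∣ ≡ k) → Colourable L

  -- The list chromatic number as a relation: c is the least k such that the
  -- graph is k-choosable.
  IsListChromaticNumber : ℕ → Set
  IsListChromaticNumber c = Choosable c × (∀ k → Choosable k → c ≤ k)

-- H is isomorphic to the subgraph of G induced on the image of f.
IsInducedEmbedding : ∀ {m n} → Graph m → Graph n → (Fin m → Fin n) → Set
IsInducedEmbedding H G f =
  Injective _≡_ _≡_ f × (∀ u v → (u H.~ v) ⇔ (f u G.~ f v))
  where
  module H = Graph H
  module G = Graph G

-- The complete bipartite graph; the first a vertices form one of the parts.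
K : (a b : ℕ) → Graph (a + b)
K a b = record
  { _~_      = λ u v → part u ≢ part v
  ; _~?_     = λ u v → ¬? (part u Bool.≟ part v)
  ; ~-sym    = ≢-sym
  ; ~-irrefl = λ { refl p≢p → p≢p refl }
  }
  where
  part : Fin (a + b) → Bool
  part u = does (toℕ u <? a)

ClawFree : ∀ {n} → Graph n → Set
ClawFree G = ¬ ∃ (IsInducedEmbedding (K 1 3) G)

{-# OPTIONS --safe #-}
module Submission where

-- Let G be claw-free with maximum degree Δ ≥ 9, and let S be a minimal set of
-- vertices that is not colourable from given lists of size Δ - 1. Every vertex of
-- S has degree at least Δ - 1 in S, and S has no induced subgraph that is
-- colourable whenever each list has at least degree - 1 colours; many such
-- subgraphs are found by the Alon-Tarsi theorem. If the neighbourhood of v in S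
-- is not covered by two cliques, then it contains an induced 5-cycle, as its
-- complement is a triangle-free graph that is not bipartite and excludes some of
-- these subgraphs. Together with three further neighbours of v, and with a vertex
-- outside of the neighbourhood of v that some vertex of it is adjacent to for
-- reasons of degree, this 5-cycle always yields a claw or one of the excluded
-- subgraphs. Hence S induces a quasi-line graph, whose list chromatic number is
-- at least Δ.

open import Defs
open import Data.Bool using (T?)
open import Data.Bool.Base using (Bool; true; false; if_then_else_; _∨_; T; _∧_; not)
open import Data.Bool.ListAction using (all; any)
open import Data.Bool.Properties using (T-∧; T-∨; T-≡)
import Data.Bool.Properties as Bool
open import Data.Empty using (⊥)
open import Data.Fin.Base using (Fin; zero; suc; toℕ; splitAt; _↑ˡ_; _↑ʳ_; finToFun; funToFin)
open import Data.Fin.Properties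
  using (suc-injective; _≟_; toℕ-injective; any?; all?; splitAt-↑ˡ; splitAt-↑ʳ; splitAt⁻¹-↑ˡ; splitAt⁻¹-↑ʳ;
    ↑ˡ-injective; ↑ʳ-injective; finToFun-funToFin)
open import Data.Fin.Subset using (Subset; inside; outside; _∈_; _⊆_; ∣_∣; _⊂_; _∪_; ⊤) renaming (⊥ to ⊥ˢ)
open import Data.Fin.Subset.Induction using (⊂-wellFounded)
open import Data.Fin.Subset.Properties using (_∈?_; x∈p∪q⁺; x∈p∪q⁻; anySubset?; ∈⊤; ∉⊥)
open import Data.Integer.Base
  using (ℤ; 0ℤ; 1ℤ) renaming (_+_ to _+ℤ_; _*_ to _*ℤ_; _-_ to _-ℤ_; _^_ to _^ℤ_; +_ to pos)
import Data.Integer.Properties as ℤ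
open import Data.Integer.Tactic.RingSolver using (solve-∀)
open import Data.List.Base as List
  using (List; []; _∷_; _++_; length; map; filter; cartesianProduct; allFin; upTo; filterᵇ; take)
open import Data.List.Extrema.Nat using (xs≤max; max≤v⁺)
open import Data.List.Membership.Propositional using () renaming (_∈_ to _∈ˡ_; _∉_ to _∉ˡ_)
open import Data.List.Membership.Propositional.Properties
  using (∈-map⁺; ∈-map⁻; ∈-++⁺ˡ; ∈-++⁺ʳ; ∈-++⁻; ∈-∃++; ∈-filter⁺; ∈-filter⁻; ∈-upTo⁻; ∈-cartesianProduct⁺;
    ∈-allFin)
open import Data.List.Properties using (length-map; length-++; length-++-sucʳ; length-take; length-tabulate)
open import Data.List.Relation.Unary.All as All using (All; []; _∷_)
import Data.List.Relation.Unary.All.Properties as All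
open import Data.List.Relation.Unary.AllPairs using ([]; _∷_)
open import Data.List.Relation.Unary.Any using (here; there)
open import Data.List.Relation.Unary.Unique.Propositional using (Unique)
import Data.List.Relation.Unary.Unique.Propositional.Properties as Unique
open import Data.Nat.Base using (ℕ; zero; suc; _+_; _≤_; z≤n; s≤s; pred; _≤ᵇ_; _<_; _≡ᵇ_; _⊓_; _<ᵇ_; _^_; _≥_)
open import Data.Nat.Induction using (<-rec)
import Data.Nat.Properties as ℕ
open import Data.Nat.Solver using (module +-*-Solver)
open import Data.Product.Base using (_×_; _,_; ∃; proj₁; proj₂; ∃₂)
open import Data.Sum.Base using (inj₁; inj₂; [_,_]′; _⊎_)
open import Data.Unit.Base using (tt)
open import Data.Vec.Base as Vec using (Vec; []; _∷_; here; there; lookup; updateAt; sum)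
open import Data.Vec.Properties using (lookup∘tabulate; lookup⇒[]=; []=⇒lookup)
import Data.Vec.Properties as Vec
open import Data.Vec.Relation.Binary.Pointwise.Inductive as Pointwise using (Pointwise; []; _∷_)
open import Function.Base using (_∘_; case_of_)
open import Function.Bundles using (Equivalence; mk⇔)
import Induction.WellFounded as WellFounded
open import Level using (Level)
open import Relation.Binary.Definitions using (DecidableEquality; tri<; tri≈; tri>; Symmetric; Irreflexive)
import Relation.Binary.Definitions as Binary
open import Relation.Binary.PropositionalEquality
open import Relation.Nullary.Decidable
  using (Dec; yes; no; does; ¬?; _×-dec_; decidable-stable; from-yes; _⊎-dec_; _→-dec_; map′)
open import Relation.Nullary.Negation using (¬_; contradiction)
open import Relation.Unary using (Pred; Decidable)

-- The bound degree - 1 comes from counting: a vertex of S has Δ - 1 colours and at most Δ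
-- neighbours. If d of these lie in a subgraph that is removed, colouring the rest of S forbids at
-- most Δ - d colours, and d - 1 are left. In the triangle-free complement of a neighbourhood, the
-- excluded induced subgraphs include the path on six vertices. It is contained in every induced
-- cycle of length at least 7, which is why an obstruction to bipartiteness comes down to a 5-cycle.
-- A neighbour of v misses only pairwise adjacent vertices of the 5-cycle, as otherwise v is the
-- centre of a claw. So it is adjacent to all of the cycle, to four, or to three consecutive
-- vertices, and in the last case it acts as a clone of the middle one. Three clones are what is
-- needed: two of the same vertex give the sizes 3,1,1,1,1, and three of distinct vertices give
-- 2,2,1,1,2 or 1,2,2,1,2. The bound Δ ≥ 9 supplies 5 + 3 neighbours inside S. Minimality and the
-- existence of the list chromatic number are available only up to double negation. Colourability
-- from given lists and containment of a clique are decidable, so the conclusions are stable.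

private variable
  a p : Level
  A : Set a
  n m t : ℕ

-- Counting by lists

unique-⊆-length : {xs ys : List A} → Unique xs → (∀ {x} → x ∈ˡ xs → x ∈ˡ ys) → length xs ≤ length ys
unique-⊆-length {xs = []} _ _ = z≤n
unique-⊆-length {xs = x ∷ xs} {ys} (x∉ ∷ uxs) sub with us , vs , refl ← ∈-∃++ (sub (here refl)) =
  ℕ.≤-trans (s≤s (unique-⊆-length uxs sub′)) (ℕ.≤-reflexive (sym (length-++-sucʳ us x _)))
  where
  sub′ : ∀ {y} → y ∈ˡ xs → y ∈ˡ us ++ vs
  sub′ y∈ with ∈-++⁻ us (sub (there y∈))
  ... | inj₁ y∈us = ∈-++⁺ˡ y∈us
  ... | inj₂ (here refl) = contradiction refl (All.lookup x∉ y∈)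
  ... | inj₂ (there y∈vs) = ∈-++⁺ʳ us y∈vs

elements : Subset n → List (Fin n)
elements [] = []
elements (inside ∷ s) = zero ∷ map suc (elements s)
elements (outside ∷ s) = map suc (elements s)

length-elements : (s : Subset n) → length (elements s) ≡ ∣ s ∣
length-elements [] = refl
length-elements (inside ∷ s) = cong suc (trans (length-map suc (elements s)) (length-elements s))
length-elements (outside ∷ s) = trans (length-map suc (elements s)) (length-elements s)

∈-elements⁺ : {s : Subset n} {x : Fin n} → x ∈ s → x ∈ˡ elements s
∈-elements⁺ {s = inside ∷ s} here = here refl
∈-elements⁺ {s = inside ∷ s} (there x∈s) = there (∈-map⁺ suc (∈-elements⁺ x∈s))
∈-elements⁺ {s = outside ∷ s} (there x∈s) = ∈-map⁺ suc (∈-elements⁺ x∈s)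

∈-elements⁻ : (s : Subset n) {x : Fin n} → x ∈ˡ elements s → x ∈ s
∈-elements⁻ (inside ∷ s) (here refl) = here
∈-elements⁻ (inside ∷ s) (there x∈) with _ , y∈ , refl ← ∈-map⁻ suc x∈ = there (∈-elements⁻ s y∈)
∈-elements⁻ (outside ∷ s) x∈ with _ , y∈ , refl ← ∈-map⁻ suc x∈ = there (∈-elements⁻ s y∈)

elements-unique : (s : Subset n) → Unique (elements s)
elements-unique [] = []
elements-unique (inside ∷ s) = All.tabulate zero∉ ∷ Unique.map⁺ suc-injective (elements-unique s)
  where
  zero∉ : ∀ {x} → x ∈ˡ map suc (elements s) → zero ≢ x
  zero∉ x∈ refl with _ , _ , () ← ∈-map⁻ suc x∈
elements-unique (outside ∷ s) = Unique.map⁺ suc-injective (elements-unique s)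

unique-length≤∣∣ : {xs : List (Fin n)} (s : Subset n) → Unique xs → (∀ {x} → x ∈ˡ xs → x ∈ s) → length xs ≤ ∣ s ∣
unique-length≤∣∣ s uxs sub =
  ℕ.≤-trans (unique-⊆-length uxs (∈-elements⁺ ∘ sub)) (ℕ.≤-reflexive (length-elements s))

∣∣≤length : (s : Subset n) (ys : List (Fin n)) → (∀ {x} → x ∈ s → x ∈ˡ ys) → ∣ s ∣ ≤ length ys
∣∣≤length s ys sub =
  ℕ.≤-trans (ℕ.≤-reflexive (sym (length-elements s))) (unique-⊆-length (elements-unique s) (sub ∘ ∈-elements⁻ s))

module _ {P : Pred (Fin n) p} (P? : Decidable P) where

  -- For the predicate `v ~?_` this is literally `N v`, so the two membership lemmas below serve for
  -- neighbourhoods too.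
  separation : Subset n
  separation = Vec.tabulate (λ x → does (P? x))

  ∈-separation⁺ : ∀ {x} → P x → x ∈ separation
  ∈-separation⁺ {x} Px = lookup⇒[]= x _ (trans (lookup∘tabulate _ x) does≡true)
    where
    does≡true : does (P? x) ≡ true
    does≡true with P? x
    ... | yes _  = refl
    ... | no ¬Px = contradiction Px ¬Px

  ∈-separation⁻ : ∀ {x} → x ∈ separation → P x
  ∈-separation⁻ {x} x∈ with P? x in eq
  ... | yes Px = Px
  ... | no _ with () ← trans (sym (cong does eq)) (trans (sym (lookup∘tabulate _ x)) ([]=⇒lookup x∈))

module _ {A : Set a} (_≟_ : DecidableEquality A) where
  open import Data.List.Membership.DecPropositional _≟_ using () renaming (_∈?_ to _∈ˡ?_)

  _∖_ : List A → List A → List A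
  xs ∖ ys = filter (λ x → ¬? (x ∈ˡ? ys)) xs

  ∈-∖⁻ : ∀ xs ys {x} → x ∈ˡ xs ∖ ys → x ∈ˡ xs × x ∉ˡ ys
  ∈-∖⁻ xs ys = ∈-filter⁻ (λ x → ¬? (x ∈ˡ? ys)) {xs = xs}

  ∖-unique : ∀ {xs} ys → Unique xs → Unique (xs ∖ ys)
  ∖-unique ys = Unique.filter⁺ (λ x → ¬? (x ∈ˡ? ys))

  length-∖ : ∀ {xs} ys → Unique xs → length xs ≤ length (xs ∖ ys) + length ys
  length-∖ {xs} ys uxs = ℕ.≤-trans (unique-⊆-length uxs sub) (ℕ.≤-reflexive (length-++ (xs ∖ ys)))
    where
    sub : ∀ {x} → x ∈ˡ xs → x ∈ˡ (xs ∖ ys) ++ ys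
    sub {x} x∈xs with x ∈ˡ? ys
    ... | yes x∈ys = ∈-++⁺ʳ (xs ∖ ys) x∈ys
    ... | no x∉ys  = ∈-++⁺ˡ (∈-filter⁺ _ x∈xs x∉ys)

subset-of-size : ∀ k (s : Subset n) → k ≤ ∣ s ∣ → ∃ λ t → t ⊆ s × ∣ t ∣ ≡ k
subset-of-size k [] z≤n = [] , (λ ()) , refl
subset-of-size k (outside ∷ s) k≤ with t , t⊆s , eq ← subset-of-size k s k≤ =
  outside ∷ t , (λ { (there x∈) → there (t⊆s x∈) }) , eq
subset-of-size zero (inside ∷ s) k≤ with t , t⊆s , eq ← subset-of-size 0 s z≤n =
  outside ∷ t , (λ { (there x∈) → there (t⊆s x∈) }) , eq
subset-of-size (suc k) (inside ∷ s) (s≤s k≤) with t , t⊆s , eq ← subset-of-size k s k≤ =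
  inside ∷ t , (λ { here → here ; (there x∈) → there (t⊆s x∈) }) , cong suc eq

-- The Alon-Tarsi theorem

-- A signed measure with finite support, given by pairs of a point and its mass. Integral masses
-- avoid rational arithmetic at the price of a scaling factor.
Weights : Set
Weights = List (ℤ × ℤ)

integral : Weights → (ℤ → ℤ) → ℤ
integral [] f = 0ℤ
integral ((s , w) ∷ W) f = w *ℤ f s +ℤ integral W f

integral-cong : ∀ W {f g} → (∀ x → f x ≡ g x) → integral W f ≡ integral W g
integral-cong [] f≗g = refl
integral-cong ((s , w) ∷ W) f≗g = cong₂ (λ a b → w *ℤ a +ℤ b) (f≗g s) (integral-cong W f≗g)

integral-* : ∀ W f c → integral W (λ x → f x *ℤ c) ≡ integral W f *ℤ c
integral-* [] f c = refl
integral-* ((s , w) ∷ W) f c rewrite integral-* W f c = lemma w (f s) c (integral W f)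
  where
  lemma : ∀ w y c i → w *ℤ (y *ℤ c) +ℤ i *ℤ c ≡ (w *ℤ y +ℤ i) *ℤ c
  lemma = solve-∀

integral-- : ∀ W f g → integral W (λ x → f x -ℤ g x) ≡ integral W f -ℤ integral W g
integral-- [] f g = refl
integral-- ((s , w) ∷ W) f g rewrite integral-- W f g = lemma w (f s) (g s) (integral W f) (integral W g)
  where
  lemma : ∀ w a b i j → w *ℤ (a -ℤ b) +ℤ (i -ℤ j) ≡ (w *ℤ a +ℤ i) -ℤ (w *ℤ b +ℤ j)
  lemma = solve-∀

integral-vanishing : ∀ W {f} → (∀ {s} → s ∈ˡ map proj₁ W → f s ≡ 0ℤ) → integral W f ≡ 0ℤ
integral-vanishing [] z = refl
integral-vanishing ((s , w) ∷ W) z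
  rewrite z (here refl) | integral-vanishing W (λ s∈ → z (there s∈)) | ℤ.*-zeroʳ w = refl

moment : Weights → ℕ → ℤ
moment W j = integral W (_^ℤ j)

-- The moments of weights concentrated on e + 1 points that form, up to a
-- factor, the divided difference of order e.
Selects : ℕ → Weights → Set
Selects e W = (∀ {j} → j < e → moment W j ≡ 0ℤ) × moment W e ≢ 0ℤ

≢0-* : ∀ {x y} → x ≢ 0ℤ → y ≢ 0ℤ → x *ℤ y ≢ 0ℤ
≢0-* {x} x≢0 y≢0 xy≡0 = [ x≢0 , y≢0 ]′ (ℤ.i*j≡0⇒i≡0∨j≡0 x xy≡0)

-- Dividing each weight by s - s₀ lowers the moments; D clears the denominators.
divide : ∀ s₀ W → All (s₀ ≢_) (map proj₁ W) →
  ∃ λ D → ∃ λ W′ → D ≢ 0ℤ × map proj₁ W′ ≡ map proj₁ W ×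
  (∀ f → integral W′ (λ x → (x -ℤ s₀) *ℤ f x) ≡ D *ℤ integral W f)
divide s₀ [] [] = 1ℤ , [] , (λ ()) , refl , λ f → refl
divide s₀ ((s , w) ∷ W) (s₀≢s ∷ s₀∉) with D , W′ , D≢0 , same , eq ← divide s₀ W s₀∉ =
  D *ℤ (s -ℤ s₀) , (s , D *ℤ w) ∷ map (λ (t , u) → t , u *ℤ (s -ℤ s₀)) W′ ,
  ≢0-* D≢0 (λ s-s₀≡0 → s₀≢s (sym (ℤ.i-j≡0⇒i≡j s s₀ s-s₀≡0))) ,
  cong (s ∷_) (trans (points W′) same) ,
  λ f → trans (cong ((D *ℤ w) *ℤ ((s -ℤ s₀) *ℤ f s) +ℤ_) (trans (scaled W′ _) (cong (_*ℤ (s -ℤ s₀)) (eq f))))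
              (lemma D w (s -ℤ s₀) (f s) (integral W f))
  where
  points : ∀ V → map proj₁ (map (λ (t , u) → t , u *ℤ (s -ℤ s₀)) V) ≡ map proj₁ V
  points [] = refl
  points (x ∷ V) = cong (_ ∷_) (points V)
  scaled : ∀ V f → integral (map (λ (t , u) → t , u *ℤ (s -ℤ s₀)) V) f ≡ integral V f *ℤ (s -ℤ s₀)
  scaled [] f = refl
  scaled ((t , u) ∷ V) f rewrite scaled V f = rearrange u (s -ℤ s₀) (f t) (integral V f)
    where
    rearrange : ∀ u d y i → (u *ℤ d) *ℤ y +ℤ i *ℤ d ≡ (u *ℤ y +ℤ i) *ℤ d
    rearrange = solve-∀
  lemma : ∀ D w d y i → (D *ℤ w) *ℤ (d *ℤ y) +ℤ (D *ℤ i) *ℤ d ≡ (D *ℤ d) *ℤ (w *ℤ y +ℤ i)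
  lemma = solve-∀

-- Induction on the points, as for divided differences: passing from `W` to `V` raises by one the
-- order of the first nonvanishing moment, by the recurrence `step`.
selecting-weights : ∀ e S → Unique S → length S ≡ suc e → ∃ λ W → map proj₁ W ≡ S × Selects e W
selecting-weights zero (s ∷ []) u refl = (s , 1ℤ) ∷ [] , refl , (λ ()) , λ ()
selecting-weights (suc e) (s₀ ∷ S) (s₀∉ ∷ u) len
  with W , refl , below , top ← selecting-weights e S u (ℕ.suc-injective len)
  with D , W′ , D≢0 , same , eq ← divide s₀ W s₀∉ =
  V , cong (s₀ ∷_) same , vanish , nonzero
  where
  V : Weights
  -- The mass at `s₀` does not affect integrals of multiples of x - s₀, so it is free to cancel the
  -- total mass.
  V = (s₀ , 0ℤ -ℤ moment W′ 0) ∷ W′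
  moment₀ : moment V 0 ≡ 0ℤ
  moment₀ = lemma (moment W′ 0)
    where
    lemma : ∀ i → (0ℤ -ℤ i) *ℤ 1ℤ +ℤ i ≡ 0ℤ
    lemma = solve-∀
  step : ∀ j → moment V (suc j) ≡ s₀ *ℤ moment V j +ℤ D *ℤ moment W j
  step j = begin
    moment V (suc j)
      ≡⟨ split (moment V (suc j)) (s₀ *ℤ moment V j) ⟩
    s₀ *ℤ moment V j +ℤ (moment V (suc j) -ℤ s₀ *ℤ moment V j)
      ≡⟨ cong (λ z → s₀ *ℤ moment V j +ℤ (moment V (suc j) -ℤ z))
           (trans (ℤ.*-comm s₀ _) (sym (integral-* V (_^ℤ j) s₀))) ⟩
    s₀ *ℤ moment V j +ℤ (moment V (suc j) -ℤ integral V (λ x → x ^ℤ j *ℤ s₀))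
      ≡⟨ cong (s₀ *ℤ moment V j +ℤ_) (sym (integral-- V _ _)) ⟩
    s₀ *ℤ moment V j +ℤ integral V (λ x → x ^ℤ suc j -ℤ x ^ℤ j *ℤ s₀)
      ≡⟨ cong (s₀ *ℤ moment V j +ℤ_) (integral-cong V (λ x → factor x s₀ (x ^ℤ j))) ⟩
    s₀ *ℤ moment V j +ℤ integral V (λ x → (x -ℤ s₀) *ℤ x ^ℤ j)
      ≡⟨ cong (s₀ *ℤ moment V j +ℤ_) (drop (0ℤ -ℤ moment W′ 0) s₀ (s₀ ^ℤ j) _) ⟩
    s₀ *ℤ moment V j +ℤ integral W′ (λ x → (x -ℤ s₀) *ℤ x ^ℤ j)
      ≡⟨ cong (s₀ *ℤ moment V j +ℤ_) (eq (_^ℤ j)) ⟩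
    s₀ *ℤ moment V j +ℤ D *ℤ moment W j ∎
    where
    open ≡-Reasoning
    split : ∀ a b → a ≡ b +ℤ (a -ℤ b)
    split = solve-∀
    factor : ∀ x s y → x *ℤ y -ℤ y *ℤ s ≡ (x -ℤ s) *ℤ y
    factor = solve-∀
    drop : ∀ w s y i → w *ℤ ((s -ℤ s) *ℤ y) +ℤ i ≡ i
    drop = solve-∀
  vanish : ∀ {j} → j < suc e → moment V j ≡ 0ℤ
  vanish {zero} _ = moment₀
  vanish {suc j} (s≤s j<e)
    rewrite step j | vanish (ℕ.m<n⇒m<1+n j<e) | below j<e | ℤ.*-zeroʳ s₀ | ℤ.*-zeroʳ D = refl
  nonzero : moment V (suc e) ≢ 0ℤ
  nonzero eq₀ = ≢0-* D≢0 top (trans (sym (trans (step e) (trans (cong (λ z → s₀ *ℤ z +ℤ D *ℤ moment W e)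
    (vanish ℕ.≤-refl)) (trans (cong (_+ℤ D *ℤ moment W e) (ℤ.*-zeroʳ s₀)) (ℤ.+-identityˡ _))))) eq₀)

Π-moments : Vec Weights n → Vec ℕ n → ℤ
Π-moments [] [] = 1ℤ
Π-moments (W ∷ Ws) (d ∷ ds) = moment W d *ℤ Π-moments Ws ds

∫ : Vec Weights n → (Vec ℤ n → ℤ) → ℤ
∫ [] f = f []
∫ (W ∷ Ws) f = integral W (λ x → ∫ Ws (λ xs → f (x ∷ xs)))

∫-cong : ∀ (Ws : Vec Weights n) {f g} → (∀ xs → f xs ≡ g xs) → ∫ Ws f ≡ ∫ Ws g
∫-cong [] f≗g = f≗g []
∫-cong (W ∷ Ws) f≗g = integral-cong W (λ x → ∫-cong Ws (λ xs → f≗g (x ∷ xs)))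

∫-* : ∀ (Ws : Vec Weights n) c f → ∫ Ws (λ xs → c *ℤ f xs) ≡ c *ℤ ∫ Ws f
∫-* [] c f = refl
∫-* (W ∷ Ws) c f = trans
  (integral-cong W (λ x → trans (∫-* Ws c _) (ℤ.*-comm c _)))
  (trans (integral-* W _ c) (ℤ.*-comm _ c))

∫-- : ∀ (Ws : Vec Weights n) f g → ∫ Ws (λ xs → f xs -ℤ g xs) ≡ ∫ Ws f -ℤ ∫ Ws g
∫-- [] f g = refl
∫-- (W ∷ Ws) f g = trans (integral-cong W (λ x → ∫-- Ws _ _)) (integral-- W _ _)

∫-vanishing : ∀ (Ws : Vec Weights n) {f} →
  (∀ xs → Pointwise (λ x W → x ∈ˡ map proj₁ W) xs Ws → f xs ≡ 0ℤ) → ∫ Ws f ≡ 0ℤ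
∫-vanishing [] z = z [] []
∫-vanishing (W ∷ Ws) z = integral-vanishing W (λ x∈ → ∫-vanishing Ws (λ xs xs∈ → z _ (x∈ ∷ xs∈)))

monomial : Vec ℕ n → Vec ℤ n → ℤ
monomial [] [] = 1ℤ
monomial (d ∷ ds) (x ∷ xs) = x ^ℤ d *ℤ monomial ds xs

∫-monomial : ∀ (Ws : Vec Weights n) ds → ∫ Ws (monomial ds) ≡ Π-moments Ws ds
∫-monomial [] [] = refl
∫-monomial (W ∷ Ws) (d ∷ ds) = trans
  (integral-cong W (λ x → trans (∫-* Ws (x ^ℤ d) (monomial ds)) (cong (x ^ℤ d *ℤ_) (∫-monomial Ws ds))))
  (integral-* W (_^ℤ d) _)

monomial-suc : ∀ i (ds : Vec ℕ n) xs → monomial (updateAt ds i suc) xs ≡ lookup xs i *ℤ monomial ds xs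
monomial-suc zero (d ∷ ds) (x ∷ xs) = ℤ.*-assoc x (x ^ℤ d) _
monomial-suc (suc i) (d ∷ ds) (x ∷ xs) rewrite monomial-suc i ds xs = lemma (x ^ℤ d) (lookup xs i) (monomial ds xs)
  where
  lemma : ∀ a b c → a *ℤ (b *ℤ c) ≡ b *ℤ (a *ℤ c)
  lemma = solve-∀

sum-suc : ∀ i (ds : Vec ℕ n) → sum (updateAt ds i suc) ≡ suc (sum ds)
sum-suc zero (d ∷ ds) = refl
sum-suc (suc i) (d ∷ ds) rewrite sum-suc i ds = ℕ.+-suc d (sum ds)

Π-moments-< : ∀ {Ws : Vec Weights n} {es ds : Vec ℕ n} → Pointwise Selects es Ws → sum ds < sum es → Π-moments Ws ds ≡ 0ℤ
Π-moments-< {ds = []} [] ()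
Π-moments-< {Ws = W ∷ Ws} {e ∷ es} {d ∷ ds} (sel ∷ sels) lt with ℕ.<-≤-connex d e
... | inj₁ d<e rewrite proj₁ sel d<e = refl
... | inj₂ e≤d rewrite Π-moments-< {ds = ds} sels (ℕ.+-cancelˡ-< e _ _ (ℕ.≤-<-trans (ℕ.+-monoˡ-≤ _ e≤d) lt)) =
  ℤ.*-zeroʳ (moment W d)

-- Since the total is bounded, an excess at `i` forces a deficiency at another coordinate, where the
-- moment vanishes.
Π-moments-exceed : ∀ {Ws : Vec Weights n} {es ds : Vec ℕ n} i → Pointwise Selects es Ws →
  sum ds ≤ sum es → lookup es i < lookup ds i → Π-moments Ws ds ≡ 0ℤ
Π-moments-exceed {Ws = W ∷ Ws} {e ∷ es} {d ∷ ds} zero (sel ∷ sels) le e<d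
  rewrite Π-moments-< {ds = ds} sels (ℕ.+-cancelˡ-< e _ _ (ℕ.<-≤-trans (ℕ.+-monoˡ-< _ e<d) le)) = ℤ.*-zeroʳ (moment W d)
Π-moments-exceed {Ws = W ∷ Ws} {e ∷ es} {d ∷ ds} (suc i) (sel ∷ sels) le lt with ℕ.<-≤-connex d e
... | inj₁ d<e rewrite proj₁ sel d<e = refl
... | inj₂ e≤d rewrite Π-moments-exceed {ds = ds} i sels (ℕ.+-cancelˡ-≤ e _ _ (ℕ.≤-trans (ℕ.+-monoˡ-≤ _ e≤d) le)) lt =
  ℤ.*-zeroʳ (moment W d)

Π-moments-deficient : ∀ {Ws : Vec Weights n} {es ds : Vec ℕ n} i → Pointwise Selects es Ws →
  lookup ds i < lookup es i → Π-moments Ws ds ≡ 0ℤ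
Π-moments-deficient {ds = d ∷ ds} zero (sel ∷ sels) d<e rewrite proj₁ sel d<e = refl
Π-moments-deficient {Ws = W ∷ Ws} {ds = d ∷ ds} (suc i) (sel ∷ sels) lt
  rewrite Π-moments-deficient {ds = ds} i sels lt = ℤ.*-zeroʳ (moment W d)

Π-moments-nonzero : ∀ {Ws : Vec Weights n} {es : Vec ℕ n} → Pointwise Selects es Ws → Π-moments Ws es ≢ 0ℤ
Π-moments-nonzero [] ()
Π-moments-nonzero (sel ∷ sels) = ≢0-* (proj₂ sel) (Π-moments-nonzero sels)

lookup-updateAt-suc : ∀ (i j : Fin n) ms → lookup ms i ≤ lookup (updateAt ms j suc) i
lookup-updateAt-suc zero zero (m ∷ ms) = ℕ.n≤1+n m
lookup-updateAt-suc zero (suc j) (m ∷ ms) = ℕ.≤-refl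
lookup-updateAt-suc (suc i) zero (m ∷ ms) = ℕ.≤-refl
lookup-updateAt-suc (suc i) (suc j) (m ∷ ms) = lookup-updateAt-suc i j ms

zipWith-zero : ∀ (ms ds : Vec ℕ n) → sum ds ≡ 0 → Vec.zipWith _+_ ms ds ≡ ms
zipWith-zero [] [] eq = refl
zipWith-zero (m ∷ ms) (zero ∷ ds) eq = cong₂ _∷_ (ℕ.+-identityʳ m) (zipWith-zero ms ds eq)

zipWith-shift : ∀ i {d} (ms ds : Vec ℕ n) → lookup ds i ≡ suc d →
  Vec.zipWith _+_ (updateAt ms i suc) (updateAt ds i pred) ≡ Vec.zipWith _+_ ms ds
zipWith-shift zero (m ∷ ms) (suc d ∷ ds) eq = cong (_∷ Vec.zipWith _+_ ms ds) (sym (ℕ.+-suc m d))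
zipWith-shift (suc i) (m ∷ ms) (d ∷ ds) eq = cong (m + d ∷_) (zipWith-shift i ms ds eq)

zipWith-exceed : ∀ i (ms ds : Vec ℕ n) → lookup ds i ≡ 0 →
  lookup (Vec.zipWith _+_ ms ds) i < lookup (updateAt ms i suc) i
zipWith-exceed zero (m ∷ ms) (zero ∷ ds) eq = s≤s (ℕ.≤-reflexive (ℕ.+-identityʳ m))
zipWith-exceed (suc i) (m ∷ ms) (d ∷ ds) eq = zipWith-exceed i ms ds eq

sum-pred : ∀ i {d} (ds : Vec ℕ n) → lookup ds i ≡ suc d → suc (sum (updateAt ds i pred)) ≡ sum ds
sum-pred zero (suc d ∷ ds) eq = refl
sum-pred (suc i) (d ∷ ds) eq = trans (sym (ℕ.+-suc d _)) (cong (d +_) (sum-pred i ds eq))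

sum-zipWith : ∀ (ms ds : Vec ℕ n) → sum (Vec.zipWith _+_ ms ds) ≡ sum ms + sum ds
sum-zipWith [] [] = refl
sum-zipWith (m ∷ ms) (d ∷ ds) rewrite sum-zipWith ms ds = solve 4
  (λ a b c d → (a :+ b) :+ (c :+ d) := (a :+ c) :+ (b :+ d)) refl m d (sum ms) (sum ds)
  where open +-*-Solver

-- The graph polynomial and its coefficients

Edges : ℕ → Set
Edges n = List (Fin n × Fin n)

graphPolynomial : Edges n → Vec ℤ n → ℤ
graphPolynomial [] xs = 1ℤ
graphPolynomial ((i , j) ∷ E) xs = (lookup xs i -ℤ lookup xs j) *ℤ graphPolynomial E xs

degree : Fin n → Edges n → ℕ
degree i [] = 0
degree i ((j , k) ∷ E) = (if does (i ≟ j) ∨ does (i ≟ k) then 1 else 0) + degree i E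

-- Choosing `j` from a factor raises its exponent by one but uses up the factor, so the exponent
-- plus the remaining degree never grows.
raise : ∀ (i j : Fin n) c E ms →
  lookup (updateAt ms j suc) i + degree i E ≤ lookup ms i + ((if does (i ≟ j) ∨ c then 1 else 0) + degree i E)
raise i j c E ms with i ≟ j
... | yes refl = ℕ.≤-reflexive (trans (cong (_+ degree i E) (Vec.lookup∘updateAt i ms)) (sym (ℕ.+-suc (lookup ms i) (degree i E))))
... | no i≢j rewrite Vec.lookup∘updateAt′ i j {suc} i≢j ms = ℕ.+-monoʳ-≤ (lookup ms i) (ℕ.m≤n+m (degree i E) _)

raise-left : ∀ (i j k : Fin n) E ms →
  lookup (updateAt ms j suc) i + degree i E ≤ lookup ms i + degree i ((j , k) ∷ E)
raise-left i j k E ms = raise i j (does (i ≟ k)) E ms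

raise-right : ∀ (i j k : Fin n) E ms →
  lookup (updateAt ms k suc) i + degree i E ≤ lookup ms i + degree i ((j , k) ∷ E)
raise-right i j k E ms rewrite Bool.∨-comm (does (i ≟ j)) (does (i ≟ k)) = raise i k (does (i ≟ j)) E ms

-- The coefficient of the monomial with exponents ds in the graph polynomial,
-- provided that the sum of ds is the number of edges. The test prunes the
-- expansion: a variable occurs in no more factors than its degree.
mutual
  coefficient : Edges n → Vec ℕ n → ℤ
  coefficient [] ds = 1ℤ
  coefficient ((i , j) ∷ E) ds =
    if lookup ds i ≤ᵇ degree i ((i , j) ∷ E)
    then lowered E ds i (lookup ds i) -ℤ lowered E ds j (lookup ds j)
    else 0ℤ

  lowered : Edges n → Vec ℕ n → Fin n → ℕ → ℤ
  -- Applying `pred` to an exponent 0 would leave it at 0 and count a monomial that the variable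
  -- does not divide.
  lowered E ds i zero    = 0ℤ
  lowered E ds i (suc _) = coefficient E (updateAt ds i pred)

module _ {n} {Ws : Vec Weights n} {es : Vec ℕ n} (sels : Pointwise Selects es Ws) where

  -- The integral of a partly expanded product: `ms` records the variables chosen so far, `E` the
  -- factors still to be expanded.
  term : Edges n → Vec ℕ n → ℤ
  term E ms = ∫ Ws (λ xs → monomial ms xs *ℤ graphPolynomial E xs)

  term-∷ : ∀ i j E ms → term ((i , j) ∷ E) ms ≡ term E (updateAt ms i suc) -ℤ term E (updateAt ms j suc)
  term-∷ i j E ms = trans (∫-cong Ws expand) (∫-- Ws (λ xs → monomial (updateAt ms i suc) xs *ℤ graphPolynomial E xs) _)
    where
    lemma : ∀ m x y p → m *ℤ ((x -ℤ y) *ℤ p) ≡ (x *ℤ m) *ℤ p -ℤ (y *ℤ m) *ℤ p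
    lemma = solve-∀
    expand : ∀ xs → monomial ms xs *ℤ graphPolynomial ((i , j) ∷ E) xs ≡
      monomial (updateAt ms i suc) xs *ℤ graphPolynomial E xs -ℤ
      monomial (updateAt ms j suc) xs *ℤ graphPolynomial E xs
    expand xs rewrite monomial-suc i ms xs | monomial-suc j ms xs =
      lemma (monomial ms xs) (lookup xs i) (lookup xs j) (graphPolynomial E xs)

  term-[] : ∀ ms → term [] ms ≡ Π-moments Ws ms
  term-[] ms = trans (∫-cong Ws (λ xs → ℤ.*-identityʳ (monomial ms xs))) (∫-monomial Ws ms)

  suc-step : ∀ i {k} (E : Edges n) (ms : Vec ℕ n) → sum ms + suc (length E) ≡ k → sum (updateAt ms i suc) + length E ≡ k
  suc-step i E ms eq rewrite sum-suc i ms = trans (sym (ℕ.+-suc (sum ms) (length E))) eq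

  -- Exponents only grow during the expansion, so an excess at `i` persists until `Π-moments-exceed`
  -- applies. This matches the zero clause of `lowered`.
  term-exceed : ∀ i E ms → sum ms + length E ≡ sum es → lookup es i < lookup ms i → term E ms ≡ 0ℤ
  term-exceed i [] ms eq lt =
    trans (term-[] ms) (Π-moments-exceed i sels (ℕ.≤-reflexive (trans (sym (ℕ.+-identityʳ _)) eq)) lt)
  term-exceed i ((j , k) ∷ E) ms eq lt
    rewrite term-∷ j k E ms
          | term-exceed i E (updateAt ms j suc) (suc-step j E ms eq) (ℕ.<-≤-trans lt (lookup-updateAt-suc i j ms))
          | term-exceed i E (updateAt ms k suc) (suc-step k E ms eq) (ℕ.<-≤-trans lt (lookup-updateAt-suc i k ms)) = refl

  -- The remaining factors cannot lift the exponent of `i` up to that in `es`; this justifies the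
  -- pruning in `coefficient`.
  term-deficient : ∀ i E ms → lookup ms i + degree i E < lookup es i → term E ms ≡ 0ℤ
  term-deficient i [] ms lt =
    trans (term-[] ms) (Π-moments-deficient i sels (subst (_< lookup es i) (ℕ.+-identityʳ _) lt))
  term-deficient i ((j , k) ∷ E) ms lt
    rewrite term-∷ j k E ms
          | term-deficient i E (updateAt ms j suc) (ℕ.≤-<-trans (raise-left i j k E ms) lt)
          | term-deficient i E (updateAt ms k suc) (ℕ.≤-<-trans (raise-right i j k E ms) lt) = refl

  -- The expansion of the integral runs parallel to the recursion of `coefficient`: `ds` holds the
  -- exponents still to be collected, and `ms` plus `ds` stays equal to `es`.
  term-coefficient : ∀ E ms ds → Vec.zipWith _+_ ms ds ≡ es → sum ds ≡ length E →
    term E ms ≡ coefficient E ds *ℤ Π-moments Ws es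
  term-coefficient [] ms ds refl eq = trans (term-[] ms)
    (trans (cong (Π-moments Ws) (sym (zipWith-zero ms ds eq))) (sym (ℤ.*-identityˡ _)))
  term-coefficient ((i , j) ∷ E) ms ds split eq with lookup ds i ≤ᵇ degree i ((i , j) ∷ E) in test
  ... | false = trans (term-deficient i ((i , j) ∷ E) ms
    (subst (λ es → _ < lookup es i) split (subst (_ <_) (sym (Vec.lookup-zipWith _+_ i ms ds))
      (ℕ.+-monoʳ-< (lookup ms i) (ℕ.≰⇒> λ le → subst T test (ℕ.≤⇒≤ᵇ le)))))) (sym (ℤ.*-zeroˡ (Π-moments Ws es)))
  ... | true = begin
    term ((i , j) ∷ E) ms
      ≡⟨ term-∷ i j E ms ⟩
    term E (updateAt ms i suc) -ℤ term E (updateAt ms j suc)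
      ≡⟨ cong₂ _-ℤ_ (branch i _ refl) (branch j _ refl) ⟩
    lowered E ds i (lookup ds i) *ℤ Π-moments Ws es -ℤ lowered E ds j (lookup ds j) *ℤ Π-moments Ws es
      ≡⟨ lemma (lowered E ds i (lookup ds i)) (lowered E ds j (lookup ds j)) (Π-moments Ws es) ⟩
    (lowered E ds i (lookup ds i) -ℤ lowered E ds j (lookup ds j)) *ℤ Π-moments Ws es ∎
    where
    open ≡-Reasoning
    lemma : ∀ a b c → a *ℤ c -ℤ b *ℤ c ≡ (a -ℤ b) *ℤ c
    lemma = solve-∀
    total : sum ms + suc (length E) ≡ sum es
    total = trans (cong (sum ms +_) (sym eq)) (trans (sym (sum-zipWith ms ds)) (cong sum split))
    branch : ∀ i d → lookup ds i ≡ d → term E (updateAt ms i suc) ≡ lowered E ds i d *ℤ Π-moments Ws es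
    branch i zero d≡ = term-exceed i E (updateAt ms i suc) (suc-step i E ms total)
      (subst (λ es → lookup es i < lookup (updateAt ms i suc) i) split (zipWith-exceed i ms ds d≡))
    branch i (suc d) d≡ = term-coefficient E (updateAt ms i suc) (updateAt ds i pred) (trans (zipWith-shift i ms ds d≡) split)
      (ℕ.suc-injective (trans (sum-pred i ds d≡) eq))

choose-weights : ∀ {es : Vec ℕ n} {Ls : Vec (List ℤ) n} → Pointwise (λ e L → Unique L × length L ≡ suc e) es Ls →
  ∃ λ Ws → Vec.map (map proj₁) Ws ≡ Ls × Pointwise Selects es Ws
choose-weights [] = [] , refl , []
choose-weights ((u , len) ∷ us) with W , refl , sel ← selecting-weights _ _ u len | Ws , refl , sels ← choose-weights us =
  W ∷ Ws , refl , sel ∷ sels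

-- Integration against a product of selecting measures kills every monomial of the graph polynomial
-- except the one with exponents `es`, which contributes its coefficient times a nonzero factor. A
-- polynomial vanishing on the grid of the lists would have integral 0.
alon-tarsi : ∀ (E : Edges n) {es Ls} → coefficient E es ≢ 0ℤ → sum es ≡ length E →
  Pointwise (λ e L → Unique L × length L ≡ suc e) es Ls →
  ¬ (∀ xs → Pointwise _∈ˡ_ xs Ls → graphPolynomial E xs ≡ 0ℤ)
alon-tarsi {n} E {es} c≢0 count us vanish with Ws , refl , sels ← choose-weights us =
  ≢0-* c≢0 (Π-moments-nonzero sels) (trans (sym (term-coefficient sels E zeros es (zeros-+ es) count))
    (∫-vanishing Ws (λ xs xs∈ → trans (cong (monomial zeros xs *ℤ_) (vanish xs (on-map xs∈))) (ℤ.*-zeroʳ (monomial zeros xs)))))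
  where
  zeros : ∀ {n} → Vec ℕ n
  zeros = Vec.replicate _ 0
  zeros-+ : ∀ {n} (es : Vec ℕ n) → Vec.zipWith _+_ zeros es ≡ es
  zeros-+ [] = refl
  zeros-+ (e ∷ es) = cong (e ∷_) (zeros-+ es)
  on-map : ∀ {n} {xs : Vec ℤ n} {Ws : Vec Weights n} → Pointwise (λ x W → x ∈ˡ map proj₁ W) xs Ws →
    Pointwise _∈ˡ_ xs (Vec.map (map proj₁) Ws)
  on-map [] = []
  on-map (x∈ ∷ xs∈) = x∈ ∷ on-map xs∈

-- Forbidden patterns and their refutations

data Tag : Set where
  adj non neq : Tag

Fact Facts : Set
Fact = ℕ × ℕ × Tag
Facts = List Fact

implies : Tag → Tag → Bool
implies adj adj = true
implies non non = true
implies _   neq = true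
implies _   _   = false

entails : Facts → ℕ → ℕ → Tag → Bool
entails [] i j t = false
entails ((a , b , s) ∷ F) i j t =
  (((a ≡ᵇ i) ∧ (b ≡ᵇ j)) ∨ ((a ≡ᵇ j) ∧ (b ≡ᵇ i))) ∧ implies s t ∨ entails F i j t

infixl 8 _!_
-- The default 0 makes every list a total renaming, as assignments of vertices to names are total.
_!_ : List ℕ → ℕ → ℕ
[] ! i = 0
(x ∷ xs) ! zero = x
(x ∷ xs) ! suc i = xs ! i

-- A refutation of a list of facts about vertices named by natural numbers; the
-- name 0 is reserved for a vertex v.
--   split i j l r    : case distinction on whether i and j are adjacent;
--   outer x a b w t  : x has the two nonneighbours a, b in the neighbourhood
--                      of v, hence a neighbour w outside of it;
--   leaf k e         : renaming along e embeds the k-th known forbidden pattern.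
data Refutation : Set where
  split : ℕ → ℕ → Refutation → Refutation → Refutation
  outer : ℕ → ℕ → ℕ → ℕ → Refutation → Refutation
  leaf  : ℕ → List ℕ → Refutation

-- Neighbours of 0 differ from `w`, which is not one of them; `split` may be applied to a pair only
-- once its members are known to be distinct.
outerFacts : Facts → ℕ → ℕ → Facts
outerFacts F x w = (0 , w , non) ∷ (x , w , adj) ∷
  map (λ i → i , w , neq) (filter (λ i → T? (entails F 0 i adj)) (upTo w))

fresh : ℕ → Facts → Bool
fresh w = all (λ (i , j , _) → not (i ≡ᵇ w) ∧ not (j ≡ᵇ w))

embeds : Facts → Facts → List ℕ → Bool
embeds F P e = all (λ (i , j , t) → entails F (e ! i) (e ! j) t) P

embedsNth : Facts → List Facts → ℕ → List ℕ → Bool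
embedsNth F [] k e = false
embedsNth F (P ∷ Ps) zero e = embeds F P e
embedsNth F (P ∷ Ps) (suc k) e = embedsNth F Ps k e

check : List Facts → Facts → Refutation → Bool
check Ps F (split i j l r) =
  entails F i j neq ∧ check Ps ((i , j , adj) ∷ F) l ∧ check Ps ((i , j , non) ∷ F) r
check Ps F (outer x a b w t) =
  entails F 0 x adj ∧ entails F 0 a adj ∧ entails F 0 b adj ∧
  entails F x a non ∧ entails F x b non ∧ entails F a b neq ∧
  not (0 ≡ᵇ w) ∧ not (x ≡ᵇ w) ∧ fresh w F ∧ check Ps (outerFacts F x w ++ F) t
check Ps F (leaf k e) = embedsNth F Ps k e

-- Proof by reflection: the check evaluates to the unit type, so that the instance argument is found
-- and a refutation is plain data.
record Refuted (Ps : List Facts) (F : Facts) : Set where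
  constructor refuted-by
  field
    refutation : Refutation
    {{checked}} : T (check Ps F refutation)

∧⁻ : ∀ {x y} → T (x ∧ y) → T x × T y
∧⁻ = Equivalence.to T-∧

-- The predicate `Vertex` will be membership in S, so that patterns are sought inside S without
-- reindexing its vertices.
module Soundness {V : Set} (_~_ : V → V → Set) (_~?_ : Binary.Decidable _~_)
  (~-sym : Symmetric _~_) (~-irrefl : Irreflexive _≡_ _~_) (Vertex : V → Set) where

  NonAdjacent : V → V → Set
  NonAdjacent u w = u ≢ w × ¬ u ~ w

  ⟦_⟧ : Tag → V → V → Set
  ⟦ adj ⟧ u w = u ~ w
  ⟦ non ⟧ u w = NonAdjacent u w
  ⟦ neq ⟧ u w = u ≢ w

  FactHolds : (ℕ → V) → Fact → Set
  FactHolds ρ (i , j , t) = ⟦ t ⟧ (ρ i) (ρ j)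

  Forbidden : Facts → Set
  Forbidden F = ∀ ρ → (∀ i → Vertex (ρ i)) → All (FactHolds ρ) F → ⊥

  EscapesNeighbourhoods : Set
  EscapesNeighbourhoods = ∀ {v x a b} → Vertex v → Vertex x → Vertex a → Vertex b →
    v ~ x → v ~ a → v ~ b → NonAdjacent x a → NonAdjacent x b → a ≢ b →
    ∃ λ w → Vertex w × x ~ w × NonAdjacent v w

  ⟦⟧-sym : ∀ t {u w} → ⟦ t ⟧ u w → ⟦ t ⟧ w u
  ⟦⟧-sym adj u~w = ~-sym u~w
  ⟦⟧-sym non (u≢w , u≁w) = ≢-sym u≢w , u≁w ∘ ~-sym
  ⟦⟧-sym neq u≢w = ≢-sym u≢w

  implies-sound : ∀ s t → T (implies s t) → ∀ {u w} → ⟦ s ⟧ u w → ⟦ t ⟧ u w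
  implies-sound adj adj _ u~w = u~w
  implies-sound non non _ nonadj = nonadj
  implies-sound adj neq _ u~w u≡w = ~-irrefl u≡w u~w
  implies-sound non neq _ = proj₁
  implies-sound neq neq _ u≢w = u≢w

  entails-sound : ∀ {ρ F} → All (FactHolds ρ) F → ∀ i j t → T (entails F i j t) → ⟦ t ⟧ (ρ i) (ρ j)
  entails-sound {ρ} (_∷_ {a , b , s} h hs) i j t ok with Equivalence.to T-∨ ok
  ... | inj₂ later = entails-sound hs i j t later
  ... | inj₁ now with ij , st ← ∧⁻ now with Equivalence.to T-∨ ij
  ...   | inj₁ same with a≡i , b≡j ← ∧⁻ same
    with refl ← ℕ.≡ᵇ⇒≡ a i a≡i | refl ← ℕ.≡ᵇ⇒≡ b j b≡j = implies-sound s t st h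
  ...   | inj₂ swapped with a≡j , b≡i ← ∧⁻ swapped
    with refl ← ℕ.≡ᵇ⇒≡ a j a≡j | refl ← ℕ.≡ᵇ⇒≡ b i b≡i = ⟦⟧-sym t (implies-sound s t st h)

  embeds-sound : ∀ {ρ F} → All (FactHolds ρ) F → ∀ P e → T (embeds F P e) → All (FactHolds (λ i → ρ (e ! i))) P
  embeds-sound hs [] e ok = []
  embeds-sound hs ((i , j , t) ∷ P) e ok with here-ok , rest ← ∧⁻ ok =
    entails-sound hs (e ! i) (e ! j) t here-ok ∷ embeds-sound hs P e rest

  rename : (ℕ → V) → ℕ → V → ℕ → V
  rename ρ w u i = if i ≡ᵇ w then u else ρ i

  rename-same : ∀ ρ w u → rename ρ w u w ≡ u
  rename-same ρ w u rewrite Equivalence.to T-≡ (ℕ.≡⇒≡ᵇ w w refl) = refl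

  rename-other : ∀ ρ w u i → T (not (i ≡ᵇ w)) → rename ρ w u i ≡ ρ i
  rename-other ρ w u i ok with i ≡ᵇ w
  ... | false = refl

  fresh-sound : ∀ {ρ w u} F → T (fresh w F) → All (FactHolds ρ) F → All (FactHolds (rename ρ w u)) F
  fresh-sound [] ok [] = []
  fresh-sound {ρ} {w} {u} ((i , j , t) ∷ F) ok (h ∷ hs)
    with ij , rest ← ∧⁻ ok with i≢w , j≢w ← ∧⁻ {not (i ≡ᵇ w)} ij =
    subst₂ ⟦ t ⟧ (sym (rename-other ρ w u i i≢w)) (sym (rename-other ρ w u j j≢w)) h ∷ fresh-sound F rest hs

  module _ (escape : EscapesNeighbourhoods) {Ps : List Facts} (forbidden : All Forbidden Ps) where

    embedsNth-sound : ∀ {Ps} → All Forbidden Ps → ∀ {F} k e → T (embedsNth F Ps k e) → Forbidden F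
    embedsNth-sound {P ∷ Ps} (f ∷ fs) zero e ok ρ vs hs = f (λ i → ρ (e ! i)) (λ i → vs (e ! i)) (embeds-sound hs P e ok)
    embedsNth-sound {P ∷ Ps} (f ∷ fs) (suc k) e ok = embedsNth-sound fs k e ok

    check-sound : ∀ F t → T (check Ps F t) → Forbidden F
    check-sound F (leaf k e) ok = embedsNth-sound forbidden k e ok
    check-sound F (split i j l r) ok ρ vs hs
      with i≢j , rest ← ∧⁻ ok with ok-l , ok-r ← ∧⁻ {check Ps ((i , j , adj) ∷ F) l} rest with ρ i ~? ρ j
    ... | yes i~j = check-sound _ l ok-l ρ vs (i~j ∷ hs)
    ... | no i≁j  = check-sound _ r ok-r ρ vs ((entails-sound hs i j neq i≢j , i≁j) ∷ hs)
    check-sound F (outer x a b w t) ok ρ vs hs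
      with 0~x , ok ← ∧⁻ ok with 0~a , ok ← ∧⁻ ok with 0~b , ok ← ∧⁻ ok
      with x≁a , ok ← ∧⁻ ok with x≁b , ok ← ∧⁻ ok with a≢b , ok ← ∧⁻ ok with 0≢w , ok ← ∧⁻ {not (0 ≡ᵇ w)} ok with x≢w , ok ← ∧⁻ {not (x ≡ᵇ w)} ok
      with w-fresh , ok ← ∧⁻ {fresh w F} ok
      with u , Vu , x~u , v≁u ← escape (vs 0) (vs x) (vs a) (vs b)
             (entails-sound hs 0 x adj 0~x) (entails-sound hs 0 a adj 0~a) (entails-sound hs 0 b adj 0~b)
             (entails-sound hs x a non x≁a) (entails-sound hs x b non x≁b) (entails-sound hs a b neq a≢b) =
      check-sound _ t ok ρ′ vs′ (All.++⁺ new (fresh-sound F w-fresh hs))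
      where
      ρ′ : ℕ → V
      ρ′ = rename ρ w u
      here≡ : ρ′ w ≡ u
      here≡ = rename-same ρ w u
      elsewhere : ∀ i → T (not (i ≡ᵇ w)) → ρ′ i ≡ ρ i
      elsewhere = rename-other ρ w u
      new-neq : ∀ {i} → i ∈ˡ filter (λ i → T? (entails F 0 i adj)) (upTo w) → ρ′ i ≢ ρ′ w
      new-neq {i} i∈ ρi≡ρw with i∈upTo , 0~i ← ∈-filter⁻ (λ i → T? (entails F 0 i adj)) {xs = upTo w} i∈ =
        proj₂ v≁u (subst (ρ 0 ~_) (trans (sym (elsewhere i i≢w)) (trans ρi≡ρw here≡)) (entails-sound hs 0 i adj 0~i))
        where
        i≢w : T (not (i ≡ᵇ w))
        i≢w with i ≡ᵇ w in eq
        ... | false = tt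
        ... | true  = contradiction (∈-upTo⁻ i∈upTo) (ℕ.<-irrefl (ℕ.≡ᵇ⇒≡ i w (subst T (sym eq) tt)))
      new : All (FactHolds ρ′) (outerFacts F x w)
      new = subst₂ NonAdjacent (sym (elsewhere 0 0≢w)) (sym here≡) v≁u ∷
            subst₂ _~_ (sym (elsewhere x x≢w)) (sym here≡) x~u ∷
            All.map⁺ (All.tabulate new-neq)
      vs′ : ∀ i → Vertex (ρ′ i)
      vs′ i with i ≡ᵇ w
      ... | true  = Vu
      ... | false = vs i

    refuted-forbidden : ∀ {F} → Refuted Ps F → Forbidden F
    refuted-forbidden (refuted-by t {{checked}}) = check-sound _ t checked

-- Minimal uncolourable sets

pairs : ∀ n → List (Fin n × Fin n)
pairs n = filter (λ (i , j) → toℕ i ℕ.<? toℕ j) (cartesianProduct (allFin n) (allFin n))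

contains : List (ℕ × ℕ) → ℕ → ℕ → Bool
contains ps i j = any (λ (a , b) → (a ≡ᵇ i) ∧ (b ≡ᵇ j)) ps

-- All pairs of names below n that are in neither list are adjacent.
pattern-facts : ℕ → List (ℕ × ℕ) → List (ℕ × ℕ) → Facts
pattern-facts n nons neqs = map (λ (i , j) → toℕ i , toℕ j , tag (toℕ i) (toℕ j)) (pairs n)
  where
  tag : ℕ → ℕ → Tag
  tag i j = if contains nons i j then non else if contains neqs i j then neq else adj

-- A graph on the names below size, given by its nonadjacent pairs (i , j) with
-- i < j, together with a monomial of its graph polynomial.
record Configuration : Set where
  constructor configuration
  field
    size      : ℕ
    nonedges  : List (ℕ × ℕ)
    exponents : Vec ℕ size

  adjacent : Fin size → Fin size → Bool
  adjacent i j = not (contains nonedges (toℕ i) (toℕ j))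

  edges : Edges size
  edges = filterᵇ (λ (i , j) → adjacent i j) (pairs size)

  neighbour : Fin size → Fin size → Bool
  neighbour i j =
    if toℕ i <ᵇ toℕ j then adjacent i j else (toℕ j <ᵇ toℕ i) ∧ adjacent j i

  neighbours : Fin size → List (Fin size)
  neighbours i = filterᵇ (neighbour i) (allFin size)

  -- Lists of size degree - 1 suffice by the Alon-Tarsi theorem.
  Reducible : Set
  Reducible = 0 < size × T (not (does (coefficient edges exponents ℤ.≟ 0ℤ))) × sum exponents ≡ length edges ×
    (∀ i → 2 + lookup exponents i ≤ length (neighbours i))

  reducible? : Dec Reducible
  reducible? = (0 ℕ.<? size) ×-dec T? _ ×-dec (sum exponents ℕ.≟ length edges) ×-dec
    all? (λ i → 2 + lookup exponents i ℕ.≤? length (neighbours i))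

  facts : Facts
  facts = pattern-facts size nonedges []

∈-take⁻ : ∀ {A : Set} k {xs : List A} {x} → x ∈ˡ take k xs → x ∈ˡ xs
∈-take⁻ (suc k) {_ ∷ xs} (here eq) = here eq
∈-take⁻ (suc k) {_ ∷ xs} (there x∈) = there (∈-take⁻ k x∈)

Pointwise-tabulate : ∀ {A B : Set} {R : A → B → Set} (xs : Vec A n) (f : Fin n → B) →
  (∀ i → R (lookup xs i) (f i)) → Pointwise R xs (Vec.tabulate f)
Pointwise-tabulate [] f r = []
Pointwise-tabulate (x ∷ xs) f r = r zero ∷ Pointwise-tabulate xs (f ∘ suc) (r ∘ suc)

graphPolynomial-nonzero : ∀ (E : Edges n) {xs} → graphPolynomial E xs ≢ 0ℤ →
  ∀ {i j} → (i , j) ∈ˡ E → lookup xs i ≢ lookup xs j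
graphPolynomial-nonzero (_ ∷ E) {xs} p≢0 {i} (here refl) eq =
  p≢0 (cong (_*ℤ graphPolynomial E xs) (ℤ.i≡j⇒i-j≡0 eq))
graphPolynomial-nonzero ((a , b) ∷ E) {xs} p≢0 (there ij∈) =
  graphPolynomial-nonzero E (λ z → p≢0 (trans (cong ((lookup xs a -ℤ lookup xs b) *ℤ_) z) (ℤ.*-zeroʳ (lookup xs a -ℤ lookup xs b)))) ij∈

ColourableOn : (G : Graph n) → (Fin n → Subset m) → Subset n → Set
ColourableOn {n} {m} G L S = ∃ λ (φ : Fin n → Fin m) →
  (∀ {v} → v ∈ S → φ v ∈ L v) × (∀ {u v} → u ∈ S → v ∈ S → Graph._~_ G u v → φ u ≢ φ v)

-- Proper subsets are colourable only up to double negation. This is what induction on S provides,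
-- and it suffices since the uses below end in a contradiction.
module Critical {n m} (G : Graph n) (L : Fin n → Subset m) (k : ℕ)
  (list-size : ∀ v → ∣ L v ∣ ≡ k) (deg≤ : ∀ v → Graph.deg G v ≤ suc k)
  (S : Subset n) (uncolourable : ¬ ColourableOn G L S) (minimal : ∀ {T} → T ⊂ S → ¬ ¬ ColourableOn G L T)
  where
  open Graph G

  N∋⁺ : ∀ {v u} → v ~ u → u ∈ N v
  N∋⁺ {v} = ∈-separation⁺ (v ~?_)

  N∋⁻ : ∀ {v u} → u ∈ N v → v ~ u
  N∋⁻ {v} = ∈-separation⁻ (v ~?_)

  -- The vertices `ρ i` are removed from S and coloured last. There is at least one of them, which
  -- makes `rest` a proper subset.
  module Recolouring (ρ : Fin (suc t) → Fin n) (ρ∈S : ∀ i → ρ i ∈ S) where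

    covered? : ∀ u → Dec (∃ λ i → ρ i ≡ u)
    covered? u = any? (λ i → ρ i ≟ u)

    kept? : ∀ u → Dec (u ∈ S × ¬ ∃ λ i → ρ i ≡ u)
    kept? u = (u ∈? S) ×-dec ¬? (covered? u)

    rest : Subset n
    rest = separation kept?

    rest⊂S : rest ⊂ S
    rest⊂S = (λ u∈ → proj₁ (∈-separation⁻ kept? u∈)) , ρ zero , ρ∈S zero ,
      λ ρ∈ → proj₂ (∈-separation⁻ kept? ρ∈) (zero , refl)

    boundary : Fin (suc t) → List (Fin n)
    boundary i = filter kept? (elements (N (ρ i)))

    available : (Fin n → Fin m) → Fin (suc t) → List (Fin m)
    available φ i = _∖_ _≟_ (elements (L (ρ i))) (map φ (boundary i))

    available-unique : ∀ φ i → Unique (available φ i)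
    available-unique φ i = ∖-unique _≟_ (map φ (boundary i)) (elements-unique (L (ρ i)))

    available-length : ∀ φ i → k ≤ length (available φ i) + length (boundary i)
    available-length φ i = subst₂ _≤_ (trans (length-elements (L (ρ i))) (list-size (ρ i)))
      (cong (length (available φ i) +_) (length-map φ (boundary i)))
      (length-∖ _≟_ (map φ (boundary i)) (elements-unique (L (ρ i))))

    recolour : ∀ (φ : Fin n → Fin m) → (∀ {v} → v ∈ rest → φ v ∈ L v) →
      (∀ {u v} → u ∈ rest → v ∈ rest → u ~ v → φ u ≢ φ v) →
      (c : Fin (suc t) → Fin m) → (∀ i → c i ∈ˡ available φ i) →
      (∀ {i j} → ρ i ~ ρ j → c i ≢ c j) → ⊥
    recolour φ φ∈L φ-proper c c∈ c-proper = uncolourable (ψ , ψ∈L , ψ-proper)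
      where
      ψ : Fin n → Fin m
      ψ u with covered? u
      ... | yes (i , _) = c i
      ... | no _        = φ u
      ψ∈L : ∀ {u} → u ∈ S → ψ u ∈ L u
      ψ∈L {u} u∈S with covered? u
      ... | yes (i , refl) = ∈-elements⁻ (L (ρ i)) (proj₁ (∈-∖⁻ _≟_ (elements (L (ρ i))) (map φ (boundary i)) (c∈ i)))
      ... | no ¬cov        = φ∈L (∈-separation⁺ kept? (u∈S , ¬cov))
      c≢φ : ∀ {i w} → w ∈ S → ¬ (∃ λ j → ρ j ≡ w) → ρ i ~ w → c i ≢ φ w
      c≢φ {i} w∈S ¬cov i~w eq = proj₂ (∈-∖⁻ _≟_ (elements (L (ρ i))) (map φ (boundary i)) (c∈ i)) (subst (_∈ˡ map φ (boundary i)) (sym eq)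
        (∈-map⁺ φ (∈-filter⁺ kept? (∈-elements⁺ (N∋⁺ i~w)) (w∈S , ¬cov))))
      ψ-proper : ∀ {u w} → u ∈ S → w ∈ S → u ~ w → ψ u ≢ ψ w
      ψ-proper {u} {w} u∈S w∈S u~w with covered? u | covered? w
      ... | yes (i , refl) | yes (j , refl) = c-proper u~w
      ... | yes (i , refl) | no ¬cov        = c≢φ w∈S ¬cov u~w
      ... | no ¬cov        | yes (j , refl) = ≢-sym (c≢φ u∈S ¬cov (~-sym u~w))
      ... | no ¬cov-u      | no ¬cov-w      =
        φ-proper (∈-separation⁺ kept? (u∈S , ¬cov-u)) (∈-separation⁺ kept? (w∈S , ¬cov-w)) u~w

  neighbourhood : Fin n → List (Fin n)
  neighbourhood v = filter (_∈? S) (elements (N v))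

  neighbourhood-unique : ∀ v → Unique (neighbourhood v)
  neighbourhood-unique v = Unique.filter⁺ (_∈? S) (elements-unique (N v))

  ∈-neighbourhood⁻ : ∀ {v u} → u ∈ˡ neighbourhood v → v ~ u × u ∈ S
  ∈-neighbourhood⁻ {v} u∈ with u∈N , u∈S ← ∈-filter⁻ (_∈? S) u∈ = N∋⁻ (∈-elements⁻ (N v) u∈N) , u∈S

  -- A colouring of S without `v` forbids at `v` at most one colour for each neighbour in S, so with
  -- fewer than k neighbours it would extend.
  minimum-degree : ∀ {v} → v ∈ S → k ≤ length (neighbourhood v)
  minimum-degree {v} v∈S = decidable-stable (k ℕ.≤? _) λ k≰ → minimal rest⊂S λ (φ , φ∈L , φ-proper) →
    extend (ℕ.≰⇒> k≰) φ φ∈L φ-proper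
    where
    open Recolouring {t = 0} (λ _ → v) (λ _ → v∈S)
    boundary≤ : length (boundary zero) ≤ length (neighbourhood v)
    boundary≤ = unique-⊆-length (Unique.filter⁺ kept? (elements-unique (N v))) sub
      where
      sub : ∀ {u} → u ∈ˡ boundary zero → u ∈ˡ neighbourhood v
      sub u∈ with u∈N , u∈S , _ ← ∈-filter⁻ kept? {xs = elements (N v)} u∈ = ∈-filter⁺ (_∈? S) u∈N u∈S
    extend : length (neighbourhood v) < k → ∀ φ → (∀ {v} → v ∈ rest → φ v ∈ L v) →
      (∀ {u v} → u ∈ rest → v ∈ rest → u ~ v → φ u ≢ φ v) → ⊥
    extend few φ φ∈L φ-proper with available φ zero in eq | available-length φ zero
    ... | [] | k≤ = ℕ.<-irrefl refl (ℕ.≤-<-trans k≤ (ℕ.≤-<-trans boundary≤ few))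
    ... | c ∷ _ | _ = recolour φ φ∈L φ-proper (λ _ → c)
      (λ { zero → subst (c ∈ˡ_) (sym eq) (here refl) }) (λ v~v → contradiction v~v (~-irrefl refl))

  open Soundness _~_ _~?_ ~-sym ~-irrefl (_∈ S)

  -- A vertex with d neighbours in the pattern has at most k + 1 - d neighbours in the coloured
  -- rest, so at least d - 1 colours stay available. As its exponent is at most d - 2, the
  -- Alon-Tarsi theorem extends the colouring to all of S.
  configuration-forbidden : ∀ C → Configuration.Reducible C → Forbidden (Configuration.facts C)
  configuration-forbidden (configuration zero _ _) (() , _)
  configuration-forbidden C@(configuration (suc t) nons es) (_ , coeff , count , degrees) ρ′ ρ∈S hs =
    minimal rest⊂S λ (φ , φ∈L , φ-proper) → alon-tarsi edges coeff≢0 count (lists φ)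
      (vanish φ φ∈L φ-proper)
    where
    open Configuration C
    ρ : Fin (suc t) → Fin n
    ρ = ρ′ ∘ toℕ
    open Recolouring ρ (ρ∈S ∘ toℕ)

    coeff≢0 : coefficient edges es ≢ 0ℤ
    coeff≢0 eq with coefficient edges es ℤ.≟ 0ℤ
    ... | no ≢0 = ≢0 eq

    holds : ∀ {i j} → toℕ i < toℕ j → if adjacent i j then ρ i ~ ρ j else NonAdjacent (ρ i) (ρ j)
    holds {i} {j} i<j with contains nons (toℕ i) (toℕ j)
      | All.lookup hs (∈-map⁺ _ (∈-filter⁺ (λ (i , j) → toℕ i ℕ.<? toℕ j)
          (∈-cartesianProduct⁺ (∈-allFin i) (∈-allFin j)) i<j))
    ... | true  | h = h
    ... | false | h = h

    distinct : ∀ {i j} → toℕ i < toℕ j → ρ i ≢ ρ j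
    distinct {i} {j} i<j with adjacent i j | holds i<j
    ... | true  | i~j       = λ eq → ~-irrefl eq i~j
    ... | false | (i≢j , _) = i≢j

    ρ-injective : ∀ {i j} → ρ i ≡ ρ j → i ≡ j
    ρ-injective {i} {j} eq with ℕ.<-cmp (toℕ i) (toℕ j)
    ... | tri< i<j _ _ = contradiction eq (distinct i<j)
    ... | tri≈ _ i≡j _ = toℕ-injective i≡j
    ... | tri> _ _ j<i = contradiction (sym eq) (distinct j<i)

    adjacent⇒~ : ∀ {i j} → toℕ i < toℕ j → T (adjacent i j) → ρ i ~ ρ j
    adjacent⇒~ {i} {j} i<j adj-ij with adjacent i j | holds i<j
    ... | true | i~j = i~j

    neighbours-adjacent : ∀ {i j} → j ∈ˡ neighbours i → ρ i ~ ρ j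
    neighbours-adjacent {i} {j} j∈ with _ , ok ← ∈-filter⁻ (T? ∘ neighbour i) {xs = allFin (suc t)} j∈
      with toℕ i <ᵇ toℕ j in i<j
    ... | true  = adjacent⇒~ (ℕ.<ᵇ⇒< _ _ (subst T (sym i<j) tt)) ok
    ... | false with j<i , ok ← ∧⁻ {toℕ j <ᵇ toℕ i} ok = ~-sym (adjacent⇒~ (ℕ.<ᵇ⇒< _ _ j<i) ok)

    boundary+inside : ∀ i → length (boundary i) + length (neighbours i) ≤ suc k
    boundary+inside i = begin
      length (boundary i) + length (neighbours i)          ≡⟨ cong (length (boundary i) +_) (length-map ρ (neighbours i)) ⟨
      length (boundary i) + length (map ρ (neighbours i))  ≡⟨ length-++ (boundary i) ⟨
      length (boundary i ++ map ρ (neighbours i))          ≤⟨ unique-length≤∣∣ (N (ρ i)) unique sub ⟩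
      deg (ρ i)                                           ≤⟨ deg≤ (ρ i) ⟩
      suc k                                               ∎
      where
      open ℕ.≤-Reasoning
      unique : Unique (boundary i ++ map ρ (neighbours i))
      unique = Unique.++⁺ (Unique.filter⁺ kept? (elements-unique (N (ρ i))))
        (Unique.map⁺ ρ-injective (Unique.filter⁺ (T? ∘ neighbour i) (Unique.allFin⁺ (suc t))))
        λ (u∈ , u∈′) → case ∈-map⁻ ρ u∈′ of λ { (j , _ , refl) →
          proj₂ (proj₂ (∈-filter⁻ kept? {xs = elements (N (ρ i))} u∈)) (j , refl) }
      sub : ∀ {u} → u ∈ˡ boundary i ++ map ρ (neighbours i) → u ∈ N (ρ i)
      sub u∈ with ∈-++⁻ (boundary i) u∈
      ... | inj₁ u∈out = ∈-elements⁻ (N (ρ i)) (proj₁ (∈-filter⁻ kept? u∈out))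
      ... | inj₂ u∈in with j , j∈ , refl ← ∈-map⁻ ρ u∈in = N∋⁺ (neighbours-adjacent j∈)

    enough : ∀ φ i → suc (lookup es i) ≤ length (available φ i)
    enough φ i = ℕ.+-cancelʳ-≤ (suc (length (boundary i))) _ _ (begin
      suc (lookup es i) + suc (length (boundary i))       ≡⟨ ℕ.+-suc (suc (lookup es i)) (length (boundary i)) ⟩
      2 + lookup es i + length (boundary i)                ≤⟨ ℕ.+-monoˡ-≤ _ (degrees i) ⟩
      length (neighbours i) + length (boundary i)         ≡⟨ ℕ.+-comm (length (neighbours i)) _ ⟩
      length (boundary i) + length (neighbours i)         ≤⟨ boundary+inside i ⟩
      suc k                                               ≤⟨ s≤s (available-length φ i) ⟩
      suc (length (available φ i) + length (boundary i))  ≡⟨ ℕ.+-suc (length (available φ i)) (length (boundary i)) ⟨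
      length (available φ i) + suc (length (boundary i))  ∎)
      where open ℕ.≤-Reasoning

    -- The Alon-Tarsi theorem above asks for lists of size exactly one more than the exponent, with
    -- integers as colours.
    list : (Fin n → Fin m) → Fin (suc t) → List ℤ
    list φ i = take (suc (lookup es i)) (map (λ c → pos (toℕ c)) (available φ i))

    lists : ∀ φ → Pointwise (λ e L → Unique L × length L ≡ suc e) es (Vec.tabulate (list φ))
    lists φ = Pointwise-tabulate es (list φ) λ i →
      Unique.take⁺ _ (Unique.map⁺ (toℕ-injective ∘ ℤ.+-injective) (available-unique φ i)) ,
      trans (length-take (suc (lookup es i)) (map (λ c → pos (toℕ c)) (available φ i))) (trans (cong (suc (lookup es i) ⊓_) (length-map (λ c → pos (toℕ c)) (available φ i)))
        (ℕ.m≤n⇒m⊓n≡m (enough φ i)))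

    vanish : ∀ φ → (∀ {v} → v ∈ rest → φ v ∈ L v) →
      (∀ {u v} → u ∈ rest → v ∈ rest → u ~ v → φ u ≢ φ v) →
      ∀ xs → Pointwise _∈ˡ_ xs (Vec.tabulate (list φ)) → graphPolynomial edges xs ≡ 0ℤ
    -- A point of the grid with a nonzero value has distinct entries along every edge, hence is a
    -- proper colouring of the removed vertices.
    vanish φ φ∈L φ-proper xs xs∈ = decidable-stable (_ ℤ.≟ 0ℤ) λ p≢0 →
      recolour φ φ∈L φ-proper (proj₁ ∘ colour) (proj₁ ∘ proj₂ ∘ colour) (proper p≢0)
      where
      colour : ∀ i → ∃ λ c → c ∈ˡ available φ i × lookup xs i ≡ pos (toℕ c)
      colour i = ∈-map⁻ _ (∈-take⁻ (suc (lookup es i))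
        (subst (lookup xs i ∈ˡ_) (lookup∘tabulate (list φ) i) (Pointwise.lookup xs∈ i)))
      proper< : graphPolynomial edges xs ≢ 0ℤ → ∀ {i j} → toℕ i < toℕ j → ρ i ~ ρ j → proj₁ (colour i) ≢ proj₁ (colour j)
      proper< p≢0 {i} {j} i<j i~j eq = graphPolynomial-nonzero edges p≢0
        (∈-filter⁺ (λ (i , j) → T? (adjacent i j)) (∈-filter⁺ (λ (i , j) → toℕ i ℕ.<? toℕ j)
          (∈-cartesianProduct⁺ (∈-allFin i) (∈-allFin j)) i<j) adjacent-ij)
        (trans (proj₂ (proj₂ (colour i))) (trans (cong (pos ∘ toℕ) eq) (sym (proj₂ (proj₂ (colour j))))))
        where
        adjacent-ij : T (adjacent i j)
        adjacent-ij with adjacent i j | holds i<j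
        ... | true  | _         = tt
        ... | false | (_ , i≁j) = i≁j i~j
      proper : graphPolynomial edges xs ≢ 0ℤ → ∀ {i j} → ρ i ~ ρ j → proj₁ (colour i) ≢ proj₁ (colour j)
      proper p≢0 {i} {j} i~j with ℕ.<-cmp (toℕ i) (toℕ j)
      ... | tri< i<j _ _ = proper< p≢0 i<j i~j
      ... | tri≈ _ i≡j _ = contradiction i~j (~-irrefl (cong ρ (toℕ-injective i≡j)))
      ... | tri> _ _ j<i = ≢-sym (proper< p≢0 j<i (~-sym i~j))

  -- Otherwise the neighbours of `x` in S other than `v`, of which there are at least k - 1, are all
  -- neighbours of `v`. Together with `x`, `a` and `b` they exceed the degree bound k + 1 of `v`.
  escapes : EscapesNeighbourhoods
  escapes {v} {x} {a} {b} v∈S x∈S a∈S b∈S v~x v~a v~b (x≢a , x≁a) (x≢b , x≁b) a≢b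
    with any? (λ w → (w ∈? S) ×-dec (x ~? w) ×-dec ¬? (v ≟ w) ×-dec ¬? (v ~? w))
  ... | yes (w , w∈S , x~w , v≢w , v≁w) = w , w∈S , x~w , v≢w , v≁w
  ... | no none = contradiction (begin-strict
      suc k                                        <⟨ s≤s (s≤s (minimum-degree x∈S)) ⟩
      2 + length (neighbourhood x)                 ≤⟨ s≤s (s≤s (length-∖ _≟_ (v ∷ []) (neighbourhood-unique x))) ⟩
      2 + (length inner + 1)                       ≡⟨ ℕ.+-comm 2 _ ⟩
      length inner + 1 + 2                         ≡⟨ ℕ.+-assoc (length inner) 1 2 ⟩
      length inner + 3                             ≡⟨ length-++ inner ⟨
      length (inner ++ x ∷ a ∷ b ∷ [])             ≤⟨ unique-length≤∣∣ (N v) unique sub ⟩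
      deg v                                        ≤⟨ deg≤ v ⟩
      suc k                                        ∎) (ℕ.<-irrefl refl)
    where
    open ℕ.≤-Reasoning
    inner : List (Fin n)
    inner = _∖_ _≟_ (neighbourhood x) (v ∷ [])
    inner⁻ : ∀ {u} → u ∈ˡ inner → x ~ u × v ~ u
    inner⁻ {u} u∈ with u∈nb , u∉ ← ∈-∖⁻ _≟_ (neighbourhood x) (v ∷ []) u∈ with x~u , u∈S ← ∈-neighbourhood⁻ u∈nb =
      x~u , decidable-stable (v ~? u) λ v≁u → none (u , u∈S , x~u , (λ v≡u → u∉ (here (sym v≡u))) , v≁u)
    unique : Unique (inner ++ x ∷ a ∷ b ∷ [])
    unique = Unique.++⁺ (∖-unique _≟_ (v ∷ []) (neighbourhood-unique x))
      ((x≢a ∷ x≢b ∷ []) ∷ (a≢b ∷ []) ∷ [] ∷ [])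
      λ { (u∈ , here refl) → ~-irrefl refl (proj₁ (inner⁻ u∈))
        ; (u∈ , there (here refl)) → x≁a (proj₁ (inner⁻ u∈))
        ; (u∈ , there (there (here refl))) → x≁b (proj₁ (inner⁻ u∈)) }
    sub : ∀ {u} → u ∈ˡ inner ++ x ∷ a ∷ b ∷ [] → u ∈ N v
    sub u∈ with ∈-++⁻ inner u∈
    ... | inj₁ u∈inner = N∋⁺ (proj₂ (inner⁻ u∈inner))
    ... | inj₂ (here refl) = N∋⁺ v~x
    ... | inj₂ (there (here refl)) = N∋⁺ v~a
    ... | inj₂ (there (there (here refl))) = N∋⁺ v~b

-- Patterns

claw : Facts
claw = pattern-facts 4 ((1 , 2) ∷ (1 , 3) ∷ (2 , 3) ∷ []) []

-- Found by a search through the claw-free graphs of small order. The first two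
-- are the octahedron and the join of K₂ and C₄.
configurations : List Configuration
configurations =
  configuration 6 ((0 , 2) ∷ (1 , 5) ∷ (3 , 4) ∷ []) (2 ∷ 2 ∷ 2 ∷ 2 ∷ 2 ∷ 2 ∷ []) ∷
  configuration 6 ((1 , 2) ∷ (3 , 4) ∷ []) (2 ∷ 2 ∷ 2 ∷ 2 ∷ 2 ∷ 3 ∷ []) ∷
  configuration 7 ((0 , 2) ∷ (0 , 3) ∷ (0 , 4) ∷ (1 , 2) ∷ (2 , 6) ∷ (4 , 5) ∷ [])
    (1 ∷ 2 ∷ 1 ∷ 3 ∷ 2 ∷ 3 ∷ 3 ∷ []) ∷
  configuration 7 ((0 , 1) ∷ (0 , 2) ∷ (0 , 3) ∷ (1 , 4) ∷ (2 , 6) ∷ (4 , 5) ∷ [])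
    (1 ∷ 1 ∷ 2 ∷ 3 ∷ 2 ∷ 3 ∷ 3 ∷ []) ∷
  configuration 7 ((0 , 2) ∷ (1 , 2) ∷ (2 , 5) ∷ (3 , 4) ∷ []) (1 ∷ 2 ∷ 1 ∷ 3 ∷ 3 ∷ 3 ∷ 4 ∷ []) ∷
  configuration 7 ((0 , 4) ∷ (1 , 2) ∷ (2 , 3) ∷ (4 , 5) ∷ []) (1 ∷ 2 ∷ 2 ∷ 3 ∷ 2 ∷ 3 ∷ 4 ∷ []) ∷
  configuration 7 ((0 , 1) ∷ (0 , 3) ∷ (1 , 2) ∷ (2 , 6) ∷ (3 , 4) ∷ []) (1 ∷ 1 ∷ 2 ∷ 2 ∷ 3 ∷ 4 ∷ 3 ∷ []) ∷
  configuration 7 ((0 , 2) ∷ (1 , 2) ∷ (1 , 4) ∷ (2 , 5) ∷ []) (1 ∷ 2 ∷ 1 ∷ 3 ∷ 3 ∷ 3 ∷ 4 ∷ []) ∷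
  configuration 7 ((1 , 2) ∷ (1 , 5) ∷ (2 , 4) ∷ []) (2 ∷ 1 ∷ 2 ∷ 3 ∷ 3 ∷ 3 ∷ 4 ∷ []) ∷
  configuration 8 ((0 , 1) ∷ (0 , 3) ∷ (0 , 5) ∷ (0 , 6) ∷ (1 , 2) ∷ (2 , 3) ∷ (2 , 4) ∷ (2 , 5) ∷ (5 , 7) ∷ [])
    (1 ∷ 1 ∷ 1 ∷ 2 ∷ 4 ∷ 2 ∷ 4 ∷ 4 ∷ []) ∷
  configuration 8 ((0 , 1) ∷ (0 , 4) ∷ (0 , 7) ∷ (1 , 3) ∷ (2 , 3) ∷ (2 , 4) ∷ (2 , 6) ∷ (3 , 7) ∷ [])
    (1 ∷ 1 ∷ 2 ∷ 2 ∷ 2 ∷ 5 ∷ 4 ∷ 3 ∷ []) ∷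
  configuration 10 ((0 , 3) ∷ (0 , 5) ∷ (0 , 6) ∷ (0 , 7) ∷ (0 , 8) ∷ (0 , 9) ∷ (1 , 3) ∷ (1 , 5) ∷ (1 , 6) ∷
    (1 , 8) ∷ (2 , 3) ∷ (2 , 5) ∷ (2 , 6) ∷ (2 , 8) ∷ (3 , 7) ∷ (4 , 5) ∷ (4 , 6) ∷ (4 , 7) ∷ (7 , 8) ∷ [])
    (1 ∷ 1 ∷ 2 ∷ 1 ∷ 4 ∷ 2 ∷ 3 ∷ 3 ∷ 3 ∷ 6 ∷ []) ∷
  []

-- The coefficients are evaluated during type checking, which is what the pruning in `coefficient`
-- is for.
configurations-reducible : All Configuration.Reducible configurations
configurations-reducible = from-yes (All.all? Configuration.reducible? configurations)

-- The order matters: in the refutations over this list, `leaf 0` is the claw and `leaf 1` to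
-- `leaf 12` are the configurations. Longer lists extend it at the end.
reducible-patterns : List Facts
reducible-patterns = claw ∷ map Configuration.facts configurations

-- The hub 0 joined to a thickening of the 5-cycle 1 , … , 5, that is, to its
-- blow-up by cliques of the given sizes. These, and the co-wagner pattern, are
-- not reducible in themselves: a neighbour of a suitable vertex outside of the
-- neighbourhood of 0 is needed.
thickening-31111 : Facts
thickening-31111 = pattern-facts 8 ((1 , 3) ∷ (1 , 4) ∷ (2 , 4) ∷ (2 , 5) ∷ (3 , 5) ∷ (3 , 6) ∷ (3 , 7) ∷
  (4 , 6) ∷ (4 , 7) ∷ []) []

-- Vertex 1 misses 3 and 4, so it has a neighbour 8 not adjacent to the hub. Only the adjacencies of
-- 8 to the vertices 2 to 7 are open, and the tree decides them.
thickening-31111-refuted : Refuted reducible-patterns thickening-31111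
thickening-31111-refuted = refuted-by
  (outer 1 3 4 8
   (split 2 8
    (split 6 8
     (split 5 8
      (leaf 2 (1 ∷ 0 ∷ 8 ∷ 2 ∷ 5 ∷ 6 ∷ []))
      (split 7 8
       (leaf 9 (1 ∷ 5 ∷ 8 ∷ 6 ∷ 0 ∷ 2 ∷ 7 ∷ []))
       (leaf 8 (0 ∷ 5 ∷ 8 ∷ 1 ∷ 2 ∷ 7 ∷ 6 ∷ []))))
     (split 3 8
      (split 5 8
       (leaf 4 (3 ∷ 6 ∷ 5 ∷ 1 ∷ 8 ∷ 0 ∷ 2 ∷ []))
       (split 7 8
        (leaf 3 (5 ∷ 1 ∷ 3 ∷ 2 ∷ 8 ∷ 0 ∷ 7 ∷ []))
        (leaf 10 (3 ∷ 6 ∷ 8 ∷ 7 ∷ 0 ∷ 5 ∷ 1 ∷ 2 ∷ []))))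
      (leaf 0 (2 ∷ 3 ∷ 6 ∷ 8 ∷ []))))
    (split 5 8
     (split 4 8
      (split 6 8
       (leaf 3 (2 ∷ 1 ∷ 4 ∷ 5 ∷ 8 ∷ 0 ∷ 6 ∷ []))
       (split 7 8
        (leaf 3 (2 ∷ 1 ∷ 4 ∷ 5 ∷ 8 ∷ 0 ∷ 7 ∷ []))
        (leaf 10 (4 ∷ 6 ∷ 8 ∷ 7 ∷ 0 ∷ 2 ∷ 1 ∷ 5 ∷ []))))
      (split 6 8
       (split 7 8
        (leaf 9 (1 ∷ 2 ∷ 8 ∷ 6 ∷ 0 ∷ 5 ∷ 7 ∷ []))
        (leaf 0 (5 ∷ 4 ∷ 7 ∷ 8 ∷ [])))
       (leaf 0 (5 ∷ 4 ∷ 6 ∷ 8 ∷ []))))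
     (leaf 0 (1 ∷ 2 ∷ 5 ∷ 8 ∷ [])))))

thickening-22112 : Facts
thickening-22112 = pattern-facts 9 ((1 , 3) ∷ (1 , 4) ∷ (2 , 4) ∷ (2 , 5) ∷ (2 , 8) ∷ (3 , 5) ∷ (3 , 6) ∷
  (3 , 8) ∷ (4 , 6) ∷ (4 , 7) ∷ (5 , 7) ∷ (7 , 8) ∷ []) []

thickening-22112-refuted : Refuted reducible-patterns thickening-22112
thickening-22112-refuted = refuted-by
  (outer 1 3 4 9
   (split 2 9
    (split 6 9
     (split 5 9
      (leaf 2 (1 ∷ 0 ∷ 9 ∷ 2 ∷ 5 ∷ 6 ∷ []))
      (split 7 9
       (leaf 8 (2 ∷ 9 ∷ 5 ∷ 1 ∷ 0 ∷ 7 ∷ 6 ∷ []))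
       (leaf 0 (1 ∷ 5 ∷ 7 ∷ 9 ∷ []))))
     (split 3 9
      (split 5 9
       (leaf 4 (3 ∷ 6 ∷ 5 ∷ 1 ∷ 9 ∷ 0 ∷ 2 ∷ []))
       (split 7 9
        (leaf 2 (2 ∷ 0 ∷ 9 ∷ 1 ∷ 3 ∷ 7 ∷ []))
        (leaf 0 (1 ∷ 5 ∷ 7 ∷ 9 ∷ []))))
      (leaf 0 (2 ∷ 3 ∷ 6 ∷ 9 ∷ []))))
    (split 5 9
     (split 8 9
      (split 4 9
       (leaf 2 (5 ∷ 0 ∷ 9 ∷ 1 ∷ 4 ∷ 8 ∷ []))
       (split 6 9
        (leaf 8 (1 ∷ 9 ∷ 4 ∷ 5 ∷ 0 ∷ 6 ∷ 8 ∷ []))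
        (leaf 0 (5 ∷ 4 ∷ 6 ∷ 9 ∷ []))))
      (leaf 0 (1 ∷ 2 ∷ 8 ∷ 9 ∷ [])))
     (leaf 0 (1 ∷ 2 ∷ 5 ∷ 9 ∷ [])))))

thickening-12212 : Facts
thickening-12212 = pattern-facts 9 ((1 , 3) ∷ (1 , 4) ∷ (1 , 7) ∷ (2 , 4) ∷ (2 , 5) ∷ (2 , 8) ∷ (3 , 5) ∷
  (3 , 8) ∷ (4 , 6) ∷ (5 , 6) ∷ (5 , 7) ∷ (6 , 8) ∷ (7 , 8) ∷ []) []

-- The outer neighbour 9 of 5 may be adjacent to just 1, 5 and 8, or to just 4, 5 and 8; these two
-- cases are the reason for the configuration on ten vertices, `leaf 12`.
thickening-12212-refuted : Refuted reducible-patterns thickening-12212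
thickening-12212-refuted = refuted-by
  (outer 5 2 3 9
   (split 1 9
    (split 8 9
     (split 4 9
      (leaf 2 (5 ∷ 0 ∷ 9 ∷ 1 ∷ 4 ∷ 8 ∷ []))
      (split 2 9
       (leaf 3 (4 ∷ 5 ∷ 2 ∷ 1 ∷ 9 ∷ 0 ∷ 8 ∷ []))
       (split 3 9
        (leaf 0 (3 ∷ 2 ∷ 4 ∷ 9 ∷ []))
        (split 6 9
         (leaf 3 (4 ∷ 5 ∷ 6 ∷ 1 ∷ 9 ∷ 0 ∷ 8 ∷ []))
         (split 7 9
          (leaf 0 (7 ∷ 2 ∷ 4 ∷ 9 ∷ []))
          (leaf 12 (9 ∷ 5 ∷ 8 ∷ 2 ∷ 1 ∷ 3 ∷ 7 ∷ 4 ∷ 6 ∷ 0 ∷ [])))))))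
     (split 2 9
      (split 6 9
       (split 3 9
        (leaf 2 (2 ∷ 0 ∷ 9 ∷ 1 ∷ 3 ∷ 6 ∷ []))
        (leaf 3 (3 ∷ 2 ∷ 5 ∷ 1 ∷ 9 ∷ 0 ∷ 6 ∷ [])))
       (leaf 0 (1 ∷ 6 ∷ 8 ∷ 9 ∷ [])))
      (leaf 0 (1 ∷ 2 ∷ 8 ∷ 9 ∷ []))))
    (split 4 9
     (split 8 9
      (split 3 9
       (leaf 3 (1 ∷ 5 ∷ 3 ∷ 4 ∷ 9 ∷ 0 ∷ 8 ∷ []))
       (split 2 9
        (leaf 0 (2 ∷ 1 ∷ 3 ∷ 9 ∷ []))
        (split 6 9
         (leaf 0 (6 ∷ 1 ∷ 3 ∷ 9 ∷ []))
         (split 7 9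
          (leaf 3 (1 ∷ 5 ∷ 7 ∷ 4 ∷ 9 ∷ 0 ∷ 8 ∷ []))
          (leaf 12 (9 ∷ 5 ∷ 8 ∷ 3 ∷ 4 ∷ 2 ∷ 6 ∷ 1 ∷ 7 ∷ 0 ∷ []))))))
      (split 3 9
       (split 7 9
        (split 2 9
         (leaf 2 (3 ∷ 0 ∷ 9 ∷ 2 ∷ 4 ∷ 7 ∷ []))
         (leaf 3 (2 ∷ 3 ∷ 5 ∷ 4 ∷ 9 ∷ 0 ∷ 7 ∷ [])))
        (leaf 0 (4 ∷ 7 ∷ 8 ∷ 9 ∷ [])))
       (leaf 0 (4 ∷ 3 ∷ 8 ∷ 9 ∷ []))))
     (leaf 0 (5 ∷ 1 ∷ 4 ∷ 9 ∷ [])))))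

-- The hub 0 joined to the complement of the Wagner graph.
co-wagner : Facts
co-wagner = pattern-facts 9 ((1 , 2) ∷ (1 , 3) ∷ (1 , 4) ∷ (2 , 5) ∷ (2 , 6) ∷ (3 , 5) ∷ (3 , 7) ∷ (4 , 6) ∷
  (4 , 8) ∷ (5 , 8) ∷ (6 , 7) ∷ (7 , 8) ∷ []) []

co-wagner-refuted : Refuted reducible-patterns co-wagner
co-wagner-refuted = refuted-by
  (outer 1 2 3 9
   (split 7 9
    (split 5 9
     (split 4 9
      (leaf 2 (5 ∷ 0 ∷ 9 ∷ 1 ∷ 4 ∷ 7 ∷ []))
      (split 6 9
       (leaf 2 (1 ∷ 0 ∷ 9 ∷ 6 ∷ 7 ∷ 5 ∷ []))
       (leaf 0 (5 ∷ 4 ∷ 6 ∷ 9 ∷ []))))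
     (split 2 9
      (split 8 9
       (leaf 1 (0 ∷ 1 ∷ 9 ∷ 7 ∷ 8 ∷ 2 ∷ []))
       (leaf 0 (1 ∷ 5 ∷ 8 ∷ 9 ∷ [])))
      (leaf 0 (7 ∷ 2 ∷ 5 ∷ 9 ∷ []))))
    (split 6 9
     (split 8 9
      (split 3 9
       (leaf 2 (6 ∷ 0 ∷ 9 ∷ 1 ∷ 3 ∷ 8 ∷ []))
       (split 5 9
        (leaf 2 (1 ∷ 0 ∷ 9 ∷ 5 ∷ 8 ∷ 6 ∷ []))
        (leaf 0 (6 ∷ 3 ∷ 5 ∷ 9 ∷ []))))
      (leaf 0 (1 ∷ 7 ∷ 8 ∷ 9 ∷ [])))
     (leaf 0 (1 ∷ 6 ∷ 7 ∷ 9 ∷ [])))))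

-- In the following patterns, the hub 0 of the 5-wheel with rim 1 , … , 5 has
-- further neighbours. The first of them, 6, is adjacent to the whole rim, to
-- four or to three consecutive vertices of it, or in an unknown way to it.
wheel-full : Facts
wheel-full = pattern-facts 8 ((1 , 3) ∷ (1 , 4) ∷ (2 , 4) ∷ (2 , 5) ∷ (3 , 5) ∷ []) ((1 , 7) ∷ (2 , 7) ∷
  (3 , 7) ∷ (4 , 7) ∷ (5 , 7) ∷ (6 , 7) ∷ [])

wheel-full-refuted : Refuted reducible-patterns wheel-full
wheel-full-refuted = refuted-by
  (split 1 7
   (split 2 7
    (split 3 7
     (split 6 7
      (split 4 7
       (leaf 9 (0 ∷ 1 ∷ 4 ∷ 6 ∷ 2 ∷ 3 ∷ 7 ∷ []))
       (leaf 8 (2 ∷ 1 ∷ 4 ∷ 0 ∷ 3 ∷ 7 ∷ 6 ∷ [])))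
      (leaf 2 (0 ∷ 1 ∷ 3 ∷ 6 ∷ 7 ∷ 2 ∷ [])))
     (split 5 7
      (split 6 7
       (leaf 8 (1 ∷ 5 ∷ 3 ∷ 0 ∷ 2 ∷ 7 ∷ 6 ∷ []))
       (leaf 2 (0 ∷ 2 ∷ 5 ∷ 6 ∷ 7 ∷ 1 ∷ [])))
      (leaf 0 (0 ∷ 3 ∷ 5 ∷ 7 ∷ []))))
    (split 4 7
     (split 5 7
      (split 6 7
       (leaf 8 (5 ∷ 4 ∷ 2 ∷ 0 ∷ 1 ∷ 7 ∷ 6 ∷ []))
       (leaf 2 (0 ∷ 1 ∷ 4 ∷ 6 ∷ 7 ∷ 5 ∷ [])))
      (leaf 0 (0 ∷ 2 ∷ 5 ∷ 7 ∷ [])))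
     (leaf 0 (0 ∷ 2 ∷ 4 ∷ 7 ∷ []))))
   (split 3 7
    (split 4 7
     (split 6 7
      (split 2 7
       (leaf 8 (3 ∷ 4 ∷ 1 ∷ 0 ∷ 2 ∷ 7 ∷ 6 ∷ []))
       (split 5 7
        (leaf 8 (4 ∷ 3 ∷ 1 ∷ 0 ∷ 5 ∷ 7 ∷ 6 ∷ []))
        (leaf 0 (0 ∷ 2 ∷ 5 ∷ 7 ∷ []))))
      (split 2 7
       (leaf 2 (0 ∷ 2 ∷ 4 ∷ 6 ∷ 7 ∷ 3 ∷ []))
       (split 5 7
        (leaf 2 (0 ∷ 3 ∷ 5 ∷ 6 ∷ 7 ∷ 4 ∷ []))
        (leaf 0 (0 ∷ 2 ∷ 5 ∷ 7 ∷ [])))))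
     (leaf 0 (0 ∷ 1 ∷ 4 ∷ 7 ∷ [])))
    (leaf 0 (0 ∷ 1 ∷ 3 ∷ 7 ∷ []))))

-- In leaves, 13 to 15 are the thickenings, 16 is `co-wagner` and 17 is `wheel-full`.
thickened-patterns : List Facts
thickened-patterns =
  reducible-patterns ++ thickening-31111 ∷ thickening-22112 ∷ thickening-12212 ∷ co-wagner ∷ wheel-full ∷ []

wheel-four : Facts
wheel-four = pattern-facts 9 ((1 , 3) ∷ (1 , 4) ∷ (1 , 6) ∷ (2 , 4) ∷ (2 , 5) ∷ (3 , 5) ∷ []) ((1 , 7) ∷
  (1 , 8) ∷ (2 , 7) ∷ (2 , 8) ∷ (3 , 7) ∷ (3 , 8) ∷ (4 , 7) ∷ (4 , 8) ∷ (5 , 7) ∷ (5 , 8) ∷ (6 , 7) ∷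
  (6 , 8) ∷ (7 , 8) ∷ [])

wheel-four-refuted : Refuted thickened-patterns wheel-four
wheel-four-refuted = refuted-by
  (split 1 7
   (split 1 8
    (split 2 7
     (split 5 7
      (split 6 7
       (leaf 2 (0 ∷ 1 ∷ 6 ∷ 2 ∷ 5 ∷ 7 ∷ []))
       (split 3 7
        (leaf 7 (1 ∷ 3 ∷ 5 ∷ 6 ∷ 7 ∷ 0 ∷ 2 ∷ []))
        (split 4 7
         (leaf 7 (1 ∷ 4 ∷ 2 ∷ 6 ∷ 7 ∷ 0 ∷ 5 ∷ []))
         (split 7 8
          (split 2 8
           (split 5 8
            (split 6 8
             (leaf 2 (0 ∷ 1 ∷ 6 ∷ 2 ∷ 5 ∷ 8 ∷ []))
             (leaf 5 (1 ∷ 7 ∷ 6 ∷ 2 ∷ 5 ∷ 8 ∷ 0 ∷ [])))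
            (split 3 8
             (split 6 8
              (leaf 6 (1 ∷ 2 ∷ 5 ∷ 8 ∷ 6 ∷ 7 ∷ 0 ∷ []))
              (leaf 11 (6 ∷ 1 ∷ 5 ∷ 3 ∷ 8 ∷ 0 ∷ 2 ∷ 7 ∷ [])))
             (leaf 0 (0 ∷ 3 ∷ 5 ∷ 8 ∷ []))))
           (split 4 8
            (split 5 8
             (split 6 8
              (leaf 6 (1 ∷ 5 ∷ 2 ∷ 8 ∷ 6 ∷ 7 ∷ 0 ∷ []))
              (leaf 11 (6 ∷ 1 ∷ 2 ∷ 4 ∷ 8 ∷ 0 ∷ 5 ∷ 7 ∷ [])))
             (leaf 0 (0 ∷ 2 ∷ 5 ∷ 8 ∷ [])))
            (leaf 0 (0 ∷ 2 ∷ 4 ∷ 8 ∷ []))))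
          (split 3 8
           (split 4 8
            (split 6 8
             (split 2 8
              (leaf 8 (3 ∷ 4 ∷ 1 ∷ 0 ∷ 2 ∷ 6 ∷ 8 ∷ []))
              (split 5 8
               (leaf 7 (3 ∷ 5 ∷ 2 ∷ 1 ∷ 6 ∷ 0 ∷ 8 ∷ []))
               (leaf 0 (0 ∷ 2 ∷ 5 ∷ 8 ∷ []))))
             (leaf 0 (0 ∷ 6 ∷ 7 ∷ 8 ∷ [])))
            (leaf 0 (0 ∷ 4 ∷ 7 ∷ 8 ∷ [])))
           (leaf 0 (0 ∷ 3 ∷ 7 ∷ 8 ∷ [])))))))
      (split 3 7
       (split 4 7
        (split 6 7
         (leaf 7 (2 ∷ 4 ∷ 1 ∷ 5 ∷ 7 ∷ 0 ∷ 6 ∷ []))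
         (leaf 2 (0 ∷ 2 ∷ 4 ∷ 6 ∷ 7 ∷ 3 ∷ [])))
        (split 6 7
         (leaf 11 (5 ∷ 2 ∷ 1 ∷ 4 ∷ 3 ∷ 0 ∷ 6 ∷ 7 ∷ []))
         (split 5 8
          (split 2 8
           (split 6 8
            (leaf 2 (0 ∷ 1 ∷ 6 ∷ 2 ∷ 5 ∷ 8 ∷ []))
            (split 3 8
             (leaf 7 (1 ∷ 3 ∷ 5 ∷ 6 ∷ 8 ∷ 0 ∷ 2 ∷ []))
             (split 7 8
              (leaf 11 (6 ∷ 1 ∷ 5 ∷ 3 ∷ 7 ∷ 0 ∷ 2 ∷ 8 ∷ []))
              (leaf 0 (0 ∷ 6 ∷ 7 ∷ 8 ∷ [])))))
           (split 4 8
            (split 6 8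
             (split 3 8
              (leaf 7 (3 ∷ 5 ∷ 2 ∷ 1 ∷ 6 ∷ 0 ∷ 8 ∷ []))
              (leaf 11 (2 ∷ 5 ∷ 1 ∷ 3 ∷ 4 ∷ 0 ∷ 6 ∷ 8 ∷ [])))
             (split 3 8
              (leaf 2 (0 ∷ 3 ∷ 5 ∷ 6 ∷ 8 ∷ 4 ∷ []))
              (split 7 8
               (leaf 16 (0 ∷ 1 ∷ 6 ∷ 3 ∷ 4 ∷ 8 ∷ 7 ∷ 5 ∷ 2 ∷ []))
               (leaf 0 (0 ∷ 6 ∷ 7 ∷ 8 ∷ [])))))
            (leaf 0 (0 ∷ 2 ∷ 4 ∷ 8 ∷ []))))
          (split 2 8
           (split 3 8
            (split 7 8
             (split 4 8
              (leaf 8 (2 ∷ 1 ∷ 4 ∷ 0 ∷ 3 ∷ 7 ∷ 8 ∷ []))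
              (leaf 13 (0 ∷ 2 ∷ 1 ∷ 5 ∷ 4 ∷ 3 ∷ 7 ∷ 8 ∷ [])))
             (leaf 0 (0 ∷ 5 ∷ 7 ∷ 8 ∷ [])))
            (leaf 0 (0 ∷ 3 ∷ 5 ∷ 8 ∷ [])))
           (leaf 0 (0 ∷ 2 ∷ 5 ∷ 8 ∷ []))))))
       (leaf 0 (0 ∷ 3 ∷ 5 ∷ 7 ∷ []))))
     (split 4 7
      (split 5 7
       (split 3 7
        (split 6 7
         (leaf 7 (3 ∷ 5 ∷ 2 ∷ 1 ∷ 6 ∷ 0 ∷ 7 ∷ []))
         (leaf 2 (0 ∷ 3 ∷ 5 ∷ 6 ∷ 7 ∷ 4 ∷ [])))
        (split 6 7
         (leaf 11 (2 ∷ 5 ∷ 1 ∷ 3 ∷ 4 ∷ 0 ∷ 6 ∷ 7 ∷ []))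
         (split 2 8
          (split 5 8
           (split 6 8
            (leaf 2 (0 ∷ 1 ∷ 6 ∷ 2 ∷ 5 ∷ 8 ∷ []))
            (split 4 8
             (leaf 7 (1 ∷ 4 ∷ 2 ∷ 6 ∷ 8 ∷ 0 ∷ 5 ∷ []))
             (split 7 8
              (leaf 11 (6 ∷ 1 ∷ 2 ∷ 4 ∷ 7 ∷ 0 ∷ 5 ∷ 8 ∷ []))
              (leaf 0 (0 ∷ 6 ∷ 7 ∷ 8 ∷ [])))))
           (split 3 8
            (split 6 8
             (split 4 8
              (leaf 7 (2 ∷ 4 ∷ 1 ∷ 5 ∷ 8 ∷ 0 ∷ 6 ∷ []))
              (leaf 11 (5 ∷ 2 ∷ 1 ∷ 4 ∷ 3 ∷ 0 ∷ 6 ∷ 8 ∷ [])))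
             (split 4 8
              (leaf 2 (0 ∷ 2 ∷ 4 ∷ 6 ∷ 8 ∷ 3 ∷ []))
              (split 7 8
               (leaf 16 (0 ∷ 1 ∷ 6 ∷ 3 ∷ 4 ∷ 7 ∷ 8 ∷ 5 ∷ 2 ∷ []))
               (leaf 0 (0 ∷ 6 ∷ 7 ∷ 8 ∷ [])))))
            (leaf 0 (0 ∷ 3 ∷ 5 ∷ 8 ∷ []))))
          (split 4 8
           (split 5 8
            (split 7 8
             (split 3 8
              (leaf 8 (5 ∷ 1 ∷ 3 ∷ 0 ∷ 4 ∷ 7 ∷ 8 ∷ []))
              (leaf 13 (0 ∷ 5 ∷ 1 ∷ 2 ∷ 3 ∷ 4 ∷ 7 ∷ 8 ∷ [])))
             (leaf 0 (0 ∷ 2 ∷ 7 ∷ 8 ∷ [])))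
            (leaf 0 (0 ∷ 2 ∷ 5 ∷ 8 ∷ [])))
           (leaf 0 (0 ∷ 2 ∷ 4 ∷ 8 ∷ []))))))
       (leaf 0 (0 ∷ 2 ∷ 5 ∷ 7 ∷ [])))
      (leaf 0 (0 ∷ 2 ∷ 4 ∷ 7 ∷ []))))
    (split 3 8
     (split 4 8
      (split 6 8
       (split 2 8
        (split 5 8
         (leaf 9 (0 ∷ 2 ∷ 5 ∷ 6 ∷ 3 ∷ 4 ∷ 8 ∷ []))
         (leaf 8 (3 ∷ 2 ∷ 5 ∷ 0 ∷ 4 ∷ 8 ∷ 6 ∷ [])))
        (split 5 8
         (leaf 8 (4 ∷ 5 ∷ 2 ∷ 0 ∷ 3 ∷ 8 ∷ 6 ∷ []))
         (leaf 0 (0 ∷ 2 ∷ 5 ∷ 8 ∷ []))))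
       (leaf 0 (0 ∷ 1 ∷ 6 ∷ 8 ∷ [])))
      (leaf 0 (0 ∷ 1 ∷ 4 ∷ 8 ∷ [])))
     (leaf 0 (0 ∷ 1 ∷ 3 ∷ 8 ∷ []))))
   (split 3 7
    (split 4 7
     (split 6 7
      (split 2 7
       (split 5 7
        (leaf 9 (0 ∷ 2 ∷ 5 ∷ 6 ∷ 3 ∷ 4 ∷ 7 ∷ []))
        (leaf 8 (3 ∷ 2 ∷ 5 ∷ 0 ∷ 4 ∷ 7 ∷ 6 ∷ [])))
       (split 5 7
        (leaf 8 (4 ∷ 5 ∷ 2 ∷ 0 ∷ 3 ∷ 7 ∷ 6 ∷ []))
        (leaf 0 (0 ∷ 2 ∷ 5 ∷ 7 ∷ []))))
      (leaf 0 (0 ∷ 1 ∷ 6 ∷ 7 ∷ [])))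
     (leaf 0 (0 ∷ 1 ∷ 4 ∷ 7 ∷ [])))
    (leaf 0 (0 ∷ 1 ∷ 3 ∷ 7 ∷ []))))

wheel-three : Facts
wheel-three = pattern-facts 9 ((1 , 3) ∷ (1 , 4) ∷ (2 , 4) ∷ (2 , 5) ∷ (3 , 5) ∷ (3 , 6) ∷ (4 , 6) ∷ [])
  ((1 , 7) ∷ (1 , 8) ∷ (2 , 7) ∷ (2 , 8) ∷ (3 , 7) ∷ (3 , 8) ∷ (4 , 7) ∷ (4 , 8) ∷ (5 , 7) ∷ (5 , 8) ∷
  (6 , 7) ∷ (6 , 8) ∷ (7 , 8) ∷ [])

-- Vertex 6 is a clone of 1. If 7 or 8 is adjacent to four or five vertices of the rim, `leaf 18` or
-- `leaf 17` applies to a rotated or reflected wheel. Otherwise they are clones as well: wrong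
-- adjacencies among clones give claws, configurations or `wheel-four` around another 5-cycle, and
-- the right ones give a thickening.
wheel-three-refuted : Refuted (thickened-patterns ++ wheel-four ∷ []) wheel-three
wheel-three-refuted = refuted-by
  (split 3 7
   (split 3 8
    (split 4 7
     (split 4 8
      (split 2 7
       (split 5 7
        (split 1 7
         (leaf 17 (0 ∷ 1 ∷ 2 ∷ 3 ∷ 4 ∷ 5 ∷ 7 ∷ 6 ∷ []))
         (leaf 18 (0 ∷ 1 ∷ 2 ∷ 3 ∷ 4 ∷ 5 ∷ 7 ∷ 6 ∷ 8 ∷ [])))
        (split 1 7
         (leaf 18 (0 ∷ 5 ∷ 1 ∷ 2 ∷ 3 ∷ 4 ∷ 7 ∷ 6 ∷ 8 ∷ []))
         (split 6 7
          (leaf 18 (0 ∷ 4 ∷ 5 ∷ 1 ∷ 2 ∷ 7 ∷ 6 ∷ 3 ∷ 8 ∷ []))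
          (split 2 8
           (split 7 8
            (split 1 8
             (leaf 8 (3 ∷ 4 ∷ 1 ∷ 0 ∷ 2 ∷ 7 ∷ 8 ∷ []))
             (split 5 8
              (leaf 8 (3 ∷ 2 ∷ 5 ∷ 0 ∷ 4 ∷ 7 ∷ 8 ∷ []))
              (leaf 13 (0 ∷ 3 ∷ 2 ∷ 1 ∷ 5 ∷ 4 ∷ 7 ∷ 8 ∷ []))))
            (leaf 2 (0 ∷ 2 ∷ 4 ∷ 7 ∷ 8 ∷ 3 ∷ [])))
           (split 5 8
            (split 1 8
             (leaf 18 (0 ∷ 2 ∷ 1 ∷ 5 ∷ 4 ∷ 3 ∷ 8 ∷ 6 ∷ 7 ∷ []))
             (split 6 8
              (leaf 18 (0 ∷ 2 ∷ 3 ∷ 4 ∷ 5 ∷ 6 ∷ 8 ∷ 1 ∷ 7 ∷ []))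
              (split 7 8
               (leaf 15 (0 ∷ 2 ∷ 3 ∷ 4 ∷ 5 ∷ 1 ∷ 7 ∷ 8 ∷ 6 ∷ []))
               (leaf 0 (0 ∷ 1 ∷ 7 ∷ 8 ∷ [])))))
            (leaf 0 (0 ∷ 2 ∷ 5 ∷ 8 ∷ [])))))))
       (split 5 7
        (split 1 7
         (leaf 18 (0 ∷ 2 ∷ 1 ∷ 5 ∷ 4 ∷ 3 ∷ 7 ∷ 6 ∷ 8 ∷ []))
         (split 6 7
          (leaf 18 (0 ∷ 2 ∷ 3 ∷ 4 ∷ 5 ∷ 6 ∷ 7 ∷ 1 ∷ 8 ∷ []))
          (split 5 8
           (split 7 8
            (split 1 8
             (leaf 8 (4 ∷ 3 ∷ 1 ∷ 0 ∷ 5 ∷ 7 ∷ 8 ∷ []))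
             (split 2 8
              (leaf 8 (4 ∷ 5 ∷ 2 ∷ 0 ∷ 3 ∷ 7 ∷ 8 ∷ []))
              (leaf 13 (0 ∷ 4 ∷ 3 ∷ 2 ∷ 1 ∷ 5 ∷ 7 ∷ 8 ∷ []))))
            (leaf 2 (0 ∷ 3 ∷ 5 ∷ 7 ∷ 8 ∷ 4 ∷ [])))
           (split 2 8
            (split 1 8
             (leaf 18 (0 ∷ 5 ∷ 1 ∷ 2 ∷ 3 ∷ 4 ∷ 8 ∷ 6 ∷ 7 ∷ []))
             (split 6 8
              (leaf 18 (0 ∷ 4 ∷ 5 ∷ 1 ∷ 2 ∷ 8 ∷ 6 ∷ 3 ∷ 7 ∷ []))
              (split 7 8
               (leaf 15 (0 ∷ 2 ∷ 3 ∷ 4 ∷ 5 ∷ 1 ∷ 8 ∷ 7 ∷ 6 ∷ []))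
               (leaf 0 (0 ∷ 1 ∷ 7 ∷ 8 ∷ [])))))
            (leaf 0 (0 ∷ 2 ∷ 5 ∷ 8 ∷ []))))))
        (leaf 0 (0 ∷ 2 ∷ 5 ∷ 7 ∷ []))))
      (split 1 8
       (split 2 8
        (split 5 8
         (leaf 18 (0 ∷ 4 ∷ 3 ∷ 2 ∷ 1 ∷ 5 ∷ 8 ∷ 6 ∷ 7 ∷ []))
         (split 6 8
          (split 5 7
           (split 1 7
            (split 2 7
             (leaf 17 (0 ∷ 1 ∷ 2 ∷ 3 ∷ 4 ∷ 5 ∷ 7 ∷ 6 ∷ []))
             (leaf 18 (0 ∷ 2 ∷ 1 ∷ 5 ∷ 4 ∷ 3 ∷ 7 ∷ 6 ∷ 8 ∷ [])))
            (split 2 7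
             (leaf 18 (0 ∷ 1 ∷ 2 ∷ 3 ∷ 4 ∷ 5 ∷ 7 ∷ 6 ∷ 8 ∷ []))
             (split 6 7
              (leaf 18 (0 ∷ 2 ∷ 3 ∷ 4 ∷ 5 ∷ 6 ∷ 7 ∷ 1 ∷ 8 ∷ []))
              (split 7 8
               (leaf 11 (7 ∷ 1 ∷ 5 ∷ 3 ∷ 2 ∷ 0 ∷ 8 ∷ 6 ∷ []))
               (leaf 15 (0 ∷ 3 ∷ 2 ∷ 1 ∷ 5 ∷ 4 ∷ 8 ∷ 6 ∷ 7 ∷ []))))))
           (split 2 7
            (split 1 7
             (leaf 18 (0 ∷ 5 ∷ 1 ∷ 2 ∷ 3 ∷ 4 ∷ 7 ∷ 6 ∷ 8 ∷ []))
             (split 6 7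
              (leaf 18 (0 ∷ 4 ∷ 5 ∷ 1 ∷ 2 ∷ 7 ∷ 6 ∷ 3 ∷ 8 ∷ []))
              (split 7 8
               (leaf 14 (0 ∷ 2 ∷ 1 ∷ 5 ∷ 4 ∷ 3 ∷ 8 ∷ 6 ∷ 7 ∷ []))
               (leaf 0 (0 ∷ 5 ∷ 7 ∷ 8 ∷ [])))))
            (leaf 0 (0 ∷ 2 ∷ 5 ∷ 7 ∷ []))))
          (leaf 0 (0 ∷ 4 ∷ 6 ∷ 8 ∷ []))))
        (leaf 0 (0 ∷ 2 ∷ 4 ∷ 8 ∷ [])))
       (leaf 0 (0 ∷ 1 ∷ 4 ∷ 8 ∷ []))))
     (split 1 7
      (split 2 7
       (split 5 7
        (leaf 18 (0 ∷ 4 ∷ 3 ∷ 2 ∷ 1 ∷ 5 ∷ 7 ∷ 6 ∷ 8 ∷ []))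
        (split 6 7
         (split 4 8
          (split 5 8
           (split 1 8
            (split 2 8
             (leaf 17 (0 ∷ 1 ∷ 2 ∷ 3 ∷ 4 ∷ 5 ∷ 8 ∷ 6 ∷ []))
             (leaf 18 (0 ∷ 2 ∷ 1 ∷ 5 ∷ 4 ∷ 3 ∷ 8 ∷ 6 ∷ 7 ∷ [])))
            (split 2 8
             (leaf 18 (0 ∷ 1 ∷ 2 ∷ 3 ∷ 4 ∷ 5 ∷ 8 ∷ 6 ∷ 7 ∷ []))
             (split 6 8
              (leaf 18 (0 ∷ 2 ∷ 3 ∷ 4 ∷ 5 ∷ 6 ∷ 8 ∷ 1 ∷ 7 ∷ []))
              (split 7 8
               (leaf 11 (8 ∷ 1 ∷ 5 ∷ 3 ∷ 2 ∷ 0 ∷ 7 ∷ 6 ∷ []))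
               (leaf 15 (0 ∷ 3 ∷ 2 ∷ 1 ∷ 5 ∷ 4 ∷ 7 ∷ 6 ∷ 8 ∷ []))))))
           (split 2 8
            (split 1 8
             (leaf 18 (0 ∷ 5 ∷ 1 ∷ 2 ∷ 3 ∷ 4 ∷ 8 ∷ 6 ∷ 7 ∷ []))
             (split 6 8
              (leaf 18 (0 ∷ 4 ∷ 5 ∷ 1 ∷ 2 ∷ 8 ∷ 6 ∷ 3 ∷ 7 ∷ []))
              (split 7 8
               (leaf 14 (0 ∷ 2 ∷ 1 ∷ 5 ∷ 4 ∷ 3 ∷ 7 ∷ 6 ∷ 8 ∷ []))
               (leaf 0 (0 ∷ 5 ∷ 7 ∷ 8 ∷ [])))))
            (leaf 0 (0 ∷ 2 ∷ 5 ∷ 8 ∷ []))))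
          (split 1 8
           (split 2 8
            (split 5 8
             (leaf 18 (0 ∷ 4 ∷ 3 ∷ 2 ∷ 1 ∷ 5 ∷ 8 ∷ 6 ∷ 7 ∷ []))
             (split 7 8
              (leaf 13 (0 ∷ 2 ∷ 1 ∷ 5 ∷ 4 ∷ 3 ∷ 7 ∷ 8 ∷ []))
              (leaf 0 (0 ∷ 4 ∷ 7 ∷ 8 ∷ []))))
            (leaf 0 (0 ∷ 2 ∷ 4 ∷ 8 ∷ [])))
           (leaf 0 (0 ∷ 1 ∷ 4 ∷ 8 ∷ []))))
         (leaf 0 (0 ∷ 4 ∷ 6 ∷ 7 ∷ []))))
       (leaf 0 (0 ∷ 2 ∷ 4 ∷ 7 ∷ [])))
      (leaf 0 (0 ∷ 1 ∷ 4 ∷ 7 ∷ []))))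
    (split 1 8
     (split 5 8
      (split 6 8
       (split 2 8
        (split 4 8
         (leaf 8 (1 ∷ 2 ∷ 4 ∷ 0 ∷ 5 ∷ 6 ∷ 8 ∷ []))
         (leaf 13 (0 ∷ 1 ∷ 2 ∷ 3 ∷ 4 ∷ 5 ∷ 6 ∷ 8 ∷ [])))
        (split 4 8
         (split 2 7
          (split 4 7
           (split 1 7
            (split 5 7
             (leaf 17 (0 ∷ 1 ∷ 2 ∷ 3 ∷ 4 ∷ 5 ∷ 7 ∷ 6 ∷ []))
             (leaf 18 (0 ∷ 5 ∷ 1 ∷ 2 ∷ 3 ∷ 4 ∷ 7 ∷ 6 ∷ 8 ∷ [])))
            (split 5 7
             (leaf 18 (0 ∷ 1 ∷ 2 ∷ 3 ∷ 4 ∷ 5 ∷ 7 ∷ 6 ∷ 8 ∷ []))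
             (split 6 7
              (leaf 18 (0 ∷ 4 ∷ 5 ∷ 1 ∷ 2 ∷ 7 ∷ 6 ∷ 3 ∷ 8 ∷ []))
              (split 7 8
               (leaf 11 (7 ∷ 1 ∷ 2 ∷ 4 ∷ 5 ∷ 0 ∷ 8 ∷ 6 ∷ []))
               (leaf 15 (0 ∷ 2 ∷ 1 ∷ 5 ∷ 4 ∷ 3 ∷ 6 ∷ 8 ∷ 7 ∷ []))))))
           (split 1 7
            (split 5 7
             (leaf 18 (0 ∷ 4 ∷ 3 ∷ 2 ∷ 1 ∷ 5 ∷ 7 ∷ 6 ∷ 8 ∷ []))
             (split 6 7
              (split 7 8
               (leaf 8 (1 ∷ 7 ∷ 4 ∷ 0 ∷ 5 ∷ 6 ∷ 8 ∷ []))
               (leaf 14 (0 ∷ 1 ∷ 2 ∷ 3 ∷ 4 ∷ 5 ∷ 6 ∷ 7 ∷ 8 ∷ [])))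
              (leaf 0 (0 ∷ 4 ∷ 6 ∷ 7 ∷ []))))
            (leaf 0 (0 ∷ 1 ∷ 4 ∷ 7 ∷ []))))
          (split 4 7
           (split 5 7
            (split 1 7
             (leaf 18 (0 ∷ 2 ∷ 1 ∷ 5 ∷ 4 ∷ 3 ∷ 7 ∷ 6 ∷ 8 ∷ []))
             (split 6 7
              (leaf 18 (0 ∷ 2 ∷ 3 ∷ 4 ∷ 5 ∷ 6 ∷ 7 ∷ 1 ∷ 8 ∷ []))
              (split 7 8
               (leaf 14 (0 ∷ 5 ∷ 1 ∷ 2 ∷ 3 ∷ 4 ∷ 8 ∷ 6 ∷ 7 ∷ []))
               (leaf 0 (0 ∷ 2 ∷ 7 ∷ 8 ∷ [])))))
            (leaf 0 (0 ∷ 2 ∷ 5 ∷ 7 ∷ [])))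
           (leaf 0 (0 ∷ 2 ∷ 4 ∷ 7 ∷ []))))
         (leaf 0 (0 ∷ 2 ∷ 4 ∷ 8 ∷ []))))
       (leaf 0 (0 ∷ 3 ∷ 6 ∷ 8 ∷ [])))
      (leaf 0 (0 ∷ 3 ∷ 5 ∷ 8 ∷ [])))
     (leaf 0 (0 ∷ 1 ∷ 3 ∷ 8 ∷ []))))
   (split 1 7
    (split 5 7
     (split 6 7
      (split 2 7
       (split 4 7
        (leaf 8 (1 ∷ 2 ∷ 4 ∷ 0 ∷ 5 ∷ 6 ∷ 7 ∷ []))
        (leaf 13 (0 ∷ 1 ∷ 2 ∷ 3 ∷ 4 ∷ 5 ∷ 6 ∷ 7 ∷ [])))
       (split 4 7
        (split 3 8
         (split 2 8
          (split 4 8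
           (split 1 8
            (split 5 8
             (leaf 17 (0 ∷ 1 ∷ 2 ∷ 3 ∷ 4 ∷ 5 ∷ 8 ∷ 6 ∷ []))
             (leaf 18 (0 ∷ 5 ∷ 1 ∷ 2 ∷ 3 ∷ 4 ∷ 8 ∷ 6 ∷ 7 ∷ [])))
            (split 5 8
             (leaf 18 (0 ∷ 1 ∷ 2 ∷ 3 ∷ 4 ∷ 5 ∷ 8 ∷ 6 ∷ 7 ∷ []))
             (split 6 8
              (leaf 18 (0 ∷ 4 ∷ 5 ∷ 1 ∷ 2 ∷ 8 ∷ 6 ∷ 3 ∷ 7 ∷ []))
              (split 7 8
               (leaf 11 (8 ∷ 1 ∷ 2 ∷ 4 ∷ 5 ∷ 0 ∷ 7 ∷ 6 ∷ []))
               (leaf 15 (0 ∷ 2 ∷ 1 ∷ 5 ∷ 4 ∷ 3 ∷ 6 ∷ 7 ∷ 8 ∷ []))))))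
           (split 1 8
            (split 5 8
             (leaf 18 (0 ∷ 4 ∷ 3 ∷ 2 ∷ 1 ∷ 5 ∷ 8 ∷ 6 ∷ 7 ∷ []))
             (split 6 8
              (split 7 8
               (leaf 8 (1 ∷ 7 ∷ 3 ∷ 0 ∷ 2 ∷ 6 ∷ 8 ∷ []))
               (leaf 14 (0 ∷ 1 ∷ 2 ∷ 3 ∷ 4 ∷ 5 ∷ 6 ∷ 8 ∷ 7 ∷ [])))
              (leaf 0 (0 ∷ 4 ∷ 6 ∷ 8 ∷ []))))
            (leaf 0 (0 ∷ 1 ∷ 4 ∷ 8 ∷ []))))
          (split 4 8
           (split 5 8
            (split 1 8
             (leaf 18 (0 ∷ 2 ∷ 1 ∷ 5 ∷ 4 ∷ 3 ∷ 8 ∷ 6 ∷ 7 ∷ []))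
             (split 6 8
              (leaf 18 (0 ∷ 2 ∷ 3 ∷ 4 ∷ 5 ∷ 6 ∷ 8 ∷ 1 ∷ 7 ∷ []))
              (split 7 8
               (leaf 14 (0 ∷ 5 ∷ 1 ∷ 2 ∷ 3 ∷ 4 ∷ 7 ∷ 6 ∷ 8 ∷ []))
               (leaf 0 (0 ∷ 2 ∷ 7 ∷ 8 ∷ [])))))
            (leaf 0 (0 ∷ 2 ∷ 5 ∷ 8 ∷ [])))
           (leaf 0 (0 ∷ 2 ∷ 4 ∷ 8 ∷ []))))
         (split 1 8
          (split 5 8
           (split 6 8
            (split 7 8
             (split 2 8
              (split 4 8
               (leaf 8 (1 ∷ 2 ∷ 4 ∷ 0 ∷ 5 ∷ 6 ∷ 8 ∷ []))
               (leaf 13 (0 ∷ 1 ∷ 2 ∷ 3 ∷ 4 ∷ 5 ∷ 6 ∷ 8 ∷ [])))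
              (split 4 8
               (leaf 13 (0 ∷ 5 ∷ 1 ∷ 2 ∷ 3 ∷ 4 ∷ 7 ∷ 8 ∷ []))
               (leaf 0 (0 ∷ 2 ∷ 4 ∷ 8 ∷ []))))
             (leaf 0 (0 ∷ 3 ∷ 7 ∷ 8 ∷ [])))
            (leaf 0 (0 ∷ 3 ∷ 6 ∷ 8 ∷ [])))
           (leaf 0 (0 ∷ 3 ∷ 5 ∷ 8 ∷ [])))
          (leaf 0 (0 ∷ 1 ∷ 3 ∷ 8 ∷ []))))
        (leaf 0 (0 ∷ 2 ∷ 4 ∷ 7 ∷ []))))
      (leaf 0 (0 ∷ 3 ∷ 6 ∷ 7 ∷ [])))
     (leaf 0 (0 ∷ 3 ∷ 5 ∷ 7 ∷ [])))
    (leaf 0 (0 ∷ 1 ∷ 3 ∷ 7 ∷ []))))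

wheel-eight : Facts
wheel-eight = pattern-facts 9 ((1 , 3) ∷ (1 , 4) ∷ (2 , 4) ∷ (2 , 5) ∷ (3 , 5) ∷ []) ((1 , 6) ∷ (1 , 7) ∷
  (1 , 8) ∷ (2 , 6) ∷ (2 , 7) ∷ (2 , 8) ∷ (3 , 6) ∷ (3 , 7) ∷ (3 , 8) ∷ (4 , 6) ∷ (4 , 7) ∷ (4 , 8) ∷
  (5 , 6) ∷ (5 , 7) ∷ (5 , 8) ∷ (6 , 7) ∷ (6 , 8) ∷ (7 , 8) ∷ [])

-- A neighbour of the hub that misses two nonadjacent vertices of the rim completes a claw at the
-- hub. What it misses is therefore nothing, one vertex or two consecutive ones, and symmetry of the
-- rim leads to one of the three wheels.
wheel-eight-refuted : Refuted (claw ∷ wheel-full ∷ wheel-four ∷ wheel-three ∷ []) wheel-eight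
wheel-eight-refuted = refuted-by
  (split 1 6
   (split 1 7
    (split 1 8
     (split 2 6
      (split 2 7
       (split 2 8
        (split 3 6
         (split 4 6
          (split 5 6
           (leaf 1 (0 ∷ 1 ∷ 2 ∷ 3 ∷ 4 ∷ 5 ∷ 6 ∷ 7 ∷ []))
           (leaf 2 (0 ∷ 5 ∷ 1 ∷ 2 ∷ 3 ∷ 4 ∷ 6 ∷ 7 ∷ 8 ∷ [])))
          (split 5 6
           (leaf 2 (0 ∷ 4 ∷ 3 ∷ 2 ∷ 1 ∷ 5 ∷ 6 ∷ 7 ∷ 8 ∷ []))
           (leaf 3 (0 ∷ 2 ∷ 1 ∷ 5 ∷ 4 ∷ 3 ∷ 6 ∷ 7 ∷ 8 ∷ []))))
         (split 5 6
          (split 4 6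
           (leaf 2 (0 ∷ 3 ∷ 2 ∷ 1 ∷ 5 ∷ 4 ∷ 6 ∷ 7 ∷ 8 ∷ []))
           (leaf 3 (0 ∷ 1 ∷ 2 ∷ 3 ∷ 4 ∷ 5 ∷ 6 ∷ 7 ∷ 8 ∷ [])))
          (leaf 0 (0 ∷ 3 ∷ 5 ∷ 6 ∷ []))))
        (split 4 8
         (split 5 8
          (split 3 8
           (leaf 2 (0 ∷ 2 ∷ 1 ∷ 5 ∷ 4 ∷ 3 ∷ 8 ∷ 6 ∷ 7 ∷ []))
           (leaf 3 (0 ∷ 5 ∷ 1 ∷ 2 ∷ 3 ∷ 4 ∷ 8 ∷ 6 ∷ 7 ∷ [])))
          (leaf 0 (0 ∷ 2 ∷ 5 ∷ 8 ∷ [])))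
         (leaf 0 (0 ∷ 2 ∷ 4 ∷ 8 ∷ []))))
       (split 4 7
        (split 5 7
         (split 3 7
          (leaf 2 (0 ∷ 2 ∷ 1 ∷ 5 ∷ 4 ∷ 3 ∷ 7 ∷ 6 ∷ 8 ∷ []))
          (leaf 3 (0 ∷ 5 ∷ 1 ∷ 2 ∷ 3 ∷ 4 ∷ 7 ∷ 6 ∷ 8 ∷ [])))
         (leaf 0 (0 ∷ 2 ∷ 5 ∷ 7 ∷ [])))
        (leaf 0 (0 ∷ 2 ∷ 4 ∷ 7 ∷ []))))
      (split 4 6
       (split 5 6
        (split 3 6
         (leaf 2 (0 ∷ 2 ∷ 1 ∷ 5 ∷ 4 ∷ 3 ∷ 6 ∷ 7 ∷ 8 ∷ []))
         (leaf 3 (0 ∷ 5 ∷ 1 ∷ 2 ∷ 3 ∷ 4 ∷ 6 ∷ 7 ∷ 8 ∷ [])))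
        (leaf 0 (0 ∷ 2 ∷ 5 ∷ 6 ∷ [])))
       (leaf 0 (0 ∷ 2 ∷ 4 ∷ 6 ∷ []))))
     (split 3 8
      (split 4 8
       (split 2 8
        (split 5 8
         (leaf 2 (0 ∷ 1 ∷ 2 ∷ 3 ∷ 4 ∷ 5 ∷ 8 ∷ 6 ∷ 7 ∷ []))
         (leaf 3 (0 ∷ 3 ∷ 2 ∷ 1 ∷ 5 ∷ 4 ∷ 8 ∷ 6 ∷ 7 ∷ [])))
        (split 5 8
         (leaf 3 (0 ∷ 4 ∷ 3 ∷ 2 ∷ 1 ∷ 5 ∷ 8 ∷ 6 ∷ 7 ∷ []))
         (leaf 0 (0 ∷ 2 ∷ 5 ∷ 8 ∷ []))))
       (leaf 0 (0 ∷ 1 ∷ 4 ∷ 8 ∷ [])))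
      (leaf 0 (0 ∷ 1 ∷ 3 ∷ 8 ∷ []))))
    (split 3 7
     (split 4 7
      (split 2 7
       (split 5 7
        (leaf 2 (0 ∷ 1 ∷ 2 ∷ 3 ∷ 4 ∷ 5 ∷ 7 ∷ 6 ∷ 8 ∷ []))
        (leaf 3 (0 ∷ 3 ∷ 2 ∷ 1 ∷ 5 ∷ 4 ∷ 7 ∷ 6 ∷ 8 ∷ [])))
       (split 5 7
        (leaf 3 (0 ∷ 4 ∷ 3 ∷ 2 ∷ 1 ∷ 5 ∷ 7 ∷ 6 ∷ 8 ∷ []))
        (leaf 0 (0 ∷ 2 ∷ 5 ∷ 7 ∷ []))))
      (leaf 0 (0 ∷ 1 ∷ 4 ∷ 7 ∷ [])))
     (leaf 0 (0 ∷ 1 ∷ 3 ∷ 7 ∷ []))))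
   (split 3 6
    (split 4 6
     (split 2 6
      (split 5 6
       (leaf 2 (0 ∷ 1 ∷ 2 ∷ 3 ∷ 4 ∷ 5 ∷ 6 ∷ 7 ∷ 8 ∷ []))
       (leaf 3 (0 ∷ 3 ∷ 2 ∷ 1 ∷ 5 ∷ 4 ∷ 6 ∷ 7 ∷ 8 ∷ [])))
      (split 5 6
       (leaf 3 (0 ∷ 4 ∷ 3 ∷ 2 ∷ 1 ∷ 5 ∷ 6 ∷ 7 ∷ 8 ∷ []))
       (leaf 0 (0 ∷ 2 ∷ 5 ∷ 6 ∷ []))))
     (leaf 0 (0 ∷ 1 ∷ 4 ∷ 6 ∷ [])))
    (leaf 0 (0 ∷ 1 ∷ 3 ∷ 6 ∷ []))))

wheel : Facts
wheel = pattern-facts 6 ((1 , 3) ∷ (1 , 4) ∷ (2 , 4) ∷ (2 , 5) ∷ (3 , 5) ∷ []) []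

-- The pairs of nonadjacent vertices that might spoil the cliques of a cover.
conflict-C₅ : Facts
conflict-C₅ = pattern-facts 6 ((1 , 2) ∷ (1 , 5) ∷ (2 , 3) ∷ (3 , 4) ∷ (4 , 5) ∷ []) ((2 , 4) ∷ (2 , 5) ∷
  (3 , 5) ∷ [])

conflict-C₅-refuted : Refuted (reducible-patterns ++ wheel ∷ []) conflict-C₅
conflict-C₅-refuted = refuted-by
  (split 2 4
   (split 2 5
    (split 3 5
     -- The complement of a 5-cycle is a 5-cycle, traversed in the order 1, 3, 5, 2, 4; here
     -- `leaf 13` is `wheel`.
     (leaf 13 (0 ∷ 1 ∷ 3 ∷ 5 ∷ 2 ∷ 4 ∷ []))
     (leaf 0 (0 ∷ 3 ∷ 4 ∷ 5 ∷ [])))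
    (leaf 0 (0 ∷ 1 ∷ 2 ∷ 5 ∷ [])))
   (leaf 0 (0 ∷ 2 ∷ 3 ∷ 4 ∷ [])))

conflict-P₆ : Facts
conflict-P₆ = pattern-facts 7 ((1 , 2) ∷ (1 , 5) ∷ (3 , 4) ∷ (4 , 6) ∷ (5 , 6) ∷ []) ((1 , 6) ∷ (2 , 5) ∷
  (3 , 6) ∷ [])

-- The nonadjacent pairs form the path 2, 1, 5, 6, 4, 3. An undecided pair that is nonadjacent
-- closes a triangle of the complement, hence a claw; otherwise `leaf 7` is the hub joined to the
-- complement of this path.
conflict-P₆-refuted : Refuted (reducible-patterns ++ wheel ∷ []) conflict-P₆
conflict-P₆-refuted = refuted-by
  (split 1 6
   (split 2 5
    (split 3 6
     (leaf 7 (5 ∷ 6 ∷ 4 ∷ 1 ∷ 2 ∷ 0 ∷ 3 ∷ []))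
     (leaf 0 (0 ∷ 3 ∷ 4 ∷ 6 ∷ [])))
    (leaf 0 (0 ∷ 1 ∷ 2 ∷ 5 ∷ [])))
   (leaf 0 (0 ∷ 1 ∷ 5 ∷ 6 ∷ [])))

conflict-sparse : Facts
conflict-sparse = pattern-facts 7 ((1 , 2) ∷ (3 , 4) ∷ (5 , 6) ∷ []) ((2 , 5) ∷ (2 , 6) ∷ (3 , 5) ∷
  (3 , 6) ∷ [])

-- If some vertex is adjacent to both members of two of the nonadjacent pairs, these and the hub
-- form the join of K₂ and C₄. Otherwise the three pairs are linked to a path on six vertices in the
-- complement, or there is a claw.
conflict-sparse-refuted : Refuted (reducible-patterns ++ wheel ∷ []) conflict-sparse
conflict-sparse-refuted = refuted-by
  (split 2 5
   (split 2 6
    (leaf 2 (0 ∷ 1 ∷ 2 ∷ 5 ∷ 6 ∷ 4 ∷ []))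
    (split 3 5
     (leaf 2 (0 ∷ 1 ∷ 2 ∷ 3 ∷ 4 ∷ 5 ∷ []))
     (split 3 6
      (leaf 7 (5 ∷ 6 ∷ 2 ∷ 3 ∷ 4 ∷ 0 ∷ 1 ∷ []))
      (leaf 0 (0 ∷ 3 ∷ 5 ∷ 6 ∷ [])))))
   (split 2 6
    (split 3 6
     (leaf 2 (0 ∷ 1 ∷ 2 ∷ 3 ∷ 4 ∷ 6 ∷ []))
     (split 3 5
      (leaf 7 (5 ∷ 6 ∷ 3 ∷ 2 ∷ 1 ∷ 0 ∷ 4 ∷ []))
      (leaf 0 (0 ∷ 3 ∷ 5 ∷ 6 ∷ []))))
    (leaf 0 (0 ∷ 2 ∷ 5 ∷ 6 ∷ []))))

conflict-C₅′ : Facts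
conflict-C₅′ = pattern-facts 6 ((1 , 4) ∷ (1 , 5) ∷ (2 , 3) ∷ (2 , 4) ∷ (3 , 5) ∷ []) ((2 , 5) ∷ (3 , 4) ∷
  (4 , 5) ∷ [])

conflict-C₅′-refuted : Refuted (reducible-patterns ++ wheel ∷ []) conflict-C₅′
conflict-C₅′-refuted = refuted-by
  (split 2 5
   (split 3 4
    (split 4 5
     (leaf 13 (0 ∷ 1 ∷ 2 ∷ 5 ∷ 4 ∷ 3 ∷ []))
     (leaf 0 (0 ∷ 1 ∷ 4 ∷ 5 ∷ [])))
    (leaf 0 (0 ∷ 2 ∷ 3 ∷ 4 ∷ [])))
   (leaf 0 (0 ∷ 2 ∷ 3 ∷ 5 ∷ [])))

-- Neighbourhoods in minimal uncolourable sets

module QuasiLineness {n m} (G : Graph n) (clawFree : ClawFree G) (L : Fin n → Subset m) (k : ℕ) (8≤k : 8 ≤ k)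
  (list-size : ∀ v → ∣ L v ∣ ≡ k) (deg≤ : ∀ v → Graph.deg G v ≤ suc k) (S : Subset n)
  (uncolourable : ¬ ColourableOn G L S) (minimal : ∀ {T} → T ⊂ S → ¬ ¬ ColourableOn G L T)
  where
  open Graph G
  open Critical G L k list-size deg≤ S uncolourable minimal
  open Soundness _~_ _~?_ ~-sym ~-irrefl (_∈ S)

  claw-forbidden : Forbidden claw
  claw-forbidden ρ _ (h₁ ∷ h₂ ∷ h₃ ∷ n₁₂ ∷ n₁₃ ∷ n₂₃ ∷ []) =
    clawFree (ρ ∘ toℕ , injective , λ u v → mk⇔ (to u v) (from u v))
    where
    H = K 1 3
    leaf~ : ∀ i → ρ 0 ~ ρ (suc (toℕ {3} i))
    leaf~ zero = h₁
    leaf~ (suc zero) = h₂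
    leaf~ (suc (suc zero)) = h₃
    leaf≁ : ∀ i j → i ≢ j → NonAdjacent (ρ (suc (toℕ {3} i))) (ρ (suc (toℕ {3} j)))
    leaf≁ zero zero i≢j = contradiction refl i≢j
    leaf≁ zero (suc zero) _ = n₁₂
    leaf≁ zero (suc (suc zero)) _ = n₁₃
    leaf≁ (suc zero) zero _ = ⟦⟧-sym non n₁₂
    leaf≁ (suc zero) (suc zero) i≢j = contradiction refl i≢j
    leaf≁ (suc zero) (suc (suc zero)) _ = n₂₃
    leaf≁ (suc (suc zero)) zero _ = ⟦⟧-sym non n₁₃
    leaf≁ (suc (suc zero)) (suc zero) _ = ⟦⟧-sym non n₂₃
    leaf≁ (suc (suc zero)) (suc (suc zero)) i≢j = contradiction refl i≢j
    injective : ∀ {u v} → ρ (toℕ {4} u) ≡ ρ (toℕ v) → u ≡ v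
    injective {zero} {zero} eq = refl
    injective {zero} {suc j} eq = contradiction (leaf~ j) (~-irrefl eq)
    injective {suc i} {zero} eq = contradiction (leaf~ i) (~-irrefl (sym eq))
    injective {suc i} {suc j} eq with i ≟ j
    ... | yes refl = refl
    ... | no i≢j   = contradiction eq (proj₁ (leaf≁ i j i≢j))
    to : ∀ u v → Graph._~_ H u v → ρ (toℕ u) ~ ρ (toℕ v)
    to zero zero p≢p = contradiction refl p≢p
    to zero (suc j) _ = leaf~ j
    to (suc i) zero _ = ~-sym (leaf~ i)
    to (suc i) (suc j) p≢p = contradiction refl p≢p
    from : ∀ u v → ρ (toℕ u) ~ ρ (toℕ v) → Graph._~_ H u v
    from zero zero v~v = contradiction v~v (~-irrefl refl)
    from zero (suc j) _ ()
    from (suc i) zero _ ()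
    from (suc i) (suc j) i~j with i ≟ j
    ... | yes refl = contradiction i~j (~-irrefl refl)
    ... | no i≢j   = contradiction i~j (proj₂ (leaf≁ i j i≢j))

  reducible-forbidden : All Forbidden reducible-patterns
  reducible-forbidden = claw-forbidden ∷ All.map⁺ (All.map
    (λ {C} → configuration-forbidden C) configurations-reducible)

  wheel-full-forbidden : Forbidden wheel-full
  wheel-full-forbidden = refuted-forbidden escapes reducible-forbidden wheel-full-refuted

  thickened-forbidden : All Forbidden thickened-patterns
  thickened-forbidden = All.++⁺ reducible-forbidden
    ( refuted-forbidden escapes reducible-forbidden thickening-31111-refuted
    ∷ refuted-forbidden escapes reducible-forbidden thickening-22112-refuted
    ∷ refuted-forbidden escapes reducible-forbidden thickening-12212-refuted
    ∷ refuted-forbidden escapes reducible-forbidden co-wagner-refuted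
    ∷ wheel-full-forbidden ∷ [])

  wheel-four-forbidden : Forbidden wheel-four
  wheel-four-forbidden = refuted-forbidden escapes thickened-forbidden wheel-four-refuted

  wheel-three-forbidden : Forbidden wheel-three
  wheel-three-forbidden = refuted-forbidden escapes (All.++⁺ thickened-forbidden (wheel-four-forbidden ∷ []))
    wheel-three-refuted

  wheel-eight-forbidden : Forbidden wheel-eight
  wheel-eight-forbidden = refuted-forbidden escapes
    (claw-forbidden ∷ wheel-full-forbidden ∷ wheel-four-forbidden ∷ wheel-three-forbidden ∷ [])
    wheel-eight-refuted

  -- Names beyond the list go to `d`, since `Forbidden` asks for all names to denote vertices of S.
  assign : Fin n → List (Fin n) → ℕ → Fin n
  assign d [] i = d
  assign d (x ∷ xs) zero = x
  assign d (x ∷ xs) (suc i) = assign d xs i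

  assign∈S : ∀ {d xs} → d ∈ S → All (_∈ S) xs → ∀ i → assign d xs i ∈ S
  assign∈S d∈S [] i = d∈S
  assign∈S d∈S (x∈S ∷ _) zero = x∈S
  assign∈S d∈S (_ ∷ xs∈S) (suc i) = assign∈S d∈S xs∈S i

  wheel-forbidden : Forbidden wheel
  wheel-forbidden ρ ρ∈S
    (h₁ ∷ h₂ ∷ h₃ ∷ h₄ ∷ h₅ ∷ c₁₂ ∷ c₁₃ ∷ c₁₄ ∷ c₁₅ ∷ c₂₃ ∷ c₂₄ ∷ c₂₅ ∷ c₃₄ ∷ c₃₅ ∷ c₄₅ ∷ [])
    = found others (∖-unique _≟_ rim (neighbourhood-unique (ρ 0))) three others⁻
    where
    rim others : List (Fin n)
    rim = ρ 1 ∷ ρ 2 ∷ ρ 3 ∷ ρ 4 ∷ ρ 5 ∷ []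
    others = _∖_ _≟_ (neighbourhood (ρ 0)) rim
    three : 3 ≤ length others
    -- The hub has at least k ≥ 8 neighbours in S, and the rim accounts for five of them.
    three = ℕ.+-cancelʳ-≤ 5 3 _ (ℕ.≤-trans 8≤k (ℕ.≤-trans (minimum-degree (ρ∈S 0))
      (length-∖ _≟_ rim (neighbourhood-unique (ρ 0)))))
    Other : Fin n → Set
    Other z = ρ 0 ~ z × z ∈ S × All (_≢ z) rim
    others⁻ : ∀ {z} → z ∈ˡ others → Other z
    others⁻ z∈ with z∈nb , z∉ ← ∈-∖⁻ _≟_ (neighbourhood (ρ 0)) rim z∈ with 0~z , z∈S ← ∈-neighbourhood⁻ z∈nb =
      0~z , z∈S , All.tabulate λ { u∈ refl → z∉ u∈ }
    found : ∀ zs → Unique zs → 3 ≤ length zs → (∀ {z} → z ∈ˡ zs → Other z) → ⊥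
    found (_ ∷ []) _ (s≤s ()) _
    found (_ ∷ _ ∷ []) _ (s≤s (s≤s ())) _
    found (z₁ ∷ z₂ ∷ z₃ ∷ _) ((z₁≢z₂ ∷ z₁≢z₃ ∷ _) ∷ (z₂≢z₃ ∷ _) ∷ _) _ other
      with h₆ , z₁∈S , (p₁ ∷ p₂ ∷ p₃ ∷ p₄ ∷ p₅ ∷ []) ← other (here refl)
      with h₇ , z₂∈S , (q₁ ∷ q₂ ∷ q₃ ∷ q₄ ∷ q₅ ∷ []) ← other (there (here refl))
      with h₈ , z₃∈S , (r₁ ∷ r₂ ∷ r₃ ∷ r₄ ∷ r₅ ∷ []) ← other (there (there (here refl))) =
      wheel-eight-forbidden (assign (ρ 0) (ρ 0 ∷ rim ++ z₁ ∷ z₂ ∷ z₃ ∷ []))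
        (assign∈S (ρ∈S 0) (ρ∈S 0 ∷ ρ∈S 1 ∷ ρ∈S 2 ∷ ρ∈S 3 ∷ ρ∈S 4 ∷ ρ∈S 5 ∷ z₁∈S ∷ z₂∈S ∷ z₃∈S ∷ []))
        (h₁ ∷ h₂ ∷ h₃ ∷ h₄ ∷ h₅ ∷ h₆ ∷ h₇ ∷ h₈ ∷
         c₁₂ ∷ c₁₃ ∷ c₁₄ ∷ c₁₅ ∷ p₁ ∷ q₁ ∷ r₁ ∷
         c₂₃ ∷ c₂₄ ∷ c₂₅ ∷ p₂ ∷ q₂ ∷ r₂ ∷
         c₃₄ ∷ c₃₅ ∷ p₃ ∷ q₃ ∷ r₃ ∷
         c₄₅ ∷ p₄ ∷ q₄ ∷ r₄ ∷ p₅ ∷ q₅ ∷ r₅ ∷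
         z₁≢z₂ ∷ z₁≢z₃ ∷ z₂≢z₃ ∷ [])

  conflict-forbidden : ∀ {F} → Refuted (reducible-patterns ++ wheel ∷ []) F → Forbidden F
  conflict-forbidden = refuted-forbidden escapes (All.++⁺ reducible-forbidden (wheel-forbidden ∷ []))

  nonadjacent? : ∀ u w → Dec (NonAdjacent u w)
  nonadjacent? u w = ¬? (u ≟ w) ×-dec ¬? (u ~? w)

  -- The complement of the neighbourhood of v is triangle-free by claw-freeness; a
  -- cover is a 2-colouring of it. The colour classes follow the distances from x
  -- in this complement, the far vertices being those at distance at least 3.
  Cover : Fin n → Set
  Cover v = ∃₂ λ (A B : Subset n) → IsClique A × IsClique B × (∀ {u} → u ∈ S → v ~ u → u ∈ A ⊎ u ∈ B)

  module _ {v} (v∈S : v ∈ S) where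

    Near : Fin n → Set
    Near u = v ~ u × u ∈ S

    near? : ∀ u → Dec (Near u)
    near? u = (v ~? u) ×-dec (u ∈? S)

    -- The double negation lets a refuted pattern with u and w nonadjacent be used directly;
    -- decidability removes it in `cover-by`.
    Complete : (Fin n → Set) → Set
    Complete P = ∀ {u w} → Near u → Near w → P u → P w → u ≢ w → ¬ ¬ u ~ w

    cover-by : {P : Fin n → Set} → Decidable P → Complete P → Complete (¬_ ∘ P) → Cover v
    cover-by {P} P? P-complete ¬P-complete =
      separation in? , separation out? ,
      (λ u∈ w∈ u≢w → let near-u , Pu = ∈-separation⁻ in? u∈ ; near-w , Pw = ∈-separation⁻ in? w∈ in
        decidable-stable (_ ~? _) (P-complete near-u near-w Pu Pw u≢w)) ,
      (λ u∈ w∈ u≢w → let near-u , Pu = ∈-separation⁻ out? u∈ ; near-w , Pw = ∈-separation⁻ out? w∈ in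
        decidable-stable (_ ~? _) (¬P-complete near-u near-w Pu Pw u≢w)) ,
      union
      where
      in? : Decidable (λ u → Near u × P u)
      in? u = near? u ×-dec P? u
      out? : Decidable (λ u → Near u × ¬ P u)
      out? u = near? u ×-dec ¬? (P? u)
      union : ∀ {u} → u ∈ S → v ~ u → u ∈ separation in? ⊎ u ∈ separation out?
      union {u} u∈S v~u with P? u
      ... | yes Pu = inj₁ (∈-separation⁺ in? ((v~u , u∈S) , Pu))
      ... | no ¬Pu = inj₂ (∈-separation⁺ out? ((v~u , u∈S) , ¬Pu))

    refute : ∀ {F} → Forbidden F → ∀ {us} → All Near us → All (FactHolds (assign v (v ∷ us))) F → ⊥
    refute F-forbidden near hs = F-forbidden _ (assign∈S v∈S (v∈S ∷ All.map proj₂ near)) hs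

    no-claw : ∀ {x u w} → Near x → Near u → Near w → NonAdjacent x u → NonAdjacent x w → u ≢ w → ¬ ¬ u ~ w
    no-claw near-x near-u near-w x≁u x≁w u≢w u≁w = refute claw-forbidden (near-x ∷ near-u ∷ near-w ∷ [])
      (proj₁ near-x ∷ proj₁ near-u ∷ proj₁ near-w ∷ x≁u ∷ x≁w ∷ (u≢w , u≁w) ∷ [])

    adjacent : ∀ {x u} → x ≢ u → ¬ NonAdjacent x u → x ~ u
    adjacent x≢u ¬x≁u = decidable-stable (_ ~? _) λ x≁u → ¬x≁u (x≢u , x≁u)

    module _ {x a} (near-x : Near x) (near-a : Near a) (x≁a : NonAdjacent x a) where

      Witness : Fin n → Fin n → Set
      Witness u t = Near t × NonAdjacent x t × ¬ u ~ t

      Far : Fin n → Set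
      Far u = x ~ u × ¬ ∃ (Witness u)

      far? : Decidable Far
      far? u = (x ~? u) ×-dec ¬? (any? λ t → near? t ×-dec nonadjacent? x t ×-dec ¬? (u ~? t))

      -- One class consists of the vertices at distance 1 or at least 3 from `x`, the other of `x`
      -- and those at distance 2. A nonadjacent pair at distance 2 either has a common predecessor
      -- at distance 1, giving a claw, or closes a 5-cycle of the complement through `x`.
      cover-independent : (∀ {y z} → Near y → Near z → Far y → Far z → y ≢ z → ¬ ¬ y ~ z) → Cover v
      cover-independent no-far-edge = cover-by (λ u → nonadjacent? x u ⊎-dec far? u) P-complete ¬P-complete
        where
        P-complete : Complete (λ u → NonAdjacent x u ⊎ Far u)
        P-complete near-u near-w (inj₁ x≁u) (inj₁ x≁w) u≢w = no-claw near-x near-u near-w x≁u x≁w u≢w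
        P-complete near-u near-w (inj₁ x≁u) (inj₂ far-w) u≢w u≁w = proj₂ far-w (_ , near-u , x≁u , u≁w ∘ ~-sym)
        P-complete near-u near-w (inj₂ far-u) (inj₁ x≁w) u≢w u≁w = proj₂ far-u (_ , near-w , x≁w , u≁w)
        P-complete near-u near-w (inj₂ far-u) (inj₂ far-w) u≢w = no-far-edge near-u near-w far-u far-w u≢w
        ¬P-complete : Complete (¬_ ∘ λ u → NonAdjacent x u ⊎ Far u)
        ¬P-complete {u} {w} near-u near-w ¬Pu ¬Pw u≢w u≁w with x ≟ u | x ≟ w
        ... | yes refl | _        = ¬Pw (inj₁ (u≢w , u≁w))
        ... | no _     | yes refl = ¬Pu (inj₁ (≢-sym u≢w , u≁w ∘ ~-sym))
        ... | no x≢u   | no x≢w   =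
          ¬Pu (inj₂ (x~u , λ (t , near-t , x≁t , u≁t) → ¬Pw (inj₂ (x~w , λ (t′ , near-t′ , x≁t′ , w≁t′) →
            conflict near-t x≁t u≁t near-t′ x≁t′ w≁t′))))
          where
          x~u : x ~ u
          x~u = adjacent x≢u (¬Pu ∘ inj₁)
          x~w : x ~ w
          x~w = adjacent x≢w (¬Pw ∘ inj₁)
          apart : ∀ {p q} → x ~ p → NonAdjacent x q → p ≢ q
          apart x~p x≁q refl = proj₂ x≁q x~p
          conflict : ∀ {t t′} → Near t → NonAdjacent x t → ¬ u ~ t → Near t′ → NonAdjacent x t′ → ¬ w ~ t′ → ⊥
          conflict {t} {t′} near-t x≁t u≁t near-t′ x≁t′ w≁t′ with t ≟ t′
          ... | yes refl = no-claw near-t near-u near-w (≢-sym (apart x~u x≁t) , u≁t ∘ ~-sym)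
                             (≢-sym (apart x~w x≁t) , w≁t′ ∘ ~-sym) u≢w u≁w
          ... | no t≢t′ = refute (conflict-forbidden conflict-C₅-refuted)
            (near-x ∷ near-t ∷ near-u ∷ near-w ∷ near-t′ ∷ [])
            (proj₁ near-x ∷ proj₁ near-t ∷ proj₁ near-u ∷ proj₁ near-w ∷ proj₁ near-t′ ∷
             x≁t ∷ x~u ∷ x~w ∷ x≁t′ ∷ (≢-sym (apart x~u x≁t) , u≁t ∘ ~-sym) ∷ ≢-sym (apart x~w x≁t) ∷ t≢t′ ∷
             (u≢w , u≁w) ∷ apart x~u x≁t′ ∷ (apart x~w x≁t′ , w≁t′) ∷ [])

      module _ {y z} (near-y : Near y) (near-z : Near z) (far-y : Far y) (far-z : Far z) (y≁z : NonAdjacent y z) where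

        far~ : ∀ {y u} → Far y → Near u → NonAdjacent x u → y ~ u
        far~ (_ , none) near-u x≁u = decidable-stable (_ ~? _) λ y≁u → none (_ , near-u , x≁u , y≁u)

        -- In the complement, xa and yz are edges with none between them. The classes are the
        -- nonneighbours of `x` or `z`, and the rest. Nonadjacent u and w in the first class give a
        -- claw or the path a, x, u, w, z, y of the complement, whose possible chord aw is ruled out
        -- by `none`; in the rest they form a third pair beside xa and yz.
        cover-dependent : (∀ {u} → Near u → NonAdjacent a u → NonAdjacent z u → ⊥) → Cover v
        cover-dependent none = cover-by (λ u → nonadjacent? x u ⊎-dec nonadjacent? z u) P-complete ¬P-complete
          where
          x~y = proj₁ far-y
          x~z = proj₁ far-z
          y~a = far~ far-y near-a x≁a
          z~a = far~ far-z near-a x≁a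
          crossing : ∀ {u w} → Near u → Near w → NonAdjacent x u → NonAdjacent z w → u ≢ w → ¬ ¬ u ~ w
          crossing {u} {w} near-u near-w x≁u z≁w u≢w u≁w =
            refute (conflict-forbidden conflict-P₆-refuted)
              (near-x ∷ near-a ∷ near-y ∷ near-z ∷ near-u ∷ near-w ∷ [])
              (proj₁ near-x ∷ proj₁ near-a ∷ proj₁ near-y ∷ proj₁ near-z ∷ proj₁ near-u ∷ proj₁ near-w ∷
               x≁a ∷ x~y ∷ x~z ∷ x≁u ∷ (λ { refl → proj₂ z≁w (~-sym x~z) }) ∷
               ~-sym y~a ∷ ~-sym z~a ∷ (λ { refl → none near-w (u≢w , u≁w) z≁w }) ∷
               adjacent (λ { refl → proj₂ z≁w z~a }) (λ a≁w → none near-w a≁w z≁w) ∷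
               y≁z ∷ y~u ∷ (λ { refl → u≁w (~-sym y~u) }) ∷ far~ far-z near-u x≁u ∷ z≁w ∷ (u≢w , u≁w) ∷ [])
            where
            y~u = far~ far-y near-u x≁u
          P-complete : Complete (λ u → NonAdjacent x u ⊎ NonAdjacent z u)
          P-complete near-u near-w (inj₁ x≁u) (inj₁ x≁w) u≢w = no-claw near-x near-u near-w x≁u x≁w u≢w
          P-complete near-u near-w (inj₁ x≁u) (inj₂ z≁w) u≢w = crossing near-u near-w x≁u z≁w u≢w
          P-complete near-u near-w (inj₂ z≁u) (inj₁ x≁w) u≢w u≁w = crossing near-w near-u x≁w z≁u (≢-sym u≢w) (u≁w ∘ ~-sym)
          P-complete near-u near-w (inj₂ z≁u) (inj₂ z≁w) u≢w = no-claw near-z near-u near-w z≁u z≁w u≢w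
          ¬P-complete : Complete (¬_ ∘ λ u → NonAdjacent x u ⊎ NonAdjacent z u)
          ¬P-complete {u} {w} near-u near-w ¬Pu ¬Pw u≢w u≁w with x ≟ u | x ≟ w | z ≟ u | z ≟ w
          ... | yes refl | _ | _ | _ = ¬Pw (inj₁ (u≢w , u≁w))
          ... | _ | yes refl | _ | _ = ¬Pu (inj₁ (≢-sym u≢w , u≁w ∘ ~-sym))
          ... | _ | _ | yes refl | _ = ¬Pw (inj₂ (u≢w , u≁w))
          ... | _ | _ | _ | yes refl = ¬Pu (inj₂ (≢-sym u≢w , u≁w ∘ ~-sym))
          ... | no x≢u | no x≢w | no z≢u | no z≢w =
            refute (conflict-forbidden conflict-sparse-refuted)
              (near-x ∷ near-a ∷ near-y ∷ near-z ∷ near-u ∷ near-w ∷ [])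
              (proj₁ near-x ∷ proj₁ near-a ∷ proj₁ near-y ∷ proj₁ near-z ∷ proj₁ near-u ∷ proj₁ near-w ∷
               x≁a ∷ x~y ∷ x~z ∷ x~u ∷ x~w ∷
               ~-sym y~a ∷ ~-sym z~a ∷ (λ { refl → proj₂ x≁a x~u }) ∷ (λ { refl → proj₂ x≁a x~w }) ∷
               y≁z ∷ (λ { refl → proj₂ y≁z (~-sym z~u) }) ∷ (λ { refl → proj₂ y≁z (~-sym z~w) }) ∷
               z~u ∷ z~w ∷ (u≢w , u≁w) ∷ [])
            where
            x~u = adjacent x≢u (¬Pu ∘ inj₁)
            x~w = adjacent x≢w (¬Pw ∘ inj₁)
            z~u = adjacent z≢u (¬Pu ∘ inj₂)
            z~w = adjacent z≢w (¬Pw ∘ inj₂)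

      -- The roles of `y` and `z` can be exchanged, and one choice works: if u misses `a` and `z`
      -- while w misses `a` and `y`, then u = w gives a claw and u ≠ w gives the 5-cycle a, w, y, z,
      -- u of the complement.
      cover-far : ∀ {y z} → Near y → Near z → Far y → Far z → NonAdjacent y z → Cover v
      cover-far {y} {z} near-y near-z far-y far-z y≁z
        with any? (λ u → near? u ×-dec nonadjacent? a u ×-dec nonadjacent? z u)
      ... | no none = cover-dependent near-y near-z far-y far-z y≁z
        λ near-u a≁u z≁u → none (_ , near-u , a≁u , z≁u)
      ... | yes (u , near-u , a≁u , z≁u) = cover-dependent near-z near-y far-z far-y (⟦⟧-sym non y≁z) none
        where
        none : ∀ {w} → Near w → NonAdjacent a w → NonAdjacent y w → ⊥
        none {w} near-w a≁w y≁w with w ≟ u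
        ... | yes refl = no-claw near-w near-y near-z (⟦⟧-sym non y≁w) (⟦⟧-sym non z≁u) (proj₁ y≁z) (proj₂ y≁z)
        ... | no w≢u = refute (conflict-forbidden conflict-C₅′-refuted)
          (near-a ∷ near-y ∷ near-z ∷ near-w ∷ near-u ∷ [])
          (proj₁ near-a ∷ proj₁ near-y ∷ proj₁ near-z ∷ proj₁ near-w ∷ proj₁ near-u ∷
           a~y ∷ a~z ∷ a≁w ∷ a≁u ∷ y≁z ∷ y≁w ∷ (λ { refl → proj₂ a≁u a~y }) ∷
           (λ { refl → proj₂ a≁w a~z }) ∷ z≁u ∷ w≢u ∷ [])
          where
          a~y = ~-sym (far~ near-y near-z far-y far-z y≁z far-y near-a x≁a)
          a~z = ~-sym (far~ near-y near-z far-y far-z y≁z far-z near-a x≁a)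

    cover : Cover v
    cover with any? (λ x → near? x ×-dec any? (λ a → near? a ×-dec nonadjacent? x a))
    ... | no none = cover-by (λ _ → yes tt)
      (λ near-u near-w _ _ u≢w u≁w → none (_ , near-u , _ , near-w , u≢w , u≁w)) (λ _ _ ¬P → contradiction tt ¬P)
    ... | yes (x , near-x , a , near-a , x≁a)
      with any? (λ y → near? y ×-dec far? near-x near-a x≁a y ×-dec
             any? (λ z → near? z ×-dec far? near-x near-a x≁a z ×-dec nonadjacent? y z))
    ...   | yes (y , near-y , far-y , z , near-z , far-z , y≁z) =
      cover-far near-x near-a x≁a near-y near-z far-y far-z y≁z
    ...   | no none = cover-independent near-x near-a x≁a
      λ near-y near-z far-y far-z y≢z y≁z → none (_ , near-y , far-y , _ , near-z , far-z , y≢z , y≁z)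

-- Degrees, cliques and choosability

deg≤Δ : (G : Graph n) → ∀ v → Graph.deg G v ≤ Graph.Δ G
deg≤Δ {n} G v = All.lookup (xs≤max 0 (map (Graph.deg G) (allFin n))) (∈-map⁺ (Graph.deg G) (∈-allFin v))

Δ≡ : (G : Graph n) → ∀ {d} → (∀ v → Graph.deg G v ≤ d) → ∀ v → d ≤ Graph.deg G v → Graph.Δ G ≡ d
Δ≡ {n} G bound v d≤ = ℕ.≤-antisym
  (max≤v⁺ z≤n (All.map⁺ (All.universal bound (allFin n))))
  (ℕ.≤-trans d≤ (deg≤Δ G v))

isClique? : (G : Graph n) → ∀ A → Dec (Graph.IsClique G A)
isClique? G A = map′ (λ f {u} {v} → f u v) (λ f u v → f {u} {v})
  (all? λ u → all? λ v → (u ∈? A) →-dec (v ∈? A) →-dec ¬? (u ≟ v) →-dec (Graph._~?_ G u v))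

containsComplete? : (G : Graph n) → ∀ k → Dec (Graph.ContainsComplete G k)
containsComplete? G k = anySubset? λ A → isClique? G A ×-dec (∣ A ∣ ℕ.≟ k)

module _ {n m} (G : Graph n) (L : Fin n → Subset m) where
  open Graph G

  IsColouring : (Fin n → Fin m) → Set
  IsColouring φ = (∀ v → φ v ∈ L v) × (∀ u v → u ~ v → φ u ≢ φ v)

  isColouring? : ∀ φ → Dec (IsColouring φ)
  isColouring? φ = all? (λ v → φ v ∈? L v) ×-dec all? (λ u → all? (λ v → (u ~? v) →-dec ¬? (φ u ≟ φ v)))

  isColouring-resp : ∀ {φ ψ} → (∀ v → φ v ≡ ψ v) → IsColouring φ → IsColouring ψ
  isColouring-resp φ≗ψ (φ∈L , proper) =
    (λ v → subst (_∈ L v) (φ≗ψ v) (φ∈L v)) ,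
    λ u v u~v eq → proper u v u~v (trans (φ≗ψ u) (trans eq (sym (φ≗ψ v))))

  -- Needed to leave the double negation at the end. The search runs over codes of functions, and
  -- transfer along pointwise equality replaces extensionality.
  colourable? : Dec (Colourable L)
  colourable? with any? {n = m ^ n} (λ c → isColouring? (finToFun c))
  ... | yes (c , φ∈L , proper) = yes (finToFun c , φ∈L , λ {u} {v} → proper u v)
  ... | no none = no λ (φ , φ∈L , proper) → none (funToFin φ ,
    isColouring-resp (λ v → sym (finToFun-funToFin φ v)) (φ∈L , λ u v → proper))

distinct-representatives : (L : Fin n → Subset m) → (∀ v → n ≤ ∣ L v ∣) →
  ∃ λ (φ : Fin n → Fin m) → (∀ v → φ v ∈ L v) × (∀ {u v} → φ u ≡ φ v → u ≡ v)
distinct-representatives {zero} L large = (λ ()) , (λ ()) , λ { {()} }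
distinct-representatives {suc n} {m} L large =
  let φ , φ∈L , φ-injective = distinct-representatives (L ∘ suc) (λ v → ℕ.≤-trans (ℕ.n≤1+n n) (large (suc v)))
  in extend φ φ∈L φ-injective (_∖_ _≟_ (elements (L zero)) (map φ (allFin n)))
       (∈-∖⁻ _≟_ (elements (L zero)) (map φ (allFin n))) (enough φ)
  where
  enough : (φ : Fin n → Fin m) → 1 ≤ length (_∖_ _≟_ (elements (L zero)) (map φ (allFin n)))
  enough φ = ℕ.+-cancelʳ-≤ n 1 (length unused) (begin
    suc n                                           ≤⟨ large zero ⟩
    ∣ L zero ∣                                      ≡⟨ length-elements (L zero) ⟨
    length (elements (L zero))                      ≤⟨ length-∖ _≟_ (map φ (allFin n)) (elements-unique (L zero)) ⟩
    length unused + length (map φ (allFin n))       ≡⟨ cong (length unused +_) (trans (length-map φ (allFin n)) (length-tabulate (λ (i : Fin n) → i))) ⟩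
    length unused + n                               ∎)
    where
    open ℕ.≤-Reasoning
    unused = _∖_ _≟_ (elements (L zero)) (map φ (allFin n))
  extend : (φ : Fin n → Fin m) → (∀ v → φ v ∈ L (suc v)) → (∀ {u v} → φ u ≡ φ v → u ≡ v) →
    ∀ cs → (∀ {c} → c ∈ˡ cs → c ∈ˡ elements (L zero) × c ∉ˡ map φ (allFin n)) → 1 ≤ length cs →
    ∃ λ (ψ : Fin (suc n) → Fin m) → (∀ v → ψ v ∈ L v) × (∀ {u v} → ψ u ≡ ψ v → u ≡ v)
  extend φ φ∈L φ-injective (c ∷ _) unused⁻ _ = ψ , ψ∈L , ψ-injective
    where
    c∉ : c ∉ˡ map φ (allFin n)
    c∉ = proj₂ (unused⁻ (here refl))
    ψ : Fin (suc n) → Fin m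
    ψ zero = c
    ψ (suc v) = φ v
    ψ∈L : ∀ v → ψ v ∈ L v
    ψ∈L zero = ∈-elements⁻ (L zero) (proj₁ (unused⁻ (here refl)))
    ψ∈L (suc v) = φ∈L v
    ψ-injective : ∀ {u v} → ψ u ≡ ψ v → u ≡ v
    ψ-injective {zero} {zero} _ = refl
    ψ-injective {zero} {suc v} eq = contradiction (subst (_∈ˡ map φ (allFin n)) (sym eq) (∈-map⁺ φ (∈-allFin v))) c∉
    ψ-injective {suc u} {zero} eq = contradiction (subst (_∈ˡ map φ (allFin n)) eq (∈-map⁺ φ (∈-allFin u))) c∉
    ψ-injective {suc u} {suc v} eq = cong suc (φ-injective eq)

-- Some choosability bound is required to start the descent to the list chromatic number; this one
-- is enough.
choosable-order : (G : Graph n) → Graph.Choosable G n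
choosable-order G L sizes with φ , φ∈L , φ-injective ← distinct-representatives L (λ v → ℕ.≤-reflexive (sym (sizes v))) =
  φ , φ∈L , λ u~v eq → Graph.~-irrefl G (φ-injective eq) u~v

-- Choosability quantifies over all palettes and comes with no decision procedure here, so its least
-- value is obtained only up to double negation.
¬¬-least : (P : ℕ → Set) → ∀ {k} → P k → ¬ ¬ ∃ λ l → P l × (∀ j → P j → l ≤ j)
¬¬-least P {k} Pk no-least = <-rec (λ k → ¬ P k) step k Pk
  where
  step : ∀ k → (∀ {j} → j < k → ¬ P j) → ¬ P k
  step k below Pk = no-least (k , Pk , λ j Pj → ℕ.≮⇒≥ λ j<k → below j<k Pj)

choosable-mono : (G : Graph n) → ∀ {c k} → c ≤ k → Graph.Choosable G c → Graph.Choosable G k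
choosable-mono {n} G {c} {k} c≤k choosable {m} L sizes = widen (choosable sublist sublist-size)
  where
  smaller : ∀ v → ∃ λ A → A ⊆ L v × ∣ A ∣ ≡ c
  smaller v = subset-of-size c (L v) (subst (c ≤_) (sym (sizes v)) c≤k)
  sublist : Fin n → Subset m
  sublist v = proj₁ (smaller v)
  sublist-size : ∀ v → ∣ sublist v ∣ ≡ c
  sublist-size v = proj₂ (proj₂ (smaller v))
  widen : Graph.Colourable G sublist → Graph.Colourable G L
  widen (φ , φ∈ , φ-proper) = φ , (λ v → proj₁ (proj₂ (smaller v)) (φ∈ v)) , φ-proper

-- Vertices outside S stay as isolated vertices, which spares a reindexing.
restrict : Graph n → Subset n → Graph n
restrict G S = record
  { _~_      = λ u v → u ∈ S × v ∈ S × u ~ v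
  ; _~?_     = λ u v → (u ∈? S) ×-dec (v ∈? S) ×-dec (u ~? v)
  ; ~-sym    = λ (u∈S , v∈S , u~v) → v∈S , u∈S , ~-sym u~v
  ; ~-irrefl = λ u≡v (_ , _ , u~v) → ~-irrefl u≡v u~v
  }
  where open Graph G

deg-mono : (G H : Graph n) → (∀ {u v} → Graph._~_ G u v → Graph._~_ H u v) → ∀ v → Graph.deg G v ≤ Graph.deg H v
deg-mono G H sub v = subst (_≤ Graph.deg H v) (length-elements (Graph.N G v))
  (unique-length≤∣∣ (Graph.N H v) (elements-unique (Graph.N G v)) λ u∈ →
    ∈-separation⁺ (Graph._~?_ H v) (sub (∈-separation⁻ (Graph._~?_ G v) (∈-elements⁻ (Graph.N G v) u∈))))

clique-of-size : (G : Graph n) → ∀ {k} A → Graph.IsClique G A → k ≤ ∣ A ∣ → Graph.ContainsComplete G k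
clique-of-size G A clique k≤ with B , B⊆A , eq ← subset-of-size _ A k≤ = B , (λ u∈ v∈ → clique (B⊆A u∈) (B⊆A v∈)) , eq

-- Disjoint unions

module DisjointUnion {n m} (G : Graph n) (H : Graph m) where
  private
    module G = Graph G
    module H = Graph H

  Adjacent : Fin n ⊎ Fin m → Fin n ⊎ Fin m → Set
  Adjacent (inj₁ u) (inj₁ v) = u G.~ v
  Adjacent (inj₂ u) (inj₂ v) = u H.~ v
  Adjacent _        _        = ⊥

  adjacent? : ∀ x y → Dec (Adjacent x y)
  adjacent? (inj₁ u) (inj₁ v) = u G.~? v
  adjacent? (inj₁ u) (inj₂ v) = no λ ()
  adjacent? (inj₂ u) (inj₁ v) = no λ ()
  adjacent? (inj₂ u) (inj₂ v) = u H.~? v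

  adjacent-sym : ∀ x y → Adjacent x y → Adjacent y x
  adjacent-sym (inj₁ u) (inj₁ v) u~v = G.~-sym u~v
  adjacent-sym (inj₂ u) (inj₂ v) u~v = H.~-sym u~v

  adjacent-irrefl : ∀ x → ¬ Adjacent x x
  adjacent-irrefl (inj₁ u) = G.~-irrefl refl
  adjacent-irrefl (inj₂ u) = H.~-irrefl refl

  union : Graph (n + m)
  union = record
    { _~_      = λ u v → Adjacent (splitAt n u) (splitAt n v)
    ; _~?_     = λ u v → adjacent? (splitAt n u) (splitAt n v)
    ; ~-sym    = λ {u} {v} → adjacent-sym (splitAt n u) (splitAt n v)
    ; ~-irrefl = λ { {u} refl → adjacent-irrefl (splitAt n u) }
    }

  open Graph union

  data View : Fin (n + m) → Set where
    left  : ∀ u → View (u ↑ˡ m)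
    right : ∀ u → View (n ↑ʳ u)

  view : ∀ u → View u
  view u with splitAt n u in eq
  ... | inj₁ v = subst View (splitAt⁻¹-↑ˡ {i = u} eq) (left v)
  ... | inj₂ v = subst View (splitAt⁻¹-↑ʳ {i = u} eq) (right v)

  left~⁺ : ∀ {u v} → u G.~ v → (u ↑ˡ m) ~ (v ↑ˡ m)
  left~⁺ {u} {v} = subst₂ Adjacent (sym (splitAt-↑ˡ n u m)) (sym (splitAt-↑ˡ n v m))

  left~⁻ : ∀ {u v} → (u ↑ˡ m) ~ (v ↑ˡ m) → u G.~ v
  left~⁻ {u} {v} = subst₂ Adjacent (splitAt-↑ˡ n u m) (splitAt-↑ˡ n v m)

  right~⁺ : ∀ {u v} → u H.~ v → (n ↑ʳ u) ~ (n ↑ʳ v)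
  right~⁺ {u} {v} = subst₂ Adjacent (sym (splitAt-↑ʳ n m u)) (sym (splitAt-↑ʳ n m v))

  right~⁻ : ∀ {u v} → (n ↑ʳ u) ~ (n ↑ʳ v) → u H.~ v
  right~⁻ {u} {v} = subst₂ Adjacent (splitAt-↑ʳ n m u) (splitAt-↑ʳ n m v)

  right≁left : ∀ {u v} → ¬ (n ↑ʳ u) ~ (v ↑ˡ m)
  right≁left {u} {v} = subst₂ Adjacent (splitAt-↑ʳ n m u) (splitAt-↑ˡ n v m)

  left≁right : ∀ {u v} → ¬ (u ↑ˡ m) ~ (n ↑ʳ v)
  left≁right u~v = right≁left (~-sym u~v)

  deg-left : ∀ u → deg (u ↑ˡ m) ≤ G.deg u
  deg-left u = ℕ.≤-trans (∣∣≤length (N (u ↑ˡ m)) (map (_↑ˡ m) (elements (G.N u))) sub)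
    (ℕ.≤-reflexive (trans (length-map (_↑ˡ m) (elements (G.N u))) (length-elements (G.N u))))
    where
    sub : ∀ {x} → x ∈ N (u ↑ˡ m) → x ∈ˡ map (_↑ˡ m) (elements (G.N u))
    sub {x} x∈ with u~x ← ∈-separation⁻ ((u ↑ˡ m) ~?_) x∈ with view x
    ... | left v  = ∈-map⁺ (_↑ˡ m) (∈-elements⁺ (∈-separation⁺ (u G.~?_) (left~⁻ u~x)))
    ... | right v = contradiction u~x left≁right

  deg-right : ∀ u → deg (n ↑ʳ u) ≤ H.deg u
  deg-right u = ℕ.≤-trans (∣∣≤length (N (n ↑ʳ u)) (map (n ↑ʳ_) (elements (H.N u))) sub)
    (ℕ.≤-reflexive (trans (length-map (n ↑ʳ_) (elements (H.N u))) (length-elements (H.N u))))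
    where
    sub : ∀ {x} → x ∈ N (n ↑ʳ u) → x ∈ˡ map (n ↑ʳ_) (elements (H.N u))
    sub {x} x∈ with u~x ← ∈-separation⁻ ((n ↑ʳ u) ~?_) x∈ with view x
    ... | left v  = contradiction u~x right≁left
    ... | right v = ∈-map⁺ (n ↑ʳ_) (∈-elements⁺ (∈-separation⁺ (u H.~?_) (right~⁻ u~x)))

  deg-right≥ : ∀ u → H.deg u ≤ deg (n ↑ʳ u)
  deg-right≥ u = ℕ.≤-trans
    (ℕ.≤-reflexive (sym (trans (length-map (n ↑ʳ_) (elements (H.N u))) (length-elements (H.N u)))))
    (unique-length≤∣∣ (N (n ↑ʳ u)) (Unique.map⁺ (↑ʳ-injective n _ _) (elements-unique (H.N u))) sub)
    where
    sub : ∀ {x} → x ∈ˡ map (n ↑ʳ_) (elements (H.N u)) → x ∈ N (n ↑ʳ u)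
    sub x∈ with v , v∈ , refl ← ∈-map⁻ (n ↑ʳ_) x∈ =
      ∈-separation⁺ ((n ↑ʳ u) ~?_) (right~⁺ (∈-separation⁻ (u H.~?_) (∈-elements⁻ (H.N u) v∈)))

  image-left? : ∀ (A : Subset n) (u : Fin (n + m)) → Dec (∃ λ v → v ∈ A × v ↑ˡ m ≡ u)
  image-left? A u = any? (λ v → (v ∈? A) ×-dec (v ↑ˡ m ≟ u))

  image-right? : ∀ (B : Subset m) (u : Fin (n + m)) → Dec (∃ λ v → v ∈ B × n ↑ʳ v ≡ u)
  image-right? B u = any? (λ v → (v ∈? B) ×-dec (n ↑ʳ v ≟ u))

  image-left-clique : ∀ {A} → G.IsClique A → IsClique (separation (image-left? A))
  image-left-clique {A} clique x∈ y∈ x≢y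
    with u , u∈ , refl ← ∈-separation⁻ (image-left? A) x∈ | v , v∈ , refl ← ∈-separation⁻ (image-left? A) y∈ =
    left~⁺ (clique u∈ v∈ (x≢y ∘ cong (_↑ˡ m)))

  image-right-clique : ∀ {B} → H.IsClique B → IsClique (separation (image-right? B))
  image-right-clique {B} clique x∈ y∈ x≢y
    with u , u∈ , refl ← ∈-separation⁻ (image-right? B) x∈ | v , v∈ , refl ← ∈-separation⁻ (image-right? B) y∈ =
    right~⁺ (clique u∈ v∈ (x≢y ∘ cong (n ↑ʳ_)))

  union-quasiLine : G.QuasiLine → H.QuasiLine → QuasiLine
  union-quasiLine qG qH x with view x
  ... | left u with A , B , A-clique , B-clique , sub ← qG u =
    separation (image-left? A) , separation (image-left? B) , image-left-clique A-clique , image-left-clique B-clique , cover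
    where
    cover : N (u ↑ˡ m) ⊆ separation (image-left? A) ∪ separation (image-left? B)
    cover {y} y∈ with u~y ← ∈-separation⁻ ((u ↑ˡ m) ~?_) y∈ with view y
    ... | right v = contradiction u~y left≁right
    ... | left v with x∈p∪q⁻ A B (sub (∈-separation⁺ (u G.~?_) (left~⁻ u~y)))
    ...   | inj₁ v∈A = x∈p∪q⁺ (inj₁ (∈-separation⁺ (image-left? A) (v , v∈A , refl)))
    ...   | inj₂ v∈B = x∈p∪q⁺ (inj₂ (∈-separation⁺ (image-left? B) (v , v∈B , refl)))
  union-quasiLine qG qH x | right u with A , B , A-clique , B-clique , sub ← qH u =
    separation (image-right? A) , separation (image-right? B) , image-right-clique A-clique , image-right-clique B-clique , cover
    where
    cover : N (n ↑ʳ u) ⊆ separation (image-right? A) ∪ separation (image-right? B)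
    cover {y} y∈ with u~y ← ∈-separation⁻ ((n ↑ʳ u) ~?_) y∈ with view y
    ... | left v = contradiction u~y right≁left
    ... | right v with x∈p∪q⁻ A B (sub (∈-separation⁺ (u H.~?_) (right~⁻ u~y)))
    ...   | inj₁ v∈A = x∈p∪q⁺ (inj₁ (∈-separation⁺ (image-right? A) (v , v∈A , refl)))
    ...   | inj₂ v∈B = x∈p∪q⁺ (inj₂ (∈-separation⁺ (image-right? B) (v , v∈B , refl)))

  left≢right : ∀ {u v} → u ↑ˡ m ≢ n ↑ʳ v
  left≢right {u} {v} eq with () ← trans (sym (splitAt-↑ˡ n u m)) (trans (cong (splitAt n) eq) (splitAt-↑ʳ n m v))

  -- No edge joins the two sides, so a clique with a vertex on the right lies entirely on the right.
  union-complete : ∀ {k} → ContainsComplete k → G.ContainsComplete k ⊎ H.ContainsComplete k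
  union-complete {k} (A , clique , size) with any? (λ v → n ↑ʳ v ∈? A)
  ... | no none = inj₁ (clique-of-size G B B-clique (subst (_≤ ∣ B ∣) size (ℕ.≤-trans
      (∣∣≤length A (map (_↑ˡ m) (elements B)) sub)
      (ℕ.≤-reflexive (trans (length-map (_↑ˡ m) (elements B)) (length-elements B))))))
    where
    inside? : ∀ v → Dec (v ↑ˡ m ∈ A)
    inside? v = v ↑ˡ m ∈? A
    B : Subset n
    B = separation inside?
    B-clique : G.IsClique B
    B-clique u∈ v∈ u≢v = left~⁻ (clique (∈-separation⁻ inside? u∈) (∈-separation⁻ inside? v∈) (λ eq → u≢v (↑ˡ-injective m _ _ eq)))
    sub : ∀ {x} → x ∈ A → x ∈ˡ map (_↑ˡ m) (elements B)
    sub {x} x∈ with view x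
    ... | left v  = ∈-map⁺ (_↑ˡ m) (∈-elements⁺ (∈-separation⁺ inside? x∈))
    ... | right v = contradiction (v , x∈) none
  ... | yes (w , w∈) = inj₂ (clique-of-size H B B-clique (subst (_≤ ∣ B ∣) size (ℕ.≤-trans
      (∣∣≤length A (map (n ↑ʳ_) (elements B)) sub)
      (ℕ.≤-reflexive (trans (length-map (n ↑ʳ_) (elements B)) (length-elements B))))))
    where
    inside? : ∀ v → Dec (n ↑ʳ v ∈ A)
    inside? v = n ↑ʳ v ∈? A
    B : Subset m
    B = separation inside?
    B-clique : H.IsClique B
    B-clique u∈ v∈ u≢v = right~⁻ (clique (∈-separation⁻ inside? u∈) (∈-separation⁻ inside? v∈) (u≢v ∘ ↑ʳ-injective n _ _))
    sub : ∀ {x} → x ∈ A → x ∈ˡ map (n ↑ʳ_) (elements B)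
    sub {x} x∈ with view x
    ... | left v  = contradiction (clique x∈ w∈ left≢right) left≁right
    ... | right v = ∈-map⁺ (n ↑ʳ_) (∈-elements⁺ (∈-separation⁺ inside? x∈))

-- Two cliques with four and d + 5 further vertices that share the vertex zero,
-- whose degree d + 9 is the maximum degree.
bowtie : ∀ d → Graph (10 + d)
bowtie d = record
  { _~_      = λ i j → i ≢ j × Linked i j
  ; _~?_     = λ i j → ¬? (i ≟ j) ×-dec ((i ≟ zero) ⊎-dec (j ≟ zero) ⊎-dec (small i Bool.≟ small j))
  ; ~-sym    = λ (i≢j , linked) → ≢-sym i≢j , linked-sym linked
  ; ~-irrefl = λ i≡j (i≢j , _) → i≢j i≡j
  }
  where
  small : Fin (10 + d) → Bool
  small i = does (toℕ i ℕ.<? 5)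
  Linked : Fin (10 + d) → Fin (10 + d) → Set
  Linked i j = i ≡ zero ⊎ j ≡ zero ⊎ small i ≡ small j
  linked-sym : ∀ {i j} → Linked i j → Linked j i
  linked-sym (inj₁ eq) = inj₂ (inj₁ eq)
  linked-sym (inj₂ (inj₁ eq)) = inj₁ eq
  linked-sym (inj₂ (inj₂ eq)) = inj₂ (inj₂ (sym eq))

module _ (d : ℕ) where
  open Graph (bowtie d)

  -- The vertices below 5 and the remaining ones are two cliques that cover the whole graph, so the
  -- same pair serves every neighbourhood.
  bowtie-quasiLine : QuasiLine
  bowtie-quasiLine v = separation small? , separation large? , clique small? (λ s t → trans s (sym t)) ,
    clique large? (λ s t → trans s (sym t)) , λ {x} _ → x∈p∪q⁺ (cover x)
    where
    Size : Bool → Fin (10 + d) → Set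
    Size b i = does (toℕ i ℕ.<? 5) ≡ b
    small? : ∀ i → Dec (Size true i)
    small? i = does (toℕ i ℕ.<? 5) Bool.≟ true
    large? : ∀ i → Dec (Size false i)
    large? i = does (toℕ i ℕ.<? 5) Bool.≟ false
    clique : ∀ {P : Fin (10 + d) → Set} (P? : ∀ i → Dec (P i)) →
      (∀ {i j} → P i → P j → does (toℕ i ℕ.<? 5) ≡ does (toℕ j ℕ.<? 5)) → IsClique (separation P?)
    clique P? same i∈ j∈ i≢j = i≢j , inj₂ (inj₂ (same (∈-separation⁻ P? i∈) (∈-separation⁻ P? j∈)))
    cover : ∀ x → x ∈ separation small? ⊎ x ∈ separation large?
    cover x with does (toℕ x ℕ.<? 5) in eq
    ... | true  = inj₁ (∈-separation⁺ small? eq)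
    ... | false = inj₂ (∈-separation⁺ large? eq)

  bowtie-deg≤ : ∀ v → deg v ≤ 9 + d
  bowtie-deg≤ v = ℕ.+-cancelˡ-≤ 1 _ _ (subst₂ _≤_ (cong suc (length-elements (N v))) (length-tabulate {n = 10 + d} (λ i → i))
    (unique-⊆-length {xs = v ∷ elements (N v)} (All.tabulate v∉ ∷ elements-unique (N v)) (λ _ → ∈-allFin _)))
    where
    v∉ : ∀ {u} → u ∈ˡ elements (N v) → v ≢ u
    v∉ u∈ refl = ~-irrefl refl (∈-separation⁻ (v ~?_) (∈-elements⁻ (N v) u∈))

  bowtie-hub : 9 + d ≤ deg zero
  bowtie-hub = subst (_≤ deg zero) (trans (length-map suc (allFin (9 + d))) (length-tabulate {n = 9 + d} (λ i → i)))
    (unique-length≤∣∣ (N zero) (Unique.map⁺ suc-injective (Unique.allFin⁺ (9 + d))) sub)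
    where
    sub : ∀ {x} → x ∈ˡ map suc (allFin (9 + d)) → x ∈ N zero
    sub x∈ with i , _ , refl ← ∈-map⁻ suc x∈ = ∈-separation⁺ (zero ~?_) ((λ ()) , inj₁ refl)

  private
    one two five six : Fin (10 + d)
    one  = suc zero
    two  = suc (suc zero)
    five = suc (suc (suc (suc (suc zero))))
    six  = suc (suc (suc (suc (suc (suc zero)))))

  -- A clique contains neither both of 1 and 5 nor both of 2 and 6.
  bowtie-incomplete : ¬ ContainsComplete (9 + d)
  bowtie-incomplete (A , clique , size) =
    let p , p≡ , p∉ = missing one five (λ ()) λ { (inj₁ ()) ; (inj₂ (inj₁ ())) ; (inj₂ (inj₂ ())) }
        q , q≡ , q∉ = missing two six (λ ()) λ { (inj₁ ()) ; (inj₂ (inj₁ ())) ; (inj₂ (inj₂ ())) }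
    in ℕ.<-irrefl refl (subst₂ _≤_ (cong (2 +_) (trans (length-elements A) size)) (length-tabulate {n = 10 + d} (λ i → i))
      (unique-⊆-length {xs = p ∷ q ∷ elements A}
        ((p≢q p≡ q≡ ∷ All.tabulate (avoids p∉)) ∷ All.tabulate (avoids q∉) ∷ elements-unique A) (λ _ → ∈-allFin _)))
    where
    missing : ∀ i j → i ≢ j → ¬ (i ≡ zero ⊎ j ≡ zero ⊎ does (toℕ i ℕ.<? 5) ≡ does (toℕ j ℕ.<? 5)) →
      ∃ λ p → (p ≡ i ⊎ p ≡ j) × ¬ p ∈ A
    missing i j i≢j unlinked with i ∈? A | j ∈? A
    ... | no i∉   | _       = i , inj₁ refl , i∉
    ... | yes _   | no j∉   = j , inj₂ refl , j∉
    ... | yes i∈  | yes j∈  = contradiction (proj₂ (clique i∈ j∈ i≢j)) unlinked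
    p≢q : ∀ {p q} → p ≡ one ⊎ p ≡ five → q ≡ two ⊎ q ≡ six → p ≢ q
    p≢q (inj₁ refl) (inj₁ ()) refl
    p≢q (inj₁ refl) (inj₂ ()) refl
    p≢q (inj₂ refl) (inj₁ ()) refl
    p≢q (inj₂ refl) (inj₂ ()) refl
    avoids : ∀ {p u} → ¬ p ∈ A → u ∈ˡ elements A → p ≢ u
    avoids p∉ u∈ refl = p∉ (∈-elements⁻ A u∈)

-- The reduction to quasi-line graphs

open Graph using (Δ; QuasiLine; IsListChromaticNumber; ContainsComplete)

QuasiLineTheorem : Set₁
QuasiLineTheorem = ∀ (n : ℕ) (G : Graph n) → QuasiLine G →
  ∀ (χₗ : ℕ) → IsListChromaticNumber G χₗ →
  χₗ ≥ Δ G → Δ G ≥ 9 → ContainsComplete G (Δ G)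

module _ {n m d} (G : Graph (suc n)) (Δ≡9+d : 9 + d ≡ Δ G) (L : Fin (suc n) → Subset m)
  (sizes : ∀ v → ∣ L v ∣ ≡ 8 + d) (S : Subset (suc n)) where

  private
    module G = Graph G
    module R = Graph (restrict G S)

  -- The bow tie raises the maximum degree to exactly 9 + d; without it, Brooks'
  -- theorem would be needed where the maximum degree of R is 8 + d.
  quasi-line-case : QuasiLineTheorem → R.QuasiLine → ¬ ContainsComplete G (9 + d) → ¬ ¬ ColourableOn G L S
  quasi-line-case theorem R-quasiLine none uncolourable =
    ¬¬-least H.Choosable (choosable-order union) λ (χ , isχ) →
      contradiction (subst H.ContainsComplete ΔH (theorem _ union quasiLine χ isχ
        (subst (χ ≥_) (sym ΔH) (ℕ.≮⇒≥ λ { (s≤s χ≤) → not-choosable (choosable-mono union χ≤ (proj₁ isχ)) }))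
        (subst (_≥ 9) (sym ΔH) (ℕ.m≤m+n 9 d)))) incomplete
    where
    open DisjointUnion (restrict G S) (bowtie d)
    module H = Graph union
    quasiLine : H.QuasiLine
    quasiLine = union-quasiLine R-quasiLine (bowtie-quasiLine d)
    deg≤ : ∀ v → H.deg v ≤ 9 + d
    deg≤ v with view v
    ... | left u  = ℕ.≤-trans (deg-left u) (ℕ.≤-trans (deg-mono (restrict G S) G (proj₂ ∘ proj₂) u)
                      (ℕ.≤-trans (deg≤Δ G u) (ℕ.≤-reflexive (sym Δ≡9+d))))
    ... | right u = ℕ.≤-trans (deg-right u) (bowtie-deg≤ d u)
    ΔH : Δ union ≡ 9 + d
    ΔH = Δ≡ union deg≤ (suc n ↑ʳ zero) (ℕ.≤-trans (bowtie-hub d) (deg-right≥ zero))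
    L′ : Fin (suc n) ⊎ Fin (10 + d) → Subset m
    L′ (inj₁ u) = L u
    -- Any list of size 8 + d serves on the bow tie; vertex `zero` of `G` provides one.
    L′ (inj₂ _) = L zero
    sizes′ : ∀ x → ∣ L′ x ∣ ≡ 8 + d
    sizes′ (inj₁ u) = sizes u
    sizes′ (inj₂ _) = sizes zero
    not-choosable : ¬ H.Choosable (8 + d)
    not-choosable choosable = uncolourable
      ( (λ u → φ (u ↑ˡ _))
      , (λ {u} _ → subst (λ x → φ (u ↑ˡ _) ∈ L′ x) (splitAt-↑ˡ (suc n) u _) (φ∈L (u ↑ˡ _)))
      , λ u∈S v∈S u~v → φ-proper (left~⁺ (u∈S , v∈S , u~v)))
      where
      colouring = choosable (L′ ∘ splitAt (suc n)) (sizes′ ∘ splitAt (suc n))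
      φ = proj₁ colouring
      φ∈L = proj₁ (proj₂ colouring)
      φ-proper = proj₂ (proj₂ colouring)
    incomplete : ¬ H.ContainsComplete (9 + d)
    incomplete complete with union-complete complete
    ... | inj₁ (A , clique , size) = none (A , (λ u∈ v∈ u≢v → proj₂ (proj₂ (clique u∈ v∈ u≢v))) , size)
    ... | inj₂ complete-bowtie = bowtie-incomplete d complete-bowtie

  minimal-quasiLine : ClawFree G → ¬ ColourableOn G L S → (∀ {T} → T ⊂ S → ¬ ¬ ColourableOn G L T) → R.QuasiLine
  minimal-quasiLine clawFree uncolourable minimal v = decide (v ∈? S)
    where
    open QuasiLineness G clawFree L (8 + d) (ℕ.m≤m+n 8 d) sizes
      (λ v → ℕ.≤-trans (deg≤Δ G v) (ℕ.≤-reflexive (sym Δ≡9+d))) S uncolourable minimal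
    in? : ∀ A u → Dec (u ∈ A × u ∈ S)
    in? A u = (u ∈? A) ×-dec (u ∈? S)
    restricted : ∀ A → G.IsClique A → R.IsClique (separation (in? A))
    restricted A clique u∈ v∈ u≢v =
      let u∈A , u∈S = ∈-separation⁻ (in? A) u∈ ; v∈A , v∈S = ∈-separation⁻ (in? A) v∈
      in u∈S , v∈S , clique u∈A v∈A u≢v
    restricted-cover : ∀ A B → (∀ {u} → u ∈ S → v G.~ u → u ∈ A ⊎ u ∈ B) →
      ∀ {u} → u ∈ R.N v → u ∈ separation (in? A) ∪ separation (in? B)
    restricted-cover A B covers u∈ with _ , u∈S , v~u ← ∈-separation⁻ (v R.~?_) u∈ with covers u∈S v~u
    ... | inj₁ u∈A = x∈p∪q⁺ (inj₁ (∈-separation⁺ (in? A) (u∈A , u∈S)))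
    ... | inj₂ u∈B = x∈p∪q⁺ (inj₂ (∈-separation⁺ (in? B) (u∈B , u∈S)))
    empty-clique : R.IsClique ⊥ˢ
    empty-clique u∈ = contradiction u∈ ∉⊥
    decide : Dec (v ∈ S) → ∃₂ λ A B → R.IsClique A × R.IsClique B × R.N v ⊆ A ∪ B
    decide (no v∉S) = ⊥ˢ , ⊥ˢ , empty-clique , empty-clique ,
      λ u∈ → contradiction (proj₁ (∈-separation⁻ (v R.~?_) u∈)) v∉S
    decide (yes v∈S) = let A , B , A-clique , B-clique , covers = cover v∈S in
      separation (in? A) , separation (in? B) , restricted A A-clique , restricted B B-clique ,
      restricted-cover A B covers

-- Well-founded induction on S takes the place of choosing a minimal uncolourable set: the induction
-- hypothesis is precisely minimality.
choosable-pred : QuasiLineTheorem → ∀ {n d} (G : Graph (suc n)) → ClawFree G → 9 + d ≡ Δ G →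
  ¬ ContainsComplete G (9 + d) → Graph.Choosable G (8 + d)
choosable-pred theorem {n} G clawFree Δ≡9+d none {m} L sizes = decidable-stable (colourable? G L) λ uncolourable →
  wfRec _ (λ S → ¬ ¬ ColourableOn G L S) step ⊤ λ (φ , φ∈L , φ-proper) →
    uncolourable (φ , (λ v → φ∈L ∈⊤) , φ-proper ∈⊤ ∈⊤)
  where
  open WellFounded.All (⊂-wellFounded {suc n}) using (wfRec)
  step : ∀ S → (∀ {T} → T ⊂ S → ¬ ¬ ColourableOn G L T) → ¬ ¬ ColourableOn G L S
  step S minimal uncolourable = quasi-line-case G Δ≡9+d L sizes S theorem
    (minimal-quasiLine G Δ≡9+d L sizes S clawFree uncolourable minimal) none uncolourable

theorem5p6 :
  (∀ (n : ℕ) (G : Graph n) → QuasiLine G →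
     ∀ (χₗ : ℕ) → IsListChromaticNumber G χₗ →
     χₗ ≥ Δ G → Δ G ≥ 9 → ContainsComplete G (Δ G)) →
  (∀ (n : ℕ) (G : Graph n) → ClawFree G →
     ∀ (χₗ : ℕ) → IsListChromaticNumber G χₗ →
     χₗ ≥ Δ G → Δ G ≥ 9 → ContainsComplete G (Δ G))
-- Order 0 needs no clause: the maximum degree then computes to 0, and `Δ G ≥ 9` is absurd.
theorem5p6 theorem (suc n) G clawFree χₗ (_ , least) χₗ≥Δ Δ≥9 = by-order (ℕ.m≤n⇒∃[o]m+o≡n Δ≥9)
  where
  by-order : (∃ λ d → 9 + d ≡ Δ G) → ContainsComplete G (Δ G)
  by-order (d , Δ≡9+d) = subst (ContainsComplete G) Δ≡9+d
    (decidable-stable (containsComplete? G (9 + d)) λ none →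
      ℕ.<-irrefl refl (ℕ.≤-trans (subst (_≤ χₗ) (sym Δ≡9+d) χₗ≥Δ)
        (least (8 + d) (choosable-pred theorem G clawFree Δ≡9+d none))))
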